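{- Let $\mathcal F\in\{\mathcal L,\mathcal C\}$, where $\mathcal L$ is the species of linear orders and $\mathcal C$ the species of cyclic permutations, and let $\mathcal A$ be a gargantuan (weighted) species of structures that can be represented as $\mathcal A=\mathcal F\circ\mathcal B$ for some (weighted) species of structures $\mathcal B$. Let $m,n\in\mathbb Z_{\ge0}$ and let $s\in\mathcal A$ be a random $\mathcal A$-structure on $[n]$. Then, with $m$ fixed and $n\to\infty$, $$\mathbb P(s\in\mathcal F_m\circ\mathcal B)\approx\sum_{k\ge0}\mathfrak d_{k,m}(\mathcal F)\cdot\binom nk\cdot\frac{\mathfrak a_{n-k}}{\mathfrak a_n},$$ where $\mathfrak a_n$, $\mathfrak d_{n,m}(\mathcal L)$ and $\mathfrak d_{n,m}(\mathcal C)$ are the total weights on the set $[n]$ of the (virtual) species $\mathcal A$, $m\,\mathcal B^{m-1}(\mathbf 1-\mathcal B)^2$ and $\mathcal B^{m-1}(\mathbf 1-\mathcal B)$, respectively.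
   Context: A species of structures $F$ assigns to each finite set $U$ a finite set $F[U]$ and to each bijection $\sigma:U\to V$ a map $F[\sigma]:F[U]\to F[V]$, functorially. In a weighted species every structure carries a weight $w(s)$ preserved by transport (and $F[U]$ is finite or summable); here weights are positive real numbers. An unweighted species has all weights $1$. Write $[n]=\{1,\dots,n\}$, $[0]=\emptyset$. The total weight of $F$ on $[n]$ is $\sum_{s\in F[[n]]}w(s)$, and $F(z)=\sum_n(\text{total weight on }[n])z^n/n!$. A random $F$-structure on $[n]$ equals $s$ with probability $w(s)$ divided by the total weight on $[n]$. Equality of species means (weight-preserving) isomorphism. $\mathcal L[U]$ is the set of linear orders on $U$ (including one on $\emptyset$); $\mathcal C[U]$ is the set of permutations of $U$ consisting of a single cycle (none for $U=\emptyset$). $\mathcal F_m$ is the restriction of $\mathcal F$ to sets of cardinality $m$. For $\mathcal B$ with $\mathcal B[\emptyset]=\emptyset$, an $(\mathcal F\circ\mathcal B)$-structure on $U$ consists of a partition $\pi$ of $U$ into nonempty blocks, an $\mathcal F$-structure on the set $\pi$, and a $\mathcal B$-structure on each block; weights multiply. $\mathbf 1$ is the species with a single structure (of weight 1), on the empty set only. The product $F\cdot G$ is the species of ordered pairs (an $F$-structure on $U_1$, a $G$-structure on $U_2$) with $U_1\sqcup U_2=U$, weights multiplying. Virtual species are formal differences of species, and total weights extend linearly. Thus for $m\ge1$ the exponential generating series of $(\mathfrak d_{n,m}(\mathcal L))_n$ and $(\mathfrak d_{n,m}(\mathcal C))_n$ are $m\mathcal B(z)^{m-1}(1-\mathcal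 B(z))^2$ and $\mathcal B(z)^{m-1}(1-\mathcal B(z))$. For $m=0$ both species are taken to be empty, so $\mathfrak d_{n,0}(\mathcal F)=0$. A sequence $(a_n)$ of real numbers with $a_n\ne0$ for all but finitely many $n$ is gargantuan if (i) $a_{n-1}/a_n\to0$ as $n\to\infty$ and (ii) for each $r\in\mathbb Z_{\ge0}$, $\sum_{k=r}^{n-r}|a_ka_{n-k}|=O(a_{n-r})$. $\mathcal A$ is gargantuan if $(\mathfrak a_n/n!)$ is gargantuan. Notation $\approx$: $p_n\approx\sum_{k\ge0}c_kg_k(n)$ (here $g_k(n)=\binom nk\mathfrak a_{n-k}/\mathfrak a_n$, for large $n$) means that $g_{k+1}(n)=o(g_k(n))$ for every $k$ and, for every integer $r\ge0$, $p_n=\sum_{k=0}^rc_kg_k(n)+O(g_{r+1}(n))$ as $n\to\infty$. -}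

module Defs where

open import Level using (Level; 0ℓ) renaming (_⊔_ to _⊔ˡ_; suc to lsuc)
open import Algebra.Apartness.Bundles using (HeytingField; HeytingCommutativeRing)
open import Algebra.Bundles using (CommutativeRing; CommutativeMonoid)
import Algebra.Definitions.RawMonoid as RawMonoid
import Algebra.Properties.CommutativeMonoid.Sum as MonoidSum
open import Data.Bool.Base using (Bool; true; false; not; T)
open import Data.Bool.Properties using (T?)
open import Data.Fin.Base using (Fin; zero; suc)
import Data.Fin.Properties as Fin
open import Data.Fin.Permutation using (Permutation; ↔⇒≡)
open import Data.List.Base using (List; []; _∷_; map; foldr; upTo; allFin; length; lookup; deduplicate)
open import Data.List.Membership.Propositional.Properties using (∈-allFin; ∈-lookup)
import Data.List.Membership.Setoid as Membership
open import Data.List.Membership.Setoid.Properties using (∈-deduplicate⁺)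
open import Data.List.Relation.Unary.All as All using (All)
open import Data.List.Relation.Unary.AllPairs using ([]; _∷_)
open import Data.List.Relation.Unary.Any as Any using (Any; here; there; index)
open import Data.List.Relation.Unary.Any.Properties as Any using (lookup-index)
import Data.List.Relation.Unary.Unique.Setoid as UniqueSetoid
open import Data.List.Relation.Unary.Unique.DecSetoid.Properties using (deduplicate-!)
open import Data.Nat.Base as ℕ using (ℕ; zero; suc; _∸_; _!; NonZero)
open import Data.Nat.Combinatorics using (_C_)
open import Data.Nat.GeneralisedArithmetic using (iterate)
open import Data.Nat.Properties using (_!≢0)
open import Data.Product.Base using (Σ; Σ-syntax; ∃; ∃-syntax; _×_; _,_; proj₁; proj₂)
open import Data.Sum.Base as Sum using (_⊎_; inj₁; inj₂)
open import Data.Sum.Relation.Binary.Pointwise using (_⊎ₛ_; inj₁; inj₂)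
open import Data.Unit.Base using (⊤; tt)
open import Data.Empty using (⊥)
open import Function.Base using (_∘_; id)
open import Function.Bundles using (Inverse; _⇔_; Equivalence)
import Function.Construct.Composition as Composition
import Function.Construct.Identity as Identity
import Function.Construct.Symmetry as Symmetry
open import Relation.Binary.Bundles using (Setoid; DecSetoid)
open import Relation.Binary.Core using (Rel)
open import Relation.Binary.Definitions using (Decidable)
import Relation.Binary.Construct.On as On
open import Relation.Binary.PropositionalEquality as ≡ using (_≡_; refl; cong; subst)
import Relation.Binary.Reasoning.Setoid as SetoidReasoning
open import Relation.Binary.Structures using (IsEquivalence; IsStrictPartialOrder; IsTotalOrder)
open import Relation.Nullary using (¬_; yes; no; contradiction)
open import Relation.Nullary.Decidable as Dec using ()

-- The real numbers, axiomatised as a Cauchy complete Archimedean ordered field.  Classically this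
-- determines ℝ up to isomorphism; the axioms are phrased (apartness instead of trichotomy,
-- binary maxima) so that they also hold for the constructive reals.

record RealNumbers (c ℓ₁ ℓ₂ : Level) : Set (lsuc (c ⊔ˡ ℓ₁ ⊔ˡ ℓ₂)) where
  field
    heytingField : HeytingField c ℓ₁ ℓ₂

  open HeytingField heytingField public
  open HeytingCommutativeRing heytingCommutativeRing public using (commutativeRing)

  infix  4 _<_ _≤_
  infixl 6 _⊔_

  field
    _<_                  : Rel Carrier ℓ₂
    isStrictPartialOrder : IsStrictPartialOrder _≈_ _<_
    #⇔<⊎>                : ∀ {x y} → x # y ⇔ (x < y ⊎ y < x)
    0<1                  : 0# < 1#
    +-monoʳ-<            : ∀ x {y z} → y < z → x + y < x + z
    *-pos                : ∀ {x y} → 0# < x → 0# < y → 0# < x * y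

  _≤_ : Rel Carrier ℓ₂
  x ≤ y = ¬ (y < x)

  field
    _⊔_     : Carrier → Carrier → Carrier
    x≤x⊔y   : ∀ x y → x ≤ x ⊔ y
    y≤x⊔y   : ∀ x y → y ≤ x ⊔ y
    ⊔-least : ∀ {x y z} → x ≤ z → y ≤ z → x ⊔ y ≤ z

  ∣_∣ : Carrier → Carrier
  ∣ x ∣ = x ⊔ - x

  fromℕ : ℕ → Carrier
  fromℕ n = RawMonoid._×_ (CommutativeRing.+-rawMonoid commutativeRing) n 1#

  field
    archimedean : ∀ x → ∃[ n ] x < fromℕ n
    complete    : ∀ (u : ℕ → Carrier) →
                  (∀ ε → 0# < ε → ∃[ N ] ∀ i j → N ℕ.≤ i → N ℕ.≤ j → ∣ u i - u j ∣ < ε) →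
                  ∃[ l ] ∀ ε → 0# < ε → ∃[ N ] ∀ i → N ℕ.≤ i → ∣ u i - l ∣ < ε

  open IsStrictPartialOrder isStrictPartialOrder public
    using (<-respˡ-≈; <-respʳ-≈) renaming (trans to <-trans; irrefl to <-irrefl)

  -- x / y, given y # 0; the stdlib inverts y - 0 rather than y.
  divide : ∀ (x : Carrier) {y} → y # 0# → Carrier
  divide x y#0 = x * proj₁ (#⇒invertible y#0)

  0<⇒#0 : ∀ {x} → 0# < x → x # 0#
  0<⇒#0 0<x = Equivalence.from #⇔<⊎> (inj₂ 0<x)

  fromℕ-pos : ∀ n → .{{_ : NonZero n}} → 0# < fromℕ n
  fromℕ-pos (suc zero)    = <-respʳ-≈ (sym (+-identityʳ 1#)) 0<1
  fromℕ-pos (suc (suc n)) = <-trans 0<1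
    (<-respˡ-≈ (+-identityʳ 1#) (+-monoʳ-< 1# (fromℕ-pos (suc n))))

  fromℕ!#0 : ∀ n → fromℕ (n !) # 0#
  fromℕ!#0 n = 0<⇒#0 (fromℕ-pos (n !) {{n !≢0}})

  ∑ : List Carrier → Carrier
  ∑ = foldr _+_ 0#

-- Finite sets are finite setoids, so that the set of blocks of a partition of U is again a
-- finite set: it has the carrier of U, and two elements are equal when they share a block.

record FinSet : Set₁ where
  no-eta-equality
  field
    setoid : Setoid 0ℓ 0ℓ
    size   : ℕ
    enum   : Inverse (≡.setoid (Fin size)) setoid

  open Setoid setoid public

  enumerate : Fin size → Carrier
  enumerate = Inverse.to enum

record Bij (U V : FinSet) : Set where
  no-eta-equality
  constructor bij
  field
    inv : Inverse (FinSet.setoid U) (FinSet.setoid V)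

  open Inverse inv public

infix 4 _≗ᵇ_
_≗ᵇ_ : ∀ {U V} → Bij U V → Bij U V → Set
_≗ᵇ_ {U} {V} σ τ = ∀ u → FinSet._≈_ V (Bij.to σ u) (Bij.to τ u)

idᵇ : ∀ {U} → Bij U U
idᵇ .Bij.inv = Identity.inverse _

infixr 9 _∘ᵇ_
_∘ᵇ_ : ∀ {U V W} → Bij V W → Bij U V → Bij U W
(τ ∘ᵇ σ) .Bij.inv = Composition.inverse (Bij.inv σ) (Bij.inv τ)

_⁻¹ᵇ : ∀ {U V} → Bij U V → Bij V U
(σ ⁻¹ᵇ) .Bij.inv = Symmetry.inverse (Bij.inv σ)

permutation : ∀ {U V} → Bij U V → Permutation (FinSet.size U) (FinSet.size V)
permutation {U} {V} σ = Composition.inverse (FinSet.enum U)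
  (Composition.inverse (Bij.inv σ) (Symmetry.inverse (FinSet.enum V)))

size-cong : ∀ {U V} → Bij U V → FinSet.size U ≡ FinSet.size V
size-cong σ = ↔⇒≡ (permutation σ)

from-cong₂ : ∀ {U V} {σ τ : Bij U V} → σ ≗ᵇ τ → ∀ v → FinSet._≈_ U (Bij.from σ v) (Bij.from τ v)
from-cong₂ {U} {V} {σ} {τ} σ≗τ v = Bij.inverseʳ σ
  (V.trans (V.sym (Bij.strictlyInverseˡ τ v)) (V.sym (σ≗τ _)))
  where module V = FinSet V

[_] : ℕ → FinSet
[ n ] .FinSet.setoid = ≡.setoid (Fin n)
[ n ] .FinSet.size   = n
[ n ] .FinSet.enum   = Identity.inverse _

-- A list containing every element, possibly with repetitions, gives an enumeration.  Nothing
-- depends on which one, so it is abstract.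

module _ (D : DecSetoid 0ℓ 0ℓ) where
  private
    module D = DecSetoid D
  open Membership D.setoid using (_∈_)
  open UniqueSetoid D.setoid using (Unique)

  lookup-injective : ∀ {xs} → Unique xs → ∀ i j → lookup xs i D.≈ lookup xs j → i ≡ j
  lookup-injective (_ ∷ _)   zero    zero    _ = refl
  lookup-injective (x# ∷ _)  zero    (suc j) e = contradiction e (All.lookup x# (∈-lookup j))
  lookup-injective (x# ∷ xs!) (suc i) zero    e =
    ≡.sym (lookup-injective (x# ∷ xs!) zero (suc i) (D.sym e))
  lookup-injective (_ ∷ xs!) (suc i) (suc j) e = cong suc (lookup-injective xs! i j e)

  abstract
    enumeration : (xs : List D.Carrier) → (∀ x → x ∈ xs) →
                  Σ[ n ∈ ℕ ] Inverse (≡.setoid (Fin n)) D.setoid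
    enumeration xs x∈xs = length ys , record
      { to        = lookup ys
      ; from      = position
      ; to-cong   = λ { refl → D.refl }
      ; from-cong = λ {x} {y} x≈y → lookup-injective ys! _ _
                      (D.trans (D.sym (at x)) (D.trans x≈y (at y)))
      ; inverse   = (λ { {x} refl → D.sym (at x) })
                  , (λ {i} {x} x≈i → lookup-injective ys! _ _ (D.trans (D.sym (at x)) x≈i))
      }
      where
      ys : List D.Carrier
      ys = deduplicate D._≟_ xs
      ys! : Unique ys
      ys! = deduplicate-! D xs
      x∈ys : ∀ x → x ∈ ys
      x∈ys x = ∈-deduplicate⁺ D.setoid D._≟_ (λ p q → D.trans q (D.sym p)) (x∈xs x)
      position : D.Carrier → Fin (length ys)
      position x = index (x∈ys x)
      at : ∀ x → x D.≈ lookup ys (position x)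
      at x = lookup-index (x∈ys x)

module _ (U : FinSet) where
  open FinSet U

  infix 4 _≟_
  _≟_ : Decidable _≈_
  x ≟ y = Dec.map′ (λ e → trans (sym (invˡ x)) (trans (reflexive (cong enumerate e)) (invˡ y)))
                   (Inverse.from-cong enum)
                   (Inverse.from enum x Fin.≟ Inverse.from enum y)
    where invˡ = Inverse.strictlyInverseˡ enum

  elements : List Carrier
  elements = map enumerate (allFin size)

  ∈-elements : ∀ x → Any (x ≈_) elements
  ∈-elements x = Any.map⁺ (Any.map (λ { refl → sym (Inverse.strictlyInverseˡ enum x) })
                                   (∈-allFin (Inverse.from enum x)))

-- Subsets and partitions are Bool-valued, hence decidable, and live in Set.

record Subset (U : FinSet) : Set where
  open FinSet U
  field
    mem      : Carrier → Bool
    mem-cong : ∀ {u v} → u ≈ v → mem u ≡ mem v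

open Subset

∁ : ∀ {U} → Subset U → Subset U
∁ P = record { mem = not ∘ mem P ; mem-cong = cong not ∘ mem-cong P }

module _ (U : FinSet) (P : Subset U) where
  private
    module U = FinSet U
    Element : Set
    Element = Σ[ u ∈ U.Carrier ] T (mem P u)
    value : Element → U.Carrier
    value = proj₁
    select : List U.Carrier → List Element
    select []       = []
    select (x ∷ xs) with T? (mem P x)
    ... | yes p = (x , p) ∷ select xs
    ... | no  _ = select xs
    ∈-select : ∀ {u} → T (mem P u) → ∀ xs → Any (u U.≈_) xs → Any ((u U.≈_) ∘ proj₁) (select xs)
    ∈-select p (x ∷ xs) u∈ with T? (mem P x) | u∈
    ... | yes _ | here u≈x = here u≈x
    ... | yes _ | there u∈xs = there (∈-select p xs u∈xs)
    ... | no ¬p | here u≈x = contradiction (subst T (mem-cong P u≈x) p) ¬p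
    ... | no _  | there u∈xs = ∈-select p xs u∈xs

    subDecSetoid : DecSetoid 0ℓ 0ℓ
    subDecSetoid = record { isDecEquivalence = record
      { isEquivalence = On.isEquivalence value U.isEquivalence
      ; _≟_           = On.decidable value U._≈_ (_≟_ U)
      } }
    subEnum : Σ[ n ∈ ℕ ] Inverse (≡.setoid (Fin n)) (DecSetoid.setoid subDecSetoid)
    subEnum = enumeration subDecSetoid (select (elements U))
                          (λ (u , p) → ∈-select p (elements U) (∈-elements U u))

  infixl 7 _↾_
  _↾_ : FinSet
  _↾_ .FinSet.setoid = DecSetoid.setoid subDecSetoid
  _↾_ .FinSet.size   = proj₁ subEnum
  _↾_ .FinSet.enum   = proj₂ subEnum

record Partition (U : FinSet) : Set where
  open FinSet U using (Carrier; _≈_)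
  field
    rel           : Carrier → Carrier → Bool
    isEquivalence : IsEquivalence (λ u v → T (rel u v))
    ≈⇒rel         : ∀ {u v} → u ≈ v → T (rel u v)

  module Rel = IsEquivalence isEquivalence

open Partition

T-ext : ∀ {x y : Bool} → (T x → T y) → (T y → T x) → x ≡ y
T-ext {false} {false} f g = refl
T-ext {false} {true}  f g with () ← g tt
T-ext {true}  {false} f g with () ← f tt
T-ext {true}  {true}  f g = refl

module _ {U : FinSet} (π : Partition U) where
  private
    module U = FinSet U

  rel-congʳ : ∀ {u v w} → T (rel π v w) → rel π u v ≡ rel π u w
  rel-congʳ vw = T-ext (λ uv → Rel.trans π uv vw) (λ uw → Rel.trans π uw (Rel.sym π vw))

  rel-congˡ : ∀ {u v w} → T (rel π u v) → rel π u w ≡ rel π v w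
  rel-congˡ uv = T-ext (Rel.trans π (Rel.sym π uv)) (Rel.trans π uv)

  block : U.Carrier → Subset U
  block u = record { mem = rel π u ; mem-cong = λ v≈w → rel-congʳ (≈⇒rel π v≈w) }

  private
    blockDecSetoid : DecSetoid 0ℓ 0ℓ
    blockDecSetoid = record { isDecEquivalence = record
      { isEquivalence = isEquivalence π ; _≟_ = λ u v → T? (rel π u v) } }
    blockEnum : Σ[ n ∈ ℕ ] Inverse (≡.setoid (Fin n)) (DecSetoid.setoid blockDecSetoid)
    blockEnum = enumeration blockDecSetoid (elements U) (λ u → Any.map (≈⇒rel π) (∈-elements U u))

  blocks : FinSet
  blocks .FinSet.setoid = DecSetoid.setoid blockDecSetoid
  blocks .FinSet.size   = proj₁ blockEnum
  blocks .FinSet.enum   = proj₂ blockEnum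

module _ {U V : FinSet} (σ : Bij U V) where
  private
    module U = FinSet U
    module V = FinSet V
    module σ = Bij σ

  restrict : ∀ (P : Subset U) (Q : Subset V) → (∀ u → mem P u ≡ mem Q (σ.to u)) →
             Bij (U ↾ P) (V ↾ Q)
  restrict P Q e .Bij.inv = record
    { to        = λ (u , p) → σ.to u , subst T (e u) p
    ; from      = λ (v , q) → σ.from v ,
                    subst T (≡.trans (mem-cong Q (V.sym (σ.strictlyInverseˡ v)))
                                     (≡.sym (e (σ.from v)))) q
    ; to-cong   = σ.to-cong
    ; from-cong = σ.from-cong
    ; inverse   = σ.inverseˡ , σ.inverseʳ
    }

  onBlocks : ∀ (π : Partition U) (ρ : Partition V) →
             (∀ u v → rel π u v ≡ rel ρ (σ.to u) (σ.to v)) → Bij (blocks π) (blocks ρ)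
  onBlocks π ρ e .Bij.inv = record
    { to        = σ.to
    ; from      = σ.from
    ; to-cong   = λ {u} {v} → subst T (e u v)
    ; from-cong = from-cong
    ; inverse   = (λ {v} {u} u~ → Rel.trans ρ (subst T (e _ _) u~)
                                     (≈⇒rel ρ (σ.strictlyInverseˡ v)))
                , (λ {u} {v} v~ → Rel.trans π (from-cong v~)
                                     (≈⇒rel π (σ.strictlyInverseʳ u)))
    }
    where
    from-cong : ∀ {v w} → T (rel ρ v w) → T (rel π (σ.from v) (σ.from w))
    from-cong {v} {w} v~w = subst T (≡.sym (e _ _))
      (Rel.trans ρ (≈⇒rel ρ (σ.strictlyInverseˡ v))
        (Rel.trans ρ v~w (≈⇒rel ρ (V.sym (σ.strictlyInverseˡ w)))))

  transportSubset : Subset U → Subset V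
  transportSubset P = record { mem = mem P ∘ σ.from ; mem-cong = mem-cong P ∘ σ.from-cong }

  transportPartition : Partition U → Partition V
  transportPartition π = record
    { rel           = λ u v → rel π (σ.from u) (σ.from v)
    ; isEquivalence = On.isEquivalence σ.from (isEquivalence π)
    ; ≈⇒rel         = ≈⇒rel π ∘ σ.from-cong
    }

  transportSubset-to : ∀ P u → mem P u ≡ mem (transportSubset P) (σ.to u)
  transportSubset-to P u = mem-cong P (U.sym (σ.strictlyInverseʳ u))

  transportPartition-to : ∀ π u v → rel π u v ≡ rel (transportPartition π) (σ.to u) (σ.to v)
  transportPartition-to π u v = ≡.trans (rel-congˡ π (back u)) (rel-congʳ π (back v))
    where
    back : ∀ u → T (rel π u (σ.from (σ.to u)))
    back u = ≈⇒rel π (U.sym (σ.strictlyInverseʳ u))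

module OverReals {c ℓ₁ ℓ₂ : Level} (ℝ : RealNumbers c ℓ₁ ℓ₂) where
  open RealNumbers ℝ public using (0#; 1#; _+_; _*_; _-_; -_; _#_; _<_; _≤_; ∣_∣; divide; fromℕ; fromℕ!#0; ∑)
    renaming (Carrier to R; _≈_ to _≈ᴿ_)
  private
    module R = RealNumbers ℝ
    module R* = CommutativeMonoid (CommutativeRing.*-commutativeMonoid R.commutativeRing)

  ∏ : (U : FinSet) → (FinSet.Carrier U → R) → R
  ∏ U f = RawMonoid.sum R*.rawMonoid (f ∘ FinSet.enumerate U)

  ∏-pos : ∀ U {f} → (∀ u → 0# < f u) → 0# < ∏ U f
  ∏-pos U {f} 0<f = go _ (0<f ∘ FinSet.enumerate U)
    where
    go : ∀ n {g : Fin n → R} → (∀ i → 0# < g i) → 0# < RawMonoid.sum R*.rawMonoid g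
    go zero    0<g = R.0<1
    go (suc n) 0<g = R.*-pos (0<g zero) (go n (0<g ∘ suc))

  ∏-cong : ∀ {U V} (σ : Bij U V) {f g} →
           (∀ {v w} → FinSet._≈_ V v w → g v ≈ᴿ g w) → (∀ u → f u ≈ᴿ g (Bij.to σ u)) →
           ∏ U f ≈ᴿ ∏ V g
  ∏-cong {U} {V} σ {f} {g} g-cong f≈g = begin
    ∏ U f
      ≈⟨ sum-cong-≋ {n = U.size} (f≈g ∘ U.enumerate) ⟩
    sum (g ∘ Bij.to σ ∘ U.enumerate)
      ≈⟨ sum-cong-≋ {n = U.size} (λ i → g-cong (V.sym (Inverse.strictlyInverseˡ V.enum (Bij.to σ (U.enumerate i))))) ⟩
    sum (g ∘ V.enumerate ∘ Inverse.to (permutation σ))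
      ≈⟨ sum-permute (g ∘ V.enumerate) (permutation σ) ⟨
    ∏ V g ∎
    where
    module U = FinSet U
    module V = FinSet V
    open MonoidSum (CommutativeRing.*-commutativeMonoid R.commutativeRing)
    open SetoidReasoning R*.setoid

  record Species : Set (lsuc 0ℓ ⊔ˡ c ⊔ˡ ℓ₁ ⊔ˡ ℓ₂) where
    no-eta-equality
    field
      Str : FinSet → Setoid 0ℓ 0ℓ

    Structure : FinSet → Set
    Structure U = Setoid.Carrier (Str U)

    infix 4 _≈_
    _≈_ : ∀ {U} → Rel (Structure U) 0ℓ
    _≈_ {U} = Setoid._≈_ (Str U)

    field
      transport      : ∀ {U V} → Bij U V → Structure U → Structure V
      transport-cong : ∀ {U V} {σ τ : Bij U V} {s t} → σ ≗ᵇ τ → s ≈ t → transport σ s ≈ transport τ t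
      transport-id   : ∀ {U} (s : Structure U) → transport idᵇ s ≈ s
      transport-∘    : ∀ {U V W} (τ : Bij V W) (σ : Bij U V) s →
                       transport (τ ∘ᵇ σ) s ≈ transport τ (transport σ s)

      weight           : ∀ {U} → Structure U → R
      weight-pos       : ∀ {U} (s : Structure U) → 0# < weight s
      weight-cong      : ∀ {U} {s t : Structure U} → s ≈ t → weight s ≈ᴿ weight t
      weight-transport : ∀ {U V} (σ : Bij U V) s → weight (transport σ s) ≈ᴿ weight s

    module _ {U : FinSet} where
      open Setoid (Str U) public using () renaming (refl to ≈-refl; sym to ≈-sym; trans to ≈-trans)

    transport-≗id : ∀ {U} {σ : Bij U U} {s} → σ ≗ᵇ idᵇ → transport σ s ≈ s
    transport-≗id σ≗id = ≈-trans (transport-cong σ≗id ≈-refl) (transport-id _)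

    transport-≗∘ : ∀ {U V W} {τ : Bij V W} {σ : Bij U V} {ρ : Bij U W} {s} → τ ∘ᵇ σ ≗ᵇ ρ →
                   transport τ (transport σ s) ≈ transport ρ s
    transport-≗∘ eq = ≈-trans (≈-sym (transport-∘ _ _ _)) (transport-cong eq ≈-refl)

    transport-congʳ : ∀ {U V} {σ : Bij U V} {s t} → s ≈ t → transport σ s ≈ transport σ t
    transport-congʳ {V = V} = transport-cong (λ _ → FinSet.refl V)

    transport-sym : ∀ {U V} {σ : Bij U V} {τ : Bij V U} {s t} → τ ∘ᵇ σ ≗ᵇ idᵇ →
                    transport σ s ≈ t → transport τ t ≈ s
    transport-sym eq s≈t = ≈-trans (transport-congʳ (≈-sym s≈t))
      (≈-trans (≈-sym (transport-∘ _ _ _)) (transport-≗id eq))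

    transport-trans : ∀ {U V W} {τ : Bij V W} {σ : Bij U V} {ρ : Bij U W} {r s t} → τ ∘ᵇ σ ≗ᵇ ρ →
                      transport σ r ≈ s → transport τ s ≈ t → transport ρ r ≈ t
    transport-trans eq r≈s s≈t =
      ≈-trans (≈-sym (transport-≗∘ eq)) (≈-trans (transport-congʳ r≈s) s≈t)

    transport-square : ∀ {U V V′ W} {σ : Bij U V} {τ : Bij V W} {σ′ : Bij V′ W} {τ′ : Bij U V′} {s t} →
                       σ′ ∘ᵇ τ′ ≗ᵇ τ ∘ᵇ σ → transport σ s ≈ t →
                       transport σ′ (transport τ′ s) ≈ transport τ t
    transport-square eq s≈t = ≈-trans (≈-sym (transport-∘ _ _ _))
      (≈-trans (transport-cong eq ≈-refl) (≈-trans (transport-∘ _ _ _) (transport-congʳ s≈t)))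

    weight-≈ : ∀ {U V} {σ : Bij U V} {s t} → transport σ s ≈ t → weight s ≈ᴿ weight t
    weight-≈ s≈t = R.trans (R.sym (weight-transport _ _)) (weight-cong s≈t)

  open Species using (Str; Structure)

  infix 4 _≅_
  record _≅_ (F G : Species) : Set (lsuc 0ℓ ⊔ˡ c ⊔ˡ ℓ₁ ⊔ˡ ℓ₂) where
    private
      module F = Species F
      module G = Species G
    field
      iso     : ∀ U → Inverse (Str F U) (Str G U)
      natural : ∀ {U V} (σ : Bij U V) s →
                Inverse.to (iso V) (F.transport σ s) G.≈ G.transport σ (Inverse.to (iso U) s)
      weights : ∀ {U} (s : Structure F U) → G.weight (Inverse.to (iso U) s) ≈ᴿ F.weight s

  record LinearOrder (U : FinSet) : Set where
    open FinSet U using (Carrier; _≈_)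
    field
      leq          : Carrier → Carrier → Bool
      isTotalOrder : IsTotalOrder _≈_ (λ u v → T (leq u v))

    leq-cong : ∀ {u u′ v v′} → u ≈ u′ → v ≈ v′ → leq u v ≡ leq u′ v′
    leq-cong u≈ v≈ = T-ext
      (λ p → ≤-respˡ-≈ u≈ (≤-respʳ-≈ v≈ p))
      (λ p → ≤-respˡ-≈ (FinSet.sym U u≈) (≤-respʳ-≈ (FinSet.sym U v≈) p))
      where open IsTotalOrder isTotalOrder using (≤-respˡ-≈; ≤-respʳ-≈)

  𝓛 : Species
  𝓛 = record
    { Str              = λ U → record
      { Carrier       = LinearOrder U
      ; _≈_           = λ s t → ∀ u v → leq s u v ≡ leq t u v
      ; isEquivalence = record
        { refl  = λ u v → refl
        ; sym   = λ e u v → ≡.sym (e u v)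
        ; trans = λ e e′ u v → ≡.trans (e u v) (e′ u v)
        }
      }
    ; transport        = transportOrder
    ; transport-cong   = λ {U} {V} {σ} {τ} {s} {t} σ≗τ s≈t u v → ≡.trans
        (leq-cong s (from-cong₂ {σ = σ} {τ} σ≗τ u) (from-cong₂ {σ = σ} {τ} σ≗τ v))
        (s≈t _ _)
    ; transport-id     = λ s u v → refl
    ; transport-∘      = λ τ σ s u v → refl
    ; weight           = λ _ → 1#
    ; weight-pos       = λ _ → R.0<1
    ; weight-cong      = λ _ → R.refl
    ; weight-transport = λ _ _ → R.refl
    }
    where
    open LinearOrder
    transportOrder : ∀ {U V} → Bij U V → LinearOrder U → LinearOrder V
    transportOrder {U} {V} σ s = record
      { leq          = λ u v → leq s (from u) (from v)
      ; isTotalOrder = record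
        { isPartialOrder = record
          { isPreorder = record
            { isEquivalence = V.isEquivalence
            ; reflexive     = s.reflexive ∘ from-cong
            ; trans         = s.trans
            }
          ; antisym = λ p q → V.trans (V.sym (strictlyInverseˡ _))
              (V.trans (to-cong (s.antisym p q)) (strictlyInverseˡ _))
          }
        ; total = λ u v → s.total (from u) (from v)
        }
      }
      where
      open Bij σ
      module V = FinSet V
      module s = IsTotalOrder (isTotalOrder s)

  record Cycle (U : FinSet) : Set where
    open FinSet U using (Carrier; _≈_)
    field
      perm   : Bij U U
      point  : Carrier
      cyclic : ∀ u v → ∃[ k ] iterate (Bij.to perm) u k ≈ v

  -- Equality compares the permutations only, so the choice of point is immaterial.

  𝓒 : Species
  𝓒 = record
    { Str              = λ U → record
      { Carrier       = Cycle U
      ; _≈_           = λ s t → perm s ≗ᵇ perm t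
      ; isEquivalence = record
        { refl  = λ u → FinSet.refl U
        ; sym   = λ e u → FinSet.sym U (e u)
        ; trans = λ e e′ u → FinSet.trans U (e u) (e′ u)
        }
      }
    ; transport        = conjugate
    ; transport-cong   = λ {U} {V} {σ} {τ} {s} {t} σ≗τ s≈t v → FinSet.trans V (σ≗τ _)
        (Bij.to-cong τ (FinSet.trans U (s≈t _)
          (Bij.to-cong (perm t) (from-cong₂ {σ = σ} {τ} σ≗τ v))))
    ; transport-id     = λ {U} s u → FinSet.refl U
    ; transport-∘      = λ {W = W} τ σ s w → FinSet.refl W
    ; weight           = λ _ → 1#
    ; weight-pos       = λ _ → R.0<1
    ; weight-cong      = λ _ → R.refl
    ; weight-transport = λ _ _ → R.refl
    }
    where
    open Cycle
    conjugate : ∀ {U V} → Bij U V → Cycle U → Cycle V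
    conjugate {U} {V} σ s = record
      { perm   = p
      ; point  = to (point s)
      ; cyclic = λ u v → let (k , e) = cyclic s (from u) (from v) in
          k , V.trans (conjugates k u (from u) (V.sym (strictlyInverseˡ u)))
                      (V.trans (to-cong e) (strictlyInverseˡ v))
      }
      where
      open Bij σ
      module U = FinSet U
      module V = FinSet V
      p : Bij V V
      p = σ ∘ᵇ perm s ∘ᵇ σ ⁻¹ᵇ
      conjugates : ∀ k v u → v V.≈ to u → iterate (Bij.to p) v k V.≈ to (iterate (Bij.to (perm s)) u k)
      conjugates zero    v u v≈ = v≈
      conjugates (suc k) v u v≈ = conjugates k _ _ (to-cong (Bij.to-cong (perm s) (inverseʳ v≈)))

  𝟘 : Species
  𝟘 = record
    { Str              = λ U → ≡.setoid ⊥
    ; transport        = λ _ ()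
    ; transport-cong   = λ { {s = ()} }
    ; transport-id     = λ ()
    ; transport-∘      = λ _ _ ()
    ; weight           = λ ()
    ; weight-pos       = λ ()
    ; weight-cong      = λ { {s = ()} }
    ; weight-transport = λ _ ()
    }

  𝟏 : Species
  𝟏 = record
    { Str              = λ U → On.setoid (≡.setoid ⊤) (λ (_ : FinSet.size U ≡ 0) → tt)
    ; transport        = λ σ → ≡.trans (≡.sym (size-cong σ))
    ; transport-cong   = λ _ _ → refl
    ; transport-id     = λ _ → refl
    ; transport-∘      = λ _ _ _ → refl
    ; weight           = λ _ → 1#
    ; weight-pos       = λ _ → R.0<1
    ; weight-cong      = λ _ → R.refl
    ; weight-transport = λ _ _ → R.refl
    }

  infixl 6 _⊕_
  _⊕_ : Species → Species → Species
  F ⊕ G = record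
    { Str              = λ U → F.Str U ⊎ₛ G.Str U
    ; transport        = λ σ → Sum.map (F.transport σ) (G.transport σ)
    ; transport-cong   = λ where
        e (inj₁ p) → inj₁ (F.transport-cong e p)
        e (inj₂ p) → inj₂ (G.transport-cong e p)
    ; transport-id     = λ where
        (inj₁ s) → inj₁ (F.transport-id s)
        (inj₂ s) → inj₂ (G.transport-id s)
    ; transport-∘      = λ where
        τ σ (inj₁ s) → inj₁ (F.transport-∘ τ σ s)
        τ σ (inj₂ s) → inj₂ (G.transport-∘ τ σ s)
    ; weight           = Sum.[ F.weight , G.weight ]
    ; weight-pos       = Sum.[ F.weight-pos , G.weight-pos ]
    ; weight-cong      = λ where
        (inj₁ p) → F.weight-cong p
        (inj₂ p) → G.weight-cong p
    ; weight-transport = λ where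
        σ (inj₁ s) → F.weight-transport σ s
        σ (inj₂ s) → G.weight-transport σ s
    }
    where
    module F = Species F
    module G = Species G

  -- The restriction of F to sets of cardinality m, written with a subscript m on paper.

  infix 8 _atSize_
  _atSize_ : Species → ℕ → Species
  F atSize m = record
    { Str              = λ U → On.setoid (F.Str U) (proj₁ {B = λ _ → FinSet.size U ≡ m})
    ; transport        = λ σ (s , e) → F.transport σ s , ≡.trans (≡.sym (size-cong σ)) e
    ; transport-cong   = F.transport-cong
    ; transport-id     = λ (s , _) → F.transport-id s
    ; transport-∘      = λ τ σ (s , _) → F.transport-∘ τ σ s
    ; weight           = λ (s , _) → F.weight s
    ; weight-pos       = λ (s , _) → F.weight-pos s
    ; weight-cong      = F.weight-cong
    ; weight-transport = λ σ (s , _) → F.weight-transport σ s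
    }
    where
    module F = Species F

  record ProductStructure (F G : Species) (U : FinSet) : Set where
    field
      part  : Subset U
      left  : Structure F (U ↾ part)
      right : Structure G (U ↾ ∁ part)

  module Product (F G : Species) where
    private
      module F = Species F
      module G = Species G
    open ProductStructure

    infix 4 _≈_
    record _≈_ {U : FinSet} (s t : ProductStructure F G U) : Set where
      field
        part≈  : ∀ u → mem (part s) u ≡ mem (part t) u
        left≈  : F.transport (restrict idᵇ (part s) (part t) part≈) (left s) F.≈ left t
        right≈ : G.transport (restrict idᵇ (∁ (part s)) (∁ (part t)) (cong not ∘ part≈)) (right s)
                   G.≈ right t

    open _≈_

    isEquivalence-≈ : ∀ {U} → IsEquivalence (_≈_ {U})
    isEquivalence-≈ {U} = record
      { refl  = record
        { part≈  = λ _ → refl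
        ; left≈  = F.transport-≗id (λ _ → U.refl)
        ; right≈ = G.transport-≗id (λ _ → U.refl)
        }
      ; sym   = λ e → record
        { part≈  = λ u → ≡.sym (part≈ e u)
        ; left≈  = F.transport-sym (λ _ → U.refl) (left≈ e)
        ; right≈ = G.transport-sym (λ _ → U.refl) (right≈ e)
        }
      ; trans = λ e e′ → record
        { part≈  = λ u → ≡.trans (part≈ e u) (part≈ e′ u)
        ; left≈  = F.transport-trans (λ _ → U.refl) (left≈ e) (left≈ e′)
        ; right≈ = G.transport-trans (λ _ → U.refl) (right≈ e) (right≈ e′)
        }
      }
      where module U = FinSet U

    module _ {U V : FinSet} (σ : Bij U V) where

      transport-left : ∀ P → Bij (U ↾ P) (V ↾ transportSubset σ P)
      transport-left P = restrict σ P (transportSubset σ P) (transportSubset-to σ P)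

      transport-right : ∀ P → Bij (U ↾ ∁ P) (V ↾ ∁ (transportSubset σ P))
      transport-right P = restrict σ (∁ P) (∁ (transportSubset σ P)) (cong not ∘ transportSubset-to σ P)

      transport : ProductStructure F G U → ProductStructure F G V
      transport s = record
        { part  = transportSubset σ (part s)
        ; left  = F.transport (transport-left (part s)) (left s)
        ; right = G.transport (transport-right (part s)) (right s)
        }

    transport-cong : ∀ {U V} {σ τ : Bij U V} {s t} → σ ≗ᵇ τ → s ≈ t → transport σ s ≈ transport τ t
    transport-cong {σ = σ} {τ} {s} {t} σ≗τ e = record
      { part≈  = λ v → ≡.trans (part≈ e _) (mem-cong (part t) (from-cong₂ {σ = σ} {τ} σ≗τ v))
      ; left≈  = F.transport-square (λ u → σ≗τ (proj₁ u)) (left≈ e)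
      ; right≈ = G.transport-square (λ u → σ≗τ (proj₁ u)) (right≈ e)
      }

    transport-id : ∀ {U} (s : ProductStructure F G U) → transport idᵇ s ≈ s
    transport-id {U} s = record
      { part≈  = λ _ → refl
      ; left≈  = F.≈-trans (F.transport-≗∘ {ρ = idᵇ} (λ _ → FinSet.refl U)) (F.transport-id (left s))
      ; right≈ = G.≈-trans (G.transport-≗∘ {ρ = idᵇ} (λ _ → FinSet.refl U)) (G.transport-id (right s))
      }

    transport-∘ : ∀ {U V W} (τ : Bij V W) (σ : Bij U V) s →
                  transport (τ ∘ᵇ σ) s ≈ transport τ (transport σ s)
    transport-∘ {W = W} τ σ s = record
      { part≈  = λ _ → refl
      ; left≈  = F.transport-square {s = left s} (λ _ → FinSet.refl W) F.≈-refl
      ; right≈ = G.transport-square {s = right s} (λ _ → FinSet.refl W) G.≈-refl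
      }

    weight : ∀ {U} → ProductStructure F G U → R
    weight s = F.weight (left s) * G.weight (right s)

  infixl 7 _⊙_
  _⊙_ : Species → Species → Species
  F ⊙ G = record
    { Str              = λ U → record { isEquivalence = isEquivalence-≈ {U} }
    ; transport        = transport
    ; transport-cong   = transport-cong
    ; transport-id     = transport-id
    ; transport-∘      = transport-∘
    ; weight           = weight
    ; weight-pos       = λ s → R.*-pos (F.weight-pos (left s)) (G.weight-pos (right s))
    ; weight-cong      = λ e → R.*-cong (F.weight-≈ (left≈ e)) (G.weight-≈ (right≈ e))
    ; weight-transport = λ σ s → R.*-cong (F.weight-transport (transport-left σ (part s)) (left s))
                                          (G.weight-transport (transport-right σ (part s)) (right s))
    }
    where
    module F = Species F
    module G = Species G
    open Product F G
    open _≈_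
    open ProductStructure

  -- A B-structure on each block of π is a family indexed by the elements u of U, placing on the
  -- block of u a structure that depends on the block only.

  record CompositeStructure (F B : Species) (U : FinSet) : Set where
    field
      partition : Partition U
      outer     : Structure F (blocks partition)
      inner     : ∀ u → Structure B (U ↾ block partition u)
      coherent  : ∀ {u v} (uv : T (rel partition u v)) →
                  Species._≈_ B
                    (Species.transport B
                      (restrict idᵇ (block partition u) (block partition v)
                                (λ _ → rel-congˡ partition uv))
                      (inner u))
                    (inner v)

  module Composite (F B : Species) where
    private
      module F = Species F
      module B = Species B
    open CompositeStructure

    infix 4 _≈_
    record _≈_ {U : FinSet} (s t : CompositeStructure F B U) : Set where
      field
        partition≈ : ∀ u v → rel (partition s) u v ≡ rel (partition t) u v
        outer≈     : F.transport (onBlocks idᵇ (partition s) (partition t) partition≈) (outer s)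
                       F.≈ outer t
        inner≈     : ∀ u → B.transport (restrict idᵇ (block (partition s) u) (block (partition t) u)
                                                 (partition≈ u))
                                       (inner s u)
                             B.≈ inner t u

    open _≈_

    isEquivalence-≈ : ∀ {U} → IsEquivalence (_≈_ {U})
    isEquivalence-≈ {U} = record
      { refl  = λ {s} → record
        { partition≈ = λ _ _ → refl
        ; outer≈     = F.transport-≗id (λ _ → Rel.refl (partition s))
        ; inner≈     = λ _ → B.transport-≗id (λ _ → U.refl)
        }
      ; sym   = λ {s} e → record
        { partition≈ = λ u v → ≡.sym (partition≈ e u v)
        ; outer≈     = F.transport-sym (λ _ → Rel.refl (partition s)) (outer≈ e)
        ; inner≈     = λ u → B.transport-sym (λ _ → U.refl) (inner≈ e u)
        }
      ; trans = λ {_} {_} {t} e e′ → record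
        { partition≈ = λ u v → ≡.trans (partition≈ e u v) (partition≈ e′ u v)
        ; outer≈     = F.transport-trans (λ _ → Rel.refl (partition t)) (outer≈ e) (outer≈ e′)
        ; inner≈     = λ u → B.transport-trans (λ _ → U.refl) (inner≈ e u) (inner≈ e′ u)
        }
      }
      where module U = FinSet U

    module _ {U V : FinSet} (σ : Bij U V) where

      transport-blocks : ∀ π → Bij (blocks π) (blocks (transportPartition σ π))
      transport-blocks π = onBlocks σ π (transportPartition σ π) (transportPartition-to σ π)

      transport-block : ∀ π v → Bij (U ↾ block π (Bij.from σ v)) (V ↾ block (transportPartition σ π) v)
      transport-block π v = restrict σ (block π (Bij.from σ v)) (block (transportPartition σ π) v)
        (λ u → rel-congʳ π (≈⇒rel π (FinSet.sym U (Bij.strictlyInverseʳ σ u))))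

      transport : CompositeStructure F B U → CompositeStructure F B V
      transport s = record
        { partition = transportPartition σ (partition s)
        ; outer     = F.transport (transport-blocks (partition s)) (outer s)
        ; inner     = λ v → B.transport (transport-block (partition s) v) (inner s (Bij.from σ v))
        ; coherent  = λ uv → B.transport-square (λ _ → FinSet.refl V) (coherent s uv)
        }

    transport-cong : ∀ {U V} {σ τ : Bij U V} {s t} → σ ≗ᵇ τ → s ≈ t → transport σ s ≈ transport τ t
    transport-cong {U} {V} {σ} {τ} {s} {t} σ≗τ e = record
      { partition≈ = λ u v → ≡.trans (partition≈ e _ _)
          (≡.trans (rel-congˡ π (σ⁻¹~τ⁻¹ u)) (rel-congʳ π (σ⁻¹~τ⁻¹ v)))
      ; outer≈     = F.transport-square (λ u → ≈⇒rel (transportPartition τ π) (σ≗τ u)) (outer≈ e)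
      ; inner≈     = λ v → B.≈-trans
          (B.transport-square {τ = shifted v} (λ u → σ≗τ (proj₁ u)) (inner≈ e (Bij.from σ v)))
          (B.≈-trans (B.≈-sym (B.transport-≗∘ (λ _ → FinSet.refl V)))
                     (B.transport-congʳ (coherent t (σ⁻¹~τ⁻¹ v))))
      }
      where
      π : Partition U
      π = partition t
      σ⁻¹~τ⁻¹ : ∀ v → T (rel π (Bij.from σ v) (Bij.from τ v))
      σ⁻¹~τ⁻¹ v = ≈⇒rel π (from-cong₂ {σ = σ} {τ} σ≗τ v)
      shifted : ∀ v → Bij (U ↾ block π (Bij.from σ v)) (V ↾ block (transportPartition τ π) v)
      shifted v = transport-block τ π v ∘ᵇ restrict idᵇ _ _ (λ _ → rel-congˡ π (σ⁻¹~τ⁻¹ v))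

    transport-id : ∀ {U} (s : CompositeStructure F B U) → transport idᵇ s ≈ s
    transport-id {U} s = record
      { partition≈ = λ _ _ → refl
      ; outer≈     = F.≈-trans (F.transport-≗∘ {ρ = idᵇ} (λ _ → Rel.refl (partition s)))
                               (F.transport-id (outer s))
      ; inner≈     = λ u → B.≈-trans (B.transport-≗∘ {ρ = idᵇ} (λ _ → FinSet.refl U))
                                     (B.transport-id (inner s u))
      }

    transport-∘ : ∀ {U V W} (τ : Bij V W) (σ : Bij U V) s →
                  transport (τ ∘ᵇ σ) s ≈ transport τ (transport σ s)
    transport-∘ {W = W} τ σ s = record
      { partition≈ = λ _ _ → refl
      ; outer≈     = F.transport-square {s = outer s}
          (λ _ → Rel.refl (transportPartition τ (transportPartition σ (partition s)))) F.≈-refl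
      ; inner≈     = λ w → B.transport-square {s = inner s (Bij.from σ (Bij.from τ w))}
          (λ _ → FinSet.refl W) B.≈-refl
      }

    weight : ∀ {U} → CompositeStructure F B U → R
    weight s = F.weight (outer s) * ∏ (blocks (partition s)) (λ u → B.weight (inner s u))

    weight-cong : ∀ {U} {s t : CompositeStructure F B U} → s ≈ t → weight s ≈ᴿ weight t
    weight-cong {U} {s} {t} e = R.*-cong (F.weight-≈ (outer≈ e))
      (∏-cong (onBlocks idᵇ (partition s) (partition t) (partition≈ e))
              (λ uv → B.weight-≈ (coherent t uv)) (λ u → B.weight-≈ (inner≈ e u)))

    weight-transport : ∀ {U V} (σ : Bij U V) s → weight (transport σ s) ≈ᴿ weight s
    weight-transport {U} {V} σ s = R.*-cong (F.weight-transport (transport-blocks σ π) (outer s))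
      (R.sym (∏-cong (transport-blocks σ π)
        (λ uv → B.weight-≈ (coherent (transport σ s) uv))
        (λ u → R.trans (B.weight-≈ (coherent s (back u)))
                       (R.sym (B.weight-transport (transport-block σ π (Bij.to σ u))
                                                  (inner s (Bij.from σ (Bij.to σ u))))))))
      where
      π : Partition U
      π = partition s
      back : ∀ u → T (rel π u (Bij.from σ (Bij.to σ u)))
      back u = ≈⇒rel π (FinSet.sym U (Bij.strictlyInverseʳ σ u))

  infixr 9 _⊚_
  _⊚_ : Species → Species → Species
  F ⊚ B = record
    { Str              = λ U → record { isEquivalence = isEquivalence-≈ {U} }
    ; transport        = transport
    ; transport-cong   = transport-cong
    ; transport-id     = transport-id
    ; transport-∘      = transport-∘
    ; weight           = weight
    ; weight-pos       = λ s → R.*-pos (Species.weight-pos F (outer s))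
                                       (∏-pos (blocks (partition s)) (λ u → Species.weight-pos B (inner s u)))
    ; weight-cong      = weight-cong
    ; weight-transport = weight-transport
    }
    where
    open Composite F B
    open CompositeStructure

  include : ∀ {F B m U} → Structure ((F atSize m) ⊚ B) U → Structure (F ⊚ B) U
  include s = record
    { partition = partition s
    ; outer     = proj₁ (outer s)
    ; inner     = inner s
    ; coherent  = coherent s
    }
    where open CompositeStructure

  infixr 10 _^_
  _^_ : Species → ℕ → Species
  F ^ zero  = 𝟏
  F ^ suc k = F ⊙ F ^ k

  -- F ⊝ G is the formal difference of F and G.

  infix 5 _⊝_
  record Virtual : Set (lsuc 0ℓ ⊔ˡ c ⊔ˡ ℓ₁ ⊔ˡ ℓ₂) where
    constructor _⊝_
    field
      pos neg : Species

  open Virtual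

  ⌜_⌝ : Species → Virtual
  ⌜ F ⌝ = F ⊝ 𝟘

  infixl 6 _+ᵛ_ _-ᵛ_
  infixl 7 _*ᵛ_
  infixr 8 _×ᵛ_

  _+ᵛ_ _-ᵛ_ _*ᵛ_ : Virtual → Virtual → Virtual
  (F ⊝ G) +ᵛ (H ⊝ K) = F ⊕ H ⊝ G ⊕ K
  (F ⊝ G) -ᵛ (H ⊝ K) = F ⊕ K ⊝ G ⊕ H
  (F ⊝ G) *ᵛ (H ⊝ K) = F ⊙ H ⊕ G ⊙ K ⊝ F ⊙ K ⊕ G ⊙ H

  _×ᵛ_ : ℕ → Virtual → Virtual
  zero  ×ᵛ V = ⌜ 𝟘 ⌝
  suc k ×ᵛ V = V +ᵛ k ×ᵛ V

  data Family : Set where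
    linearOrders cyclicPermutations : Family

  species : Family → Species
  species linearOrders       = 𝓛
  species cyclicPermutations = 𝓒

  𝔡 : Family → Species → ℕ → Virtual
  𝔡 _                  B zero    = ⌜ 𝟘 ⌝
  𝔡 linearOrders       B (suc k) = suc k ×ᵛ (⌜ B ^ k ⌝ *ᵛ ((⌜ 𝟏 ⌝ -ᵛ ⌜ B ⌝) *ᵛ (⌜ 𝟏 ⌝ -ᵛ ⌜ B ⌝)))
  𝔡 cyclicPermutations B (suc k) = ⌜ B ^ k ⌝ *ᵛ (⌜ 𝟏 ⌝ -ᵛ ⌜ B ⌝)

  -- The sum of a family of positive reals indexed by a setoid is the supremum of its sums over
  -- finite lists of distinct indices.  It is unique, and finite families always have one.

  record IsSum (S : Setoid 0ℓ 0ℓ) (w : Setoid.Carrier S → R) (total : R) : Set (c ⊔ˡ ℓ₂) where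
    open UniqueSetoid S using (Unique)
    field
      upper  : ∀ xs → Unique xs → ∑ (map w xs) ≤ total
      approx : ∀ ε → 0# < ε → ∃[ xs ] Unique xs × total - ε < ∑ (map w xs)

  Summable : Species → Set (c ⊔ˡ ℓ₂)
  Summable F = ∀ n → ∃ (IsSum (Str F [ n ]) (Species.weight F))

  totalWeight : ∀ F → Summable F → ℕ → R
  totalWeight F F-summable n = proj₁ (F-summable n)

  Summableᵛ : Virtual → Set (c ⊔ˡ ℓ₂)
  Summableᵛ V = Summable (pos V) × Summable (neg V)

  totalWeightᵛ : ∀ V → Summableᵛ V → ℕ → R
  totalWeightᵛ V (p , n) k = totalWeight (pos V) p k - totalWeight (neg V) n k

  -- p is the probability that a random F-structure on [n] lies in E.

  IsProbability : ∀ F (F-summable : Summable F) n → totalWeight F F-summable n # 0# →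
                  (E : Structure F [ n ] → Set) → R → Set (c ⊔ˡ ℓ₂)
  IsProbability F F-summable n total#0 E p =
    IsSum (On.setoid (Str F [ n ]) (proj₁ {B = E})) (λ (s , _) → divide (Species.weight F s) total#0) p

  -- s lies in (F atSize m) ⊚ B, when A is identified with F ⊚ B.

  InRestriction : ∀ {A F B} → A ≅ F ⊚ B → ℕ → ∀ {U} → Structure A U → Set
  InRestriction {A} {F} {B} A≅F⊚B m {U} s =
    Σ[ t ∈ Structure ((F atSize m) ⊚ B) U ]
      Species._≈_ (F ⊚ B) (include {F} {B} t) (Inverse.to (_≅_.iso A≅F⊚B U) s)

  -- Asymptotics as n → ∞ of sequences whose nth term is defined when D n holds.

  module _ {d : Level} {D : ℕ → Set d} where

    infix 4 _=O_ _=o_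
    _=O_ _=o_ : (f g : ∀ n → D n → R) → Set (d ⊔ˡ c ⊔ˡ ℓ₂)
    f =O g = ∃[ K ] ∃[ N ] ∀ n → N ℕ.≤ n → (δ : D n) → ∣ f n δ ∣ ≤ K * ∣ g n δ ∣
    f =o g = ∀ ε → 0# < ε → ∃[ N ] ∀ n → N ℕ.≤ n → (δ : D n) → ∣ f n δ ∣ ≤ ε * ∣ g n δ ∣

    record AsymptoticExpansion (p : ∀ n → D n → R) (a : ℕ → R) (g : ℕ → ∀ n → D n → R) :
                               Set (d ⊔ˡ c ⊔ˡ ℓ₂) where
      field
        eventually : ∃[ N ] ∀ n → N ℕ.≤ n → D n
        scale      : ∀ k → g (suc k) =o g k
        expansion  : ∀ r → (λ n δ → p n δ - ∑ (map (λ k → a k * g k n δ) (upTo (suc r)))) =O g (suc r)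

  -- The integers k with r ≤ k ≤ s.
  range : ℕ → ℕ → List ℕ
  range r s = map (r ℕ.+_) (upTo (suc s ∸ r))

  record Gargantuan (a : ℕ → R) : Set (c ⊔ˡ ℓ₂) where
    field
      nonzero     : ∃[ N ] ∀ n → N ℕ.≤ n → a n # 0#
      ratio       : (λ n (a#0 : a n # 0#) → divide (a (n ∸ 1)) a#0) =o (λ _ _ → 1#)
      convolution : ∀ r → (λ n (_ : ⊤) → ∑ (map (λ k → ∣ a k * a (n ∸ k) ∣) (range r (n ∸ r))))
                          =O (λ n _ → a (n ∸ r))

  GargantuanSpecies : ∀ A → Summable A → Set (c ⊔ˡ ℓ₂)
  GargantuanSpecies A A-summable = Gargantuan (λ n → divide (totalWeight A A-summable n) (fromℕ!#0 n))

{-# OPTIONS --safe #-}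

-- Let a and b be the exponential generating series of 𝒜 and ℬ.  Recording for every atom the
-- position of its block turns an (ℱ_m ∘ ℬ)-structure into m ℬ-structures in a row: for ℱ = ℒ this
-- is a bijection, and for ℱ = 𝒞 it becomes one after choosing the position, among m, of the block of
-- a fixed atom.  So ℱ_m ∘ ℬ has series b^m, respectively b^m / m.  Summing over m gives a = 1 + b a,
-- respectively θ a (1 - b) = θ b with θ = z d/dz.  As all coefficients are nonnegative, it also shows
-- that every power b^m with m ≥ 1 is bounded by a multiple of a; this bound does the work of the
-- analyticity hypothesis in Bender's theorem.
--
-- For series f and g bounded by multiples of a, the gargantuan condition makes all but the first r
-- and the last r terms of the coefficient of z^n in f g negligible against a_{n-r}.  Hence if f and
-- g have expansions Σ d_k a_{n-k} and Σ e_k a_{n-k}, then f g has the expansion with coefficients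
-- f e + g d.  Comparing both sides of the equation for a shows, by induction on the order r, that b
-- has the expansion with coefficients (1 - b)², respectively 1 - b, and the Leibniz rule gives
-- m b^(m-1) times this for b^m.

module Submission where

open import Defs
open import Level using (Level; 0ℓ) renaming (_⊔_ to _⊔ˡ_; suc to lsuc)
open import Algebra.Bundles using (CommutativeRing)
import Algebra.Properties.AbelianGroup as AbelianGroupProperties
import Algebra.Properties.Ring as RingProperties
import Algebra.Properties.Semiring.Mult as SemiringMult
import Algebra.Solver.Ring as RingSolver
open import Algebra.Solver.Ring.AlmostCommutativeRing using (fromCommutativeRing; _-Raw-AlmostCommutative⟶_)
open import Data.Bool.Base using (Bool; true; false; not; T)
import Data.Bool.Properties as Bool
open import Data.Empty using (⊥)
open import Data.Fin.Base as Fin using (Fin; zero; suc; toℕ; fromℕ<; punchOut)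
import Data.Fin.Properties as Fin
open import Data.Integer.Base as ℤ using (ℤ; +_; -[1+_]; _⊖_)
import Data.Integer.Properties as ℤ
open import Data.List.Base using (List; []; _∷_; map; _++_; length; allFin; cartesianProduct; upTo; applyUpTo)
import Data.List.Membership.Setoid as Membership
import Data.List.Properties as List
open import Data.List.Relation.Unary.All as All using (All; []; _∷_)
import Data.List.Relation.Unary.All.Properties as All
open import Data.List.Relation.Unary.AllPairs as AllPairs using ([]; _∷_)
open import Data.List.Relation.Unary.Any using (Any; here; there)
import Data.List.Relation.Unary.Any.Properties as Any
import Data.List.Relation.Unary.Unique.Setoid as UniqueSetoid
import Data.List.Relation.Unary.Unique.Setoid.Properties as Unique
import Data.Maybe.Base as Maybe
open import Data.Nat.Base as ℕ using (ℕ; zero; suc; pred; _∸_; _!; NonZero; z≤n; s≤s)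
open import Data.Nat.Combinatorics using (_C_; nCk≡n!/k![n-k]!; k![n∸k]!∣n!)
open import Data.Nat.DivMod using (_%_; _/_; _mod_; m≡m%n+[m/n]*n; m%n%n≡m%n; m<n⇒m%n≡m; [m+n]%n≡m%n; %-distribˡ-+; m/n*n≡m)
open import Data.Nat.GeneralisedArithmetic using (iterate)
import Data.Nat.Properties as ℕ
open import Data.Product.Base using (Σ; Σ-syntax; ∃; ∃-syntax; _×_; _,_; proj₁; proj₂)
open import Data.Product.Relation.Binary.Pointwise.NonDependent using (_×ₛ_)
open import Data.Sum.Base as Sum using (_⊎_; inj₁; inj₂)
open import Data.Sum.Relation.Binary.Pointwise using (inj₁; inj₂)
open import Data.Unit.Base using (tt)
open import Data.Vec.Base as Vec using (Vec; []; _∷_)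
import Data.Vec.Properties as Vec
open import Function.Base using (_∘_; id)
open import Function.Bundles using (Inverse; Equivalence)
import Function.Construct.Identity as Identity
import Function.Construct.Symmetry as Symmetry
open import Relation.Binary.Bundles using (Setoid)
import Relation.Binary.Construct.On as On
open import Relation.Binary.PropositionalEquality as ≡ using (_≡_; refl; cong; cong₂; subst)
import Relation.Binary.Reasoning.Setoid as SetoidReasoning
open import Relation.Binary.Structures using (IsTotalOrder)
open import Relation.Nullary using (¬_; Dec; does; yes; no; contradiction; ¬¬-excluded-middle)
open import Relation.Nullary.Decidable.Core using (dec⇒maybe)

-- The order on the reals comes without trichotomy, and equality of structures need not be
-- decidable. So no total weight is computed by listing structures: each is a supremum over finite
-- lists of distinct elements, which is moved along bijections, cut along Boolean functions,
-- multiplied over pairs, and divided by m by undoing m copies. The induction on the order closes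
-- because b n, the unknown, meets only one undelayed coefficient. In b a the truncation contains a
-- 0 * b n with a 0 = 1, and every other b in it stands at an earlier index, where order r already
-- yields order r + 1. In the cyclic equation the unknown is the n * b n of θ b, while θ a has no
-- constant term and so meets only earlier b. There the obstacle is that θ a is not bounded by a
-- multiple of a; but at the indices that occur its coefficients are at most n times those of a, so
-- the error carries at most the factor n that also multiplies b n.

-- The ring solver with coefficients in ℤ, which cancels opposite terms in an abstract ring.
module IntegerSolver {r₁ r₂ : Level} (𝑅 : CommutativeRing r₁ r₂) where
  open CommutativeRing 𝑅 renaming (Carrier to X; refl to ≈-refl; sym to ≈-sym; trans to ≈-trans)
  open RingProperties ring
  open AbelianGroupProperties +-abelianGroup using (⁻¹-∙-comm)
  open SemiringMult semiring using (×-homo-+; ×1-homo-*) renaming (_×_ to _·_)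
  open SetoidReasoning setoid

  embed : ℤ → X
  embed (+ n)    = n · 1#
  embed -[1+ n ] = - (suc n · 1#)

  embed-⊖ : ∀ m n → embed (m ⊖ n) ≈ m · 1# - n · 1#
  embed-⊖ m       zero    = ≈-sym (≈-trans (+-congˡ -0#≈0#) (+-identityʳ _))
  embed-⊖ zero    (suc n) = ≈-sym (+-identityˡ _)
  embed-⊖ (suc m) (suc n) = begin
    embed (suc m ⊖ suc n)                    ≡⟨ cong embed (ℤ.[1+m]⊖[1+n]≡m⊖n m n) ⟩
    embed (m ⊖ n)                            ≈⟨ embed-⊖ m n ⟩
    m · 1# - n · 1#                          ≈⟨ +-congʳ (≈-sym (+-identityˡ _)) ⟩
    (0# + m · 1#) - n · 1#                   ≈⟨ +-congʳ (+-congʳ (-‿inverseʳ 1#)) ⟨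
    ((1# - 1#) + m · 1#) - n · 1#            ≈⟨ +-congʳ (+-assoc _ _ _) ⟩
    (1# + (- 1# + m · 1#)) - n · 1#          ≈⟨ +-congʳ (+-congˡ (+-comm _ _)) ⟩
    (1# + (m · 1# - 1#)) - n · 1#            ≈⟨ +-congʳ (+-assoc _ _ _) ⟨
    ((1# + m · 1#) - 1#) - n · 1#            ≈⟨ +-assoc _ _ _ ⟩
    (1# + m · 1#) + (- 1# - n · 1#)          ≈⟨ +-congˡ (⁻¹-∙-comm _ _) ⟩
    suc m · 1# - suc n · 1#                  ∎

  embed-+ : ∀ i j → embed (i ℤ.+ j) ≈ embed i + embed j
  embed-+ (+ m)    (+ n)    = ×-homo-+ 1# m n
  embed-+ (+ m)    -[1+ n ] = embed-⊖ m (suc n)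
  embed-+ -[1+ m ] (+ n)    = ≈-trans (embed-⊖ n (suc m)) (+-comm _ _)
  embed-+ -[1+ m ] -[1+ n ] = begin
    - (suc (suc (m ℕ.+ n)) · 1#)             ≡⟨ cong (λ k → - (k · 1#)) (ℕ.+-suc (suc m) n) ⟨
    - ((suc m ℕ.+ suc n) · 1#)               ≈⟨ -‿cong (×-homo-+ 1# (suc m) (suc n)) ⟩
    - (suc m · 1# + suc n · 1#)              ≈⟨ ⁻¹-∙-comm _ _ ⟨
    - (suc m · 1#) - suc n · 1#              ∎

  embed-neg : ∀ i → embed (ℤ.- i) ≈ - embed i
  embed-neg (+ zero)  = ≈-sym -0#≈0#
  embed-neg (+ suc n) = ≈-refl
  embed-neg -[1+ n ]  = ≈-sym (-‿involutive _)

  embed-pos-* : ∀ m j → embed (+ m ℤ.* j) ≈ m · 1# * embed j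
  embed-pos-* m (+ n)    = ≈-trans (reflexive (cong embed (≡.sym (ℤ.pos-* m n)))) (×1-homo-* m n)
  embed-pos-* m -[1+ n ] = begin
    embed (+ m ℤ.* -[1+ n ])                 ≡⟨ cong embed (ℤ.neg-distribʳ-* (+ m) (+ suc n)) ⟨
    embed (ℤ.- (+ m ℤ.* + suc n))            ≈⟨ embed-neg (+ m ℤ.* + suc n) ⟩
    - embed (+ m ℤ.* + suc n)                ≈⟨ -‿cong (embed-pos-* m (+ suc n)) ⟩
    - (m · 1# * suc n · 1#)                  ≈⟨ -‿distribʳ-* _ _ ⟩
    m · 1# * - (suc n · 1#)                  ∎

  embed-* : ∀ i j → embed (i ℤ.* j) ≈ embed i * embed j
  embed-* (+ m)    j = embed-pos-* m j
  embed-* -[1+ m ] j = begin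
    embed (-[1+ m ] ℤ.* j)                   ≡⟨ cong embed (ℤ.neg-distribˡ-* (+ suc m) j) ⟨
    embed (ℤ.- (+ suc m ℤ.* j))              ≈⟨ embed-neg (+ suc m ℤ.* j) ⟩
    - embed (+ suc m ℤ.* j)                  ≈⟨ -‿cong (embed-pos-* (suc m) j) ⟩
    - (suc m · 1# * embed j)                 ≈⟨ -‿distribˡ-* _ _ ⟩
    - (suc m · 1#) * embed j                 ∎

  embedding : ℤ.+-*-rawRing -Raw-AlmostCommutative⟶ fromCommutativeRing 𝑅
  embedding = record
    { ⟦_⟧    = embed
    ; +-homo = embed-+
    ; *-homo = embed-*
    ; -‿homo = embed-neg
    ; 0-homo = ≈-refl
    ; 1-homo = +-identityʳ 1#
    }

  open RingSolver ℤ.+-*-rawRing (fromCommutativeRing 𝑅) embedding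
    (λ i j → Maybe.map (reflexive ∘ cong embed) (dec⇒maybe (i ℤ.≟ j))) public
    using (solve; _:=_; _:+_; _:*_; _:-_; :-_; con)

-- Order, inverses and absolute value in a constructive real field.

module OrderedField {c ℓ₁ ℓ₂ : Level} (ℝ : RealNumbers c ℓ₁ ℓ₂) where
  open RealNumbers ℝ public hiding (zero) renaming (refl to ≈-refl)
  open IntegerSolver commutativeRing public
  open SetoidReasoning setoid

  -- The substitute for trichotomy, on which case distinctions between reals rest: z is apart from x
  -- or from y, and if it lies on the outer side, transitivity puts it beyond the other point as
  -- well.
  <-cotrans : ∀ {x y} → x < y → ∀ z → (x < z) ⊎ (z < y)
  <-cotrans {x} {y} x<y z with #-cotrans (Equivalence.from #⇔<⊎> (inj₁ x<y)) z
  ... | inj₁ x#z with Equivalence.to #⇔<⊎> x#z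
  ...   | inj₁ x<z = inj₁ x<z
  ...   | inj₂ z<x = inj₂ (<-trans z<x x<y)
  <-cotrans {x} {y} x<y z | inj₂ z#y with Equivalence.to #⇔<⊎> z#y
  ...   | inj₁ z<y = inj₂ z<y
  ...   | inj₂ y<z = inj₁ (<-trans x<y y<z)

  <⇒≤ : ∀ {x y} → x < y → x ≤ y
  <⇒≤ x<y y<x = <-irrefl ≈-refl (<-trans x<y y<x)

  ≤-reflexive : ∀ {x y} → x ≈ y → x ≤ y
  ≤-reflexive x≈y y<x = <-irrefl (sym x≈y) y<x

  ≤-refl : ∀ {x} → x ≤ x
  ≤-refl = ≤-reflexive ≈-refl

  ≤-trans : ∀ {x y z} → x ≤ y → y ≤ z → x ≤ z
  ≤-trans {y = y} x≤y y≤z z<x with <-cotrans z<x y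
  ... | inj₁ z<y = y≤z z<y
  ... | inj₂ y<x = x≤y y<x

  <-≤-trans : ∀ {x y z} → x < y → y ≤ z → x < z
  <-≤-trans {z = z} x<y y≤z with <-cotrans x<y z
  ... | inj₁ x<z = x<z
  ... | inj₂ z<y = contradiction z<y y≤z

  ≤-<-trans : ∀ {x y z} → x ≤ y → y < z → x < z
  ≤-<-trans {x} x≤y y<z with <-cotrans y<z x
  ... | inj₁ y<x = contradiction y<x x≤y
  ... | inj₂ x<z = x<z

  ≤-antisym : ∀ {x y} → x ≤ y → y ≤ x → x ≈ y
  ≤-antisym x≤y y≤x = proj₁ (tight _ _) λ x#y → Sum.[ y≤x , x≤y ] (Equivalence.to #⇔<⊎> x#y)

  ≤-respˡ : ∀ {x x′ y} → x ≈ x′ → x ≤ y → x′ ≤ y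
  ≤-respˡ e = ≤-trans (≤-reflexive (sym e))

  ≤-respʳ : ∀ {x y y′} → y ≈ y′ → x ≤ y → x ≤ y′
  ≤-respʳ e p = ≤-trans p (≤-reflexive e)

  ≤-resp : ∀ {x x′ y y′} → x ≈ x′ → y ≈ y′ → x ≤ y → x′ ≤ y′
  ≤-resp e e′ = ≤-respˡ e ∘ ≤-respʳ e′

  <-resp : ∀ {x x′ y y′} → x ≈ x′ → y ≈ y′ → x < y → x′ < y′
  <-resp e e′ = <-respˡ-≈ e ∘ <-respʳ-≈ e′

  +-monoˡ-< : ∀ x {y z} → y < z → y + x < z + x
  +-monoˡ-< x y<z = <-resp (+-comm _ _) (+-comm _ _) (+-monoʳ-< x y<z)

  +-monoʳ-≤ : ∀ x {y z} → y ≤ z → x + y ≤ x + z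
  +-monoʳ-≤ x {y} {z} y≤z q = y≤z (<-resp (cancel z) (cancel y) (+-monoʳ-< (- x) q))
    where
    cancel : ∀ w → - x + (x + w) ≈ w
    cancel w = solve 2 (λ x w → :- x :+ (x :+ w) := w) ≈-refl x w

  +-mono-≤ : ∀ {x x′ y y′} → x ≤ x′ → y ≤ y′ → x + y ≤ x′ + y′
  +-mono-≤ {x} {x′} {y} {y′} p q =
    ≤-trans (+-monoʳ-≤ x q) (≤-resp (+-comm _ _) (+-comm _ _) (+-monoʳ-≤ y′ p))

  +-mono-<-≤ : ∀ {x x′ y y′} → x < x′ → y ≤ y′ → x + y < x′ + y′
  +-mono-<-≤ {x} {x′} {y} {y′} p q = <-≤-trans (+-monoˡ-< y p) (+-monoʳ-≤ x′ q)

  +-mono-< : ∀ {x x′ y y′} → x < x′ → y < y′ → x + y < x′ + y′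
  +-mono-< p q = +-mono-<-≤ p (<⇒≤ q)

  +-nonneg : ∀ {x y} → 0# ≤ x → 0# ≤ y → 0# ≤ x + y
  +-nonneg p q = ≤-respˡ (+-identityˡ 0#) (+-mono-≤ p q)

  x≤x+y : ∀ {x y} → 0# ≤ y → x ≤ x + y
  x≤x+y {x} p = ≤-respˡ (+-identityʳ x) (+-monoʳ-≤ x p)

  y≤x+y : ∀ {x y} → 0# ≤ x → y ≤ x + y
  y≤x+y p = ≤-respʳ (+-comm _ _) (x≤x+y p)

  0≤1 : 0# ≤ 1#
  0≤1 = <⇒≤ 0<1

  ≤⇒0≤- : ∀ {x y} → x ≤ y → 0# ≤ y - x
  ≤⇒0≤- {x} {y} p = ≤-resp (-‿inverseˡ x) (+-comm _ _) (+-monoʳ-≤ (- x) p)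

  0≤-⇒≤ : ∀ {x y} → 0# ≤ y - x → x ≤ y
  0≤-⇒≤ {x} {y} p = ≤-resp (+-identityʳ x)
    (solve 2 (λ x y → x :+ (y :- x) := y) ≈-refl x y) (+-monoʳ-≤ x p)

  <⇒0<- : ∀ {x y} → x < y → 0# < y - x
  <⇒0<- {x} {y} p = <-resp (-‿inverseˡ x) (+-comm _ _) (+-monoʳ-< (- x) p)

  0<-⇒< : ∀ {x y} → 0# < y - x → x < y
  0<-⇒< {x} {y} p = <-resp (+-identityʳ x)
    (solve 2 (λ x y → x :+ (y :- x) := y) ≈-refl x y) (+-monoʳ-< x p)

  -- If z inverts x y, then y z inverts x. The differences with 0# appear because a Heyting field
  -- inverts x - y for x # y.
  *-#0ˡ : ∀ {x y} → x * y # 0# → x # 0#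
  *-#0ˡ {x} {y} p = invertible⇒# (y * z , eqˡ , eqʳ)
    where
    z : Carrier
    z = proj₁ (#⇒invertible p)
    eq : (x * y - 0#) * z ≈ 1#
    eq = proj₂ (proj₂ (#⇒invertible p))
    eqʳ : (x - 0#) * (y * z) ≈ 1#
    eqʳ = trans (solve 3 (λ x y z → (x :- con (+ 0)) :* (y :* z) := (x :* y :- con (+ 0)) :* z)
                  ≈-refl x y z) eq
    eqˡ : (y * z) * (x - 0#) ≈ 1#
    eqˡ = trans (*-comm _ _) eqʳ

  #0∧0≤⇒0< : ∀ {x} → x # 0# → 0# ≤ x → 0# < x
  #0∧0≤⇒0< x#0 0≤x with Equivalence.to #⇔<⊎> x#0
  ... | inj₁ x<0 = contradiction x<0 0≤x
  ... | inj₂ 0<x = 0<x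

  #-resp : ∀ {x x′ y} → x ≈ x′ → x # y → x′ # y
  #-resp e = Equivalence.from #⇔<⊎> ∘ Sum.map (<-respˡ-≈ e) (<-respʳ-≈ e) ∘ Equivalence.to #⇔<⊎>

  -- As ≤ is a negation, x y < 0 is to be refuted: it makes x y apart from 0, hence both factors
  -- apart from 0, hence both positive, so that x y is positive.
  *-nonneg : ∀ {x y} → 0# ≤ x → 0# ≤ y → 0# ≤ x * y
  *-nonneg {x} {y} 0≤x 0≤y xy<0 = <⇒≤ (*-pos
      (#0∧0≤⇒0< (*-#0ˡ xy#0) 0≤x) (#0∧0≤⇒0< (*-#0ˡ (#-resp (*-comm x y) xy#0)) 0≤y)) xy<0
    where
    xy#0 : x * y # 0#
    xy#0 = Equivalence.from #⇔<⊎> (inj₁ xy<0)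

  *-monoˡ-≤ : ∀ {z x y} → 0# ≤ z → x ≤ y → z * x ≤ z * y
  *-monoˡ-≤ {z} {x} {y} 0≤z x≤y = 0≤-⇒≤ (≤-respʳ
    (solve 3 (λ z x y → z :* (y :- x) := z :* y :- z :* x) ≈-refl z x y)
    (*-nonneg 0≤z (≤⇒0≤- x≤y)))

  *-monoʳ-≤ : ∀ {z x y} → 0# ≤ z → x ≤ y → x * z ≤ y * z
  *-monoʳ-≤ p q = ≤-resp (*-comm _ _) (*-comm _ _) (*-monoˡ-≤ p q)

  *-mono-≤ : ∀ {x x′ y y′} → 0# ≤ x → 0# ≤ y′ → x ≤ x′ → y ≤ y′ → x * y ≤ x′ * y′
  *-mono-≤ 0≤x 0≤y′ p q = ≤-trans (*-monoˡ-≤ 0≤x q) (*-monoʳ-≤ 0≤y′ p)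

  *-monoˡ-< : ∀ {z x y} → 0# < z → x < y → z * x < z * y
  *-monoˡ-< {z} {x} {y} 0<z x<y = 0<-⇒< (<-respʳ-≈
    (solve 3 (λ z x y → z :* (y :- x) := z :* y :- z :* x) ≈-refl z x y)
    (*-pos 0<z (<⇒0<- x<y)))

  *-cancelˡ-≤ : ∀ {z x y} → 0# < z → z * x ≤ z * y → x ≤ y
  *-cancelˡ-≤ 0<z p y<x = p (*-monoˡ-< 0<z y<x)

  0≤x+x⇒0≤x : ∀ {x} → 0# ≤ x + x → 0# ≤ x
  0≤x+x⇒0≤x p x<0 = p (<-respʳ-≈ (+-identityˡ 0#) (+-mono-< x<0 x<0))

  inverse : ∀ {x} → x # 0# → Carrier
  inverse x#0 = proj₁ (#⇒invertible x#0)

  *-inverse : ∀ {x} (x#0 : x # 0#) → x * inverse x#0 ≈ 1#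
  *-inverse {x} x#0 = trans (solve 2 (λ x y → x :* y := (x :- con (+ 0)) :* y)
    ≈-refl x (inverse x#0)) (proj₂ (proj₂ (#⇒invertible x#0)))

  *-inverse-cancel : ∀ {x} (x#0 : x # 0#) y → x * inverse x#0 * y ≈ y
  *-inverse-cancel x#0 y = trans (*-congʳ (*-inverse x#0)) (*-identityˡ y)

  inverse-pos : ∀ {x} (x#0 : x # 0#) → 0# < x → 0# < inverse x#0
  inverse-pos {x} x#0 0<x = #0∧0≤⇒0< (*-#0ˡ (#-resp yx≈1 (0<⇒#0 0<1))) λ y<0 →
    0≤1 (<-respˡ-≈ (*-inverse x#0) (<-respʳ-≈ (zeroʳ x) (*-monoˡ-< 0<x y<0)))
    where
    y : Carrier
    y = inverse x#0
    yx≈1 : 1# ≈ y * x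
    yx≈1 = sym (trans (*-comm _ _) (*-inverse x#0))

  ≤∣∣ : ∀ x → x ≤ ∣ x ∣
  ≤∣∣ x = x≤x⊔y x (- x)

  -≤∣∣ : ∀ x → - x ≤ ∣ x ∣
  -≤∣∣ x = y≤x⊔y x (- x)

  -- It cannot be decided which of x and - x is the maximum, but the maximum dominates both, so
  -- twice it dominates their sum 0.
  0≤∣∣ : ∀ x → 0# ≤ ∣ x ∣
  0≤∣∣ x = 0≤x+x⇒0≤x (≤-respˡ (-‿inverseʳ x) (+-mono-≤ (≤∣∣ x) (-≤∣∣ x)))

  ∣∣-mono : ∀ {x y} → x ≈ y → ∣ x ∣ ≤ ∣ y ∣
  ∣∣-mono {x} {y} e = ⊔-least (≤-respˡ (sym e) (≤∣∣ y)) (≤-respˡ (-‿cong (sym e)) (-≤∣∣ y))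

  ∣∣-cong : ∀ {x y} → x ≈ y → ∣ x ∣ ≈ ∣ y ∣
  ∣∣-cong e = ≤-antisym (∣∣-mono e) (∣∣-mono (sym e))

  ∣∣-nonneg : ∀ {x} → 0# ≤ x → ∣ x ∣ ≈ x
  ∣∣-nonneg {x} 0≤x = ≤-antisym (⊔-least ≤-refl
    (0≤-⇒≤ (≤-respʳ (solve 1 (λ x → x :+ x := x :- (:- x)) ≈-refl x) (+-nonneg 0≤x 0≤x)))) (≤∣∣ x)

  ∣∣-+ : ∀ x y → ∣ x + y ∣ ≤ ∣ x ∣ + ∣ y ∣
  ∣∣-+ x y = ⊔-least (+-mono-≤ (≤∣∣ x) (≤∣∣ y))
    (≤-respˡ (solve 2 (λ x y → :- x :+ :- y := :- (x :+ y)) ≈-refl x y) (+-mono-≤ (-≤∣∣ x) (-≤∣∣ y)))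

  ∣∣-neg : ∀ x → ∣ - x ∣ ≤ ∣ x ∣
  ∣∣-neg x = ⊔-least (-≤∣∣ x) (≤-respˡ (solve 1 (λ x → x := :- (:- x)) ≈-refl x) (≤∣∣ x))

  -- 2(∣x∣∣y∣ - xy) = (∣x∣ - x)(∣y∣ + y) + (∣x∣ + x)(∣y∣ - y)
  *≤∣∣*∣∣ : ∀ x y → x * y ≤ ∣ x ∣ * ∣ y ∣
  *≤∣∣*∣∣ x y = 0≤-⇒≤ (0≤x+x⇒0≤x (≤-respʳ
    (solve 4 (λ x y p q → (p :- x) :* (q :- (:- y)) :+ (p :- (:- x)) :* (q :- y)
        := (p :* q :- x :* y) :+ (p :* q :- x :* y)) ≈-refl x y ∣ x ∣ ∣ y ∣)
    (+-nonneg (*-nonneg (≤⇒0≤- (≤∣∣ x)) (≤⇒0≤- (-≤∣∣ y))) (*-nonneg (≤⇒0≤- (-≤∣∣ x)) (≤⇒0≤- (≤∣∣ y))))))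

  ∣∣-* : ∀ x y → ∣ x * y ∣ ≤ ∣ x ∣ * ∣ y ∣
  ∣∣-* x y = ⊔-least (*≤∣∣*∣∣ x y) (≤-respˡ (solve 2 (λ x y → (:- x) :* y := :- (x :* y)) ≈-refl x y)
    (≤-trans (*≤∣∣*∣∣ (- x) y) (*-monoʳ-≤ (0≤∣∣ y) (∣∣-neg x))))

  -- The half of multiplicativity that lets an estimate be divided by x > 0. The inverse of x
  -- recovers z and - z from x z and its negative, so both lie below the inverse times ∣ x * z ∣.
  *∣∣-≤ : ∀ {x} → 0# < x → ∀ z → x * ∣ z ∣ ≤ ∣ x * z ∣
  *∣∣-≤ {x} 0<x z = ≤-respʳ (cancel ∣ x * z ∣) (*-monoˡ-≤ (<⇒≤ 0<x) (⊔-least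
      (≤-respˡ (uncancel z) (*-monoˡ-≤ 0≤y (≤∣∣ (x * z))))
      (≤-respˡ (trans (solve 2 (λ y w → y :* :- w := :- (y :* w)) ≈-refl y (x * z)) (-‿cong (uncancel z)))
        (*-monoˡ-≤ 0≤y (-≤∣∣ (x * z))))))
    where
    x#0 : x # 0#
    x#0 = 0<⇒#0 0<x
    y : Carrier
    y = inverse x#0
    0≤y : 0# ≤ y
    0≤y = <⇒≤ (inverse-pos x#0 0<x)
    cancel : ∀ w → x * (y * w) ≈ w
    cancel w = trans (sym (*-assoc x y w)) (*-inverse-cancel x#0 w)
    uncancel : ∀ w → y * (x * w) ≈ w
    uncancel w = trans (solve 3 (λ x y w → y :* (x :* w) := x :* (y :* w)) ≈-refl x y w) (cancel w)

  fromℕ-nonneg : ∀ n → 0# ≤ fromℕ n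
  fromℕ-nonneg zero    = ≤-refl
  fromℕ-nonneg (suc n) = +-nonneg 0≤1 (fromℕ-nonneg n)

  fromℕ-* : ∀ m n → fromℕ (m ℕ.* n) ≈ fromℕ m * fromℕ n
  fromℕ-* = SemiringMult.×1-homo-* (CommutativeRing.semiring commutativeRing)

-- Formal power series, the operator θ, and powers of a series without constant term.

-- The Cauchy product recurses on the first coefficient of the left factor, so that ring identities
-- are proved by induction on the index.
module PowerSeries {r₁ r₂ : Level} (𝑅 : CommutativeRing r₁ r₂) where
  open CommutativeRing 𝑅 hiding (zero) renaming (refl to ≈-refl)
  open IntegerSolver 𝑅
  open SemiringMult semiring using (×-congʳ) renaming (_×_ to _·_)
  open SetoidReasoning setoid

  Series : Set r₁
  Series = ℕ → Carrier

  infix 4 _≋_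
  _≋_ : Series → Series → Set r₂
  f ≋ g = ∀ n → f n ≈ g n

  tail : Series → Series
  tail f = f ∘ suc

  infixl 6 _⊞_
  infixl 7 _⋆_ _⊡_
  _⊞_ _⋆_ : Series → Series → Series
  (f ⊞ g) n = f n + g n
  (f ⋆ g) zero    = f 0 * g 0
  (f ⋆ g) (suc n) = f 0 * g (suc n) + (tail f ⋆ g) n

  _⊡_ : Carrier → Series → Series
  (x ⊡ f) n = x * f n

  ⊟_ : Series → Series
  (⊟ f) n = - f n

  𝟎 δ : Series
  𝟎 _ = 0#
  δ zero    = 1#
  δ (suc _) = 0#

  θ : Series → Series
  θ f n = (n · 1#) * f n

  ⋆-cong : ∀ {f f′ g g′} → f ≋ f′ → g ≋ g′ → f ⋆ g ≋ f′ ⋆ g′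
  ⋆-cong p q zero    = *-cong (p 0) (q 0)
  ⋆-cong p q (suc n) = +-cong (*-cong (p 0) (q (suc n))) (⋆-cong (p ∘ suc) q n)

  ⋆-⊡ˡ : ∀ x f g → (x ⊡ f) ⋆ g ≋ x ⊡ (f ⋆ g)
  ⋆-⊡ˡ x f g zero    = *-assoc x (f 0) (g 0)
  ⋆-⊡ˡ x f g (suc n) = trans (+-cong (*-assoc _ _ _) (⋆-⊡ˡ x (tail f) g n)) (sym (distribˡ _ _ _))

  ⋆-distribʳ : ∀ h f g → (f ⊞ g) ⋆ h ≋ f ⋆ h ⊞ g ⋆ h
  ⋆-distribʳ h f g zero    = distribʳ _ _ _
  ⋆-distribʳ h f g (suc n) = trans (+-cong (distribʳ _ _ _) (⋆-distribʳ h (tail f) (tail g) n))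
    (solve 4 (λ a b c d → (a :+ b) :+ (c :+ d) := (a :+ c) :+ (b :+ d)) ≈-refl _ _ _ _)

  ⋆-zeroˡ : ∀ f → 𝟎 ⋆ f ≋ 𝟎
  ⋆-zeroˡ f zero    = zeroˡ _
  ⋆-zeroˡ f (suc n) = trans (+-cong (zeroˡ _) (⋆-zeroˡ f n)) (+-identityˡ 0#)

  ⋆-identityˡ : ∀ f → δ ⋆ f ≋ f
  ⋆-identityˡ f zero    = *-identityˡ _
  ⋆-identityˡ f (suc n) = trans (+-cong (*-identityˡ _) (⋆-zeroˡ f n)) (+-identityʳ _)

  -- The recursion on the right factor, complementing the one in the definition; it gives
  -- commutativity and the derivative of a product.
  ⋆-sucʳ : ∀ f g n → (f ⋆ g) (suc n) ≈ f (suc n) * g 0 + (f ⋆ tail g) n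
  ⋆-sucʳ f g zero    = +-comm _ _
  ⋆-sucʳ f g (suc n) = trans (+-congˡ (⋆-sucʳ (tail f) g n))
    (solve 3 (λ a b c → a :+ (b :+ c) := b :+ (a :+ c)) ≈-refl _ _ _)

  ⋆-comm : ∀ f g → f ⋆ g ≋ g ⋆ f
  ⋆-comm f g zero    = *-comm _ _
  ⋆-comm f g (suc n) = trans (+-cong (*-comm _ _) (⋆-comm (tail f) g n)) (sym (⋆-sucʳ g f n))

  ⋆-assoc : ∀ f g h → (f ⋆ g) ⋆ h ≋ f ⋆ (g ⋆ h)
  ⋆-assoc f g h zero    = *-assoc _ _ _
  ⋆-assoc f g h (suc n) = begin
    f 0 * g 0 * h (suc n) + (((f 0 ⊡ tail g) ⊞ (tail f ⋆ g)) ⋆ h) n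
      ≈⟨ +-congˡ (trans (⋆-distribʳ h (f 0 ⊡ tail g) (tail f ⋆ g) n)
        (+-cong (⋆-⊡ˡ (f 0) (tail g) h n) (⋆-assoc (tail f) g h n))) ⟩
    f 0 * g 0 * h (suc n) + (f 0 * (tail g ⋆ h) n + (tail f ⋆ (g ⋆ h)) n)
      ≈⟨ solve 5 (λ a b c d e → a :* b :* c :+ (a :* d :+ e) := a :* (b :* c :+ d) :+ e) ≈-refl _ _ _ _ _ ⟩
    f 0 * (g 0 * h (suc n) + (tail g ⋆ h) n) + (tail f ⋆ (g ⋆ h)) n ∎

  seriesRing : CommutativeRing r₁ r₂
  seriesRing = record
    { Carrier = Series ; _≈_ = _≋_ ; _+_ = _⊞_ ; _*_ = _⋆_ ; -_ = ⊟_ ; 0# = 𝟎 ; 1# = δ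
    ; isCommutativeRing = record
      { isRing = record
        { +-isAbelianGroup = record
          { isGroup = record
            { isMonoid = record
              { isSemigroup = record
                { isMagma = record
                  { isEquivalence = record
                    { refl = λ _ → ≈-refl ; sym = λ p n → sym (p n) ; trans = λ p q n → trans (p n) (q n) }
                  ; ∙-cong = λ p q n → +-cong (p n) (q n)
                  }
                ; assoc = λ f g h n → +-assoc (f n) (g n) (h n)
                }
              ; identity = (λ f n → +-identityˡ (f n)) , (λ f n → +-identityʳ (f n))
              }
            ; inverse = (λ f n → -‿inverseˡ (f n)) , (λ f n → -‿inverseʳ (f n))
            ; ⁻¹-cong = λ p n → -‿cong (p n)
            }
          ; comm = λ f g n → +-comm (f n) (g n)
          }
        ; *-cong = ⋆-cong
        ; *-assoc = ⋆-assoc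
        ; *-identity = ⋆-identityˡ , λ f n → trans (⋆-comm f δ n) (⋆-identityˡ f n)
        ; distrib = (λ h f g n → trans (⋆-comm h (f ⊞ g) n) (trans (⋆-distribʳ h f g n)
                      (+-cong (⋆-comm f h n) (⋆-comm g h n)))) , ⋆-distribʳ
        }
      ; *-comm = ⋆-comm
      }
    }

  module Ser where
    open CommutativeRing seriesRing public
    open IntegerSolver seriesRing public

  ⋆-⊡ʳ : ∀ x f g → f ⋆ (x ⊡ g) ≋ x ⊡ (f ⋆ g)
  ⋆-⊡ʳ x f g n = trans (⋆-comm f (x ⊡ g) n) (trans (⋆-⊡ˡ x g f n) (*-congˡ (⋆-comm g f n)))

  θ-cong : ∀ {f g} → f ≋ g → θ f ≋ θ g
  θ-cong p n = *-congˡ (p n)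

  tail-θ : ∀ f → tail (θ f) ≋ θ (tail f) ⊞ tail f
  tail-θ f n = trans (solve 3 (λ u x y → (u :+ x) :* y := x :* y :+ u :* y) ≈-refl 1# (n · 1#) (f (suc n)))
    (+-congˡ (*-identityˡ _))

  θ-⋆ : ∀ f g → θ (f ⋆ g) ≋ θ f ⋆ g ⊞ f ⋆ θ g
  θ-⋆ f g zero    = solve 2 (λ x y → con (+ 0) :* (x :* y) := (con (+ 0) :* x) :* y :+ x :* (con (+ 0) :* y))
    ≈-refl (f 0) (g 0)
  θ-⋆ f g (suc n) = begin
    suc n · 1# * (f 0 * g (suc n) + (tail f ⋆ g) n)
      ≈⟨ distribˡ _ _ _ ⟩
    -- `delay` puts the product at index suc n, so that `tail-θ` can split its factor suc n into n
    -- and 1.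
    suc n · 1# * (f 0 * g (suc n)) + tail (θ (delay (tail f ⋆ g))) n
      ≈⟨ +-congˡ (tail-θ (delay (tail f ⋆ g)) n) ⟩
    suc n · 1# * (f 0 * g (suc n)) + (θ (tail f ⋆ g) n + (tail f ⋆ g) n)
      ≈⟨ +-congˡ (+-congʳ (θ-⋆ (tail f) g n)) ⟩
    suc n · 1# * (f 0 * g (suc n)) + (((θ (tail f) ⋆ g) n + (tail f ⋆ θ g) n) + (tail f ⋆ g) n)
      ≈⟨ solve 6 (λ s x y a b c → s :* (x :* y) :+ ((a :+ b) :+ c) := ((con (+ 0) :* x) :* y :+ (a :+ c)) :+
        (x :* (s :* y) :+ b)) ≈-refl
           (suc n · 1#) (f 0) (g (suc n)) ((θ (tail f) ⋆ g) n) ((tail f ⋆ θ g) n) ((tail f ⋆ g) n) ⟩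
    (0# * f 0 * g (suc n) + ((θ (tail f) ⋆ g) n + (tail f ⋆ g) n)) + (f ⋆ θ g) (suc n)
      ≈⟨ +-congʳ (+-congˡ (trans (sym (⋆-distribʳ g (θ (tail f)) (tail f) n))
        (⋆-cong (λ k → sym (tail-θ f k)) (λ _ → ≈-refl) n))) ⟩
    (θ f ⋆ g) (suc n) + (f ⋆ θ g) (suc n) ∎
    where
    delay : Series → Series
    delay h zero    = 0#
    delay h (suc k) = h k

  -- The derivative of an exponential generating series is the tail of the sequence of totals.
  tail-θ-⋆ : ∀ f g n → (suc n · 1#) * (f ⋆ g) (suc n) ≈ (tail (θ f) ⋆ g) n + (f ⋆ tail (θ g)) n
  tail-θ-⋆ f g n = trans (θ-⋆ f g (suc n)) (+-cong
    (trans (+-congʳ (trans (*-congʳ (zeroˡ _)) (zeroˡ _))) (+-identityˡ _))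
    (trans (⋆-sucʳ f (θ g) n) (trans (+-congʳ (trans (*-congˡ (zeroˡ _)) (zeroʳ _))) (+-identityˡ _))))

  infixr 9 _↑_
  _↑_ : Series → ℕ → Series
  f ↑ zero  = δ
  f ↑ suc m = f ⋆ f ↑ m

  θ-↑ : ∀ f m → θ (f ↑ suc m) ≋ (suc m · 1#) ⊡ (f ↑ m ⋆ θ f)
  θ-↑ f zero n = begin
    θ (f ⋆ δ) n          ≈⟨ θ-cong (Ser.*-identityʳ f) n ⟩
    θ f n                ≈⟨ Ser.*-identityˡ (θ f) n ⟨
    (δ ⋆ θ f) n          ≈⟨ *-identityˡ _ ⟨
    1# * (δ ⋆ θ f) n     ≈⟨ *-congʳ (+-identityʳ 1#) ⟨
    1 · 1# * (δ ⋆ θ f) n ∎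
  θ-↑ f (suc m) n = begin
    θ (f ⋆ f ↑ suc m) n
      ≈⟨ θ-⋆ f (f ↑ suc m) n ⟩
    (θ f ⋆ f ↑ suc m) n + (f ⋆ θ (f ↑ suc m)) n
      ≈⟨ +-cong (⋆-comm (θ f) (f ↑ suc m) n) (⋆-cong (λ _ → ≈-refl) (θ-↑ f m) n) ⟩
    (f ↑ suc m ⋆ θ f) n + (f ⋆ ((suc m · 1#) ⊡ (f ↑ m ⋆ θ f))) n
      ≈⟨ +-congˡ (trans (⋆-⊡ʳ _ f (f ↑ m ⋆ θ f) n) (*-congˡ (sym (⋆-assoc f (f ↑ m) (θ f) n)))) ⟩
    (f ↑ suc m ⋆ θ f) n + suc m · 1# * (f ↑ suc m ⋆ θ f) n
      ≈⟨ +-congʳ (*-identityˡ _) ⟨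
    1# * (f ↑ suc m ⋆ θ f) n + suc m · 1# * (f ↑ suc m ⋆ θ f) n
      ≈⟨ distribʳ _ _ _ ⟨
    suc (suc m) · 1# * (f ↑ suc m ⋆ θ f) n ∎

  Σ< : ℕ → Series → Carrier
  Σ< zero    t = 0#
  Σ< (suc n) t = t 0 + Σ< n (t ∘ suc)

  Σ<-cong : ∀ n {s t} → (∀ k → k ℕ.< n → s k ≈ t k) → Σ< n s ≈ Σ< n t
  Σ<-cong zero    e = ≈-refl
  Σ<-cong (suc n) e = +-cong (e 0 (s≤s z≤n)) (Σ<-cong n (λ k k<n → e (suc k) (s≤s k<n)))

  Σ<-*ˡ : ∀ n z t → Σ< n (λ k → z * t k) ≈ z * Σ< n t
  Σ<-*ˡ zero    z t = sym (zeroʳ z)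
  Σ<-*ˡ (suc n) z t = trans (+-congˡ (Σ<-*ˡ n z (t ∘ suc))) (sym (distribˡ _ _ _))

  Σ<-suc : ∀ n t → t n ≈ 0# → Σ< (suc n) t ≈ Σ< n t
  Σ<-suc zero    t tn≈0 = trans (+-identityʳ _) tn≈0
  Σ<-suc (suc n) t tn≈0 = +-congˡ (Σ<-suc n (t ∘ suc) tn≈0)

  Σ<-stable : ∀ {m n} t → m ℕ.≤′ n → (∀ k → m ℕ.≤ k → t k ≈ 0#) → Σ< n t ≈ Σ< m t
  Σ<-stable t ℕ.≤′-refl       t≈0 = ≈-refl
  Σ<-stable t (ℕ.≤′-step m≤n) t≈0 = trans (Σ<-suc _ t (t≈0 _ (ℕ.≤′⇒≤ m≤n))) (Σ<-stable t m≤n t≈0)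

  ⋆-Σ< : ∀ f g n → (f ⋆ g) n ≈ Σ< (suc n) (λ i → f i * g (n ∸ i))
  ⋆-Σ< f g zero    = sym (+-identityʳ _)
  ⋆-Σ< f g (suc n) = +-congˡ (⋆-Σ< (tail f) g n)

  -- Coefficient n of a product sees the factors up to index n only. This serves series that agree
  -- just on an initial segment, as a partial sum of powers of b does with the full sum.
  ⋆-cong≤ : ∀ {f f′ g g′} n → (∀ i → i ℕ.≤ n → f i ≈ f′ i) → (∀ i → i ℕ.≤ n → g i ≈ g′ i) → (f ⋆ g) n ≈
    (f′ ⋆ g′) n
  ⋆-cong≤ zero    p q = *-cong (p 0 z≤n) (q 0 z≤n)
  ⋆-cong≤ (suc n) p q = +-cong (*-cong (p 0 z≤n) (q (suc n) ℕ.≤-refl))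
    (⋆-cong≤ n (λ i i≤n → p (suc i) (s≤s i≤n)) (λ i i≤n → q i (ℕ.m≤n⇒m≤1+n i≤n)))

  Σ<-⋆ : ∀ N (f : ℕ → Series) g n → Σ< N (λ m → (f m ⋆ g) n) ≈ ((λ i → Σ< N (λ m → f m i)) ⋆ g) n
  Σ<-⋆ zero    f g n = sym (⋆-zeroˡ g n)
  Σ<-⋆ (suc N) f g n = trans (+-congˡ (Σ<-⋆ N (f ∘ suc) g n))
    (sym (⋆-distribʳ g (f 0) (λ i → Σ< N (λ m → f (suc m) i)) n))

  module _ (b : Series) (b₀ : b 0 ≈ 0#) where

    -- Each factor b lacks a constant term and so raises the order by one. Sums over all powers of b
    -- are therefore finite in every coefficient.
    ↑-vanishes : ∀ m n → n ℕ.< m → (b ↑ m) n ≈ 0#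
    ↑-vanishes (suc m) zero    _         = trans (*-congʳ b₀) (zeroˡ _)
    ↑-vanishes (suc m) (suc n) (s≤s n<m) = trans (+-congʳ (trans (*-congʳ b₀) (zeroˡ _)))
      (trans (+-identityˡ _) (trans (⋆-cong≤ {tail b} {tail b} {b ↑ m} {𝟎} n (λ _ _ → ≈-refl)
          (λ i i≤n → ↑-vanishes m i (ℕ.≤-<-trans i≤n n<m)))
        (trans (⋆-comm (tail b) 𝟎 n) (⋆-zeroˡ (tail b) n))))

    -- The series 1 / (1 - b): the powers beyond the n-th do not reach coefficient n.
    geometric : Series
    geometric n = Σ< (suc n) (λ m → (b ↑ m) n)

    geometric-upTo : ∀ {n} N → n ℕ.< N → Σ< N (λ m → (b ↑ m) n) ≈ geometric n
    geometric-upTo {n} N n<N = Σ<-stable (λ m → (b ↑ m) n) (ℕ.≤⇒≤′ n<N) (λ m → ↑-vanishes m n)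

    Σ<-↑-⋆ : ∀ g n → Σ< (suc n) (λ m → (b ↑ m ⋆ g) n) ≈ (geometric ⋆ g) n
    Σ<-↑-⋆ g n = trans (Σ<-⋆ (suc n) (b ↑_) g n)
      (⋆-cong≤ n (λ i i≤n → geometric-upTo (suc n) (s≤s i≤n)) (λ _ _ → ≈-refl))

    geometric-equation : geometric ≋ δ ⊞ b ⋆ geometric
    geometric-equation n = begin
      -- The vanishing summand m = n + 1 is included, so that suc n summands remain once m = 0 is
      -- split off.
      geometric n                                   ≈⟨ geometric-upTo (suc (suc n)) (ℕ.m≤n⇒m≤1+n ℕ.≤-refl) ⟨
      δ n + Σ< (suc n) (λ m → (b ⋆ b ↑ m) n)        ≈⟨ +-congˡ (Σ<-cong (suc n) (λ m _ → ⋆-comm b (b ↑ m) n))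
        ⟩
      δ n + Σ< (suc n) (λ m → (b ↑ m ⋆ b) n)        ≈⟨ +-congˡ (Σ<-↑-⋆ b n) ⟩
      δ n + (geometric ⋆ b) n                       ≈⟨ +-congˡ (⋆-comm geometric b n) ⟩
      δ n + (b ⋆ geometric) n                       ∎

    geometric-inverse : geometric ⋆ (δ ⊞ ⊟ b) ≋ δ
    geometric-inverse = Ser.trans (Ser.solve 3 (λ u g b → g Ser.:* (u Ser.:- b) Ser.:= u Ser.:* g Ser.:- b
      Ser.:* g) Ser.refl δ geometric b)
      (λ n → trans (+-congʳ (trans (⋆-identityˡ geometric n) (geometric-equation n)))
        (solve 2 (λ x y → (x :+ y) :- y := x) ≈-refl _ _))

    -- The series Σ b^m / m = - log (1 - b).
    logarithm-equation : ∀ (κ : ℕ → Carrier) → κ 0 ≈ 0# → (∀ m → κ (suc m) * (suc m · 1#) ≈ 1#) →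
                         θ (λ n → Σ< (suc n) (λ m → κ m * (b ↑ m) n)) ⋆ (δ ⊞ ⊟ b) ≋ θ b
    logarithm-equation κ κ₀ κ-suc = Ser.trans (⋆-cong θ-log Ser.refl)
      (Ser.trans (Ser.solve 4 (λ u g b t → (g Ser.:* t) Ser.:* (u Ser.:- b) Ser.:= (g Ser.:* (u Ser.:- b))
        Ser.:* t) Ser.refl δ geometric b (θ b))
        (Ser.trans (⋆-cong geometric-inverse Ser.refl) (⋆-identityˡ (θ b))))
      where
      -- The power rule for θ produces the factor m + 1, which κ (m + 1) cancels.
      term : ∀ m n → (n · 1#) * (κ (suc m) * (b ↑ suc m) n) ≈ (b ↑ m ⋆ θ b) n
      term m n = begin
        (n · 1#) * (κ (suc m) * (b ↑ suc m) n)
          ≈⟨ solve 3 (λ x y z → x :* (y :* z) := y :* (x :* z)) ≈-refl _ _ _ ⟩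
        κ (suc m) * θ (b ↑ suc m) n
          ≈⟨ *-congˡ (θ-↑ b m n) ⟩
        κ (suc m) * ((suc m · 1#) * (b ↑ m ⋆ θ b) n)
          ≈⟨ *-assoc _ _ _ ⟨
        κ (suc m) * (suc m · 1#) * (b ↑ m ⋆ θ b) n
          ≈⟨ trans (*-congʳ (κ-suc m)) (*-identityˡ _) ⟩
        (b ↑ m ⋆ θ b) n ∎
      θ-log : θ (λ n → Σ< (suc n) (λ m → κ m * (b ↑ m) n)) ≋ geometric ⋆ θ b
      θ-log n = begin
        (n · 1#) * Σ< (suc n) (λ m → κ m * (b ↑ m) n)
          ≈⟨ *-congˡ (Σ<-suc (suc n) (λ m → κ m * (b ↑ m) n)
            (trans (*-congˡ (↑-vanishes (suc n) n ℕ.≤-refl)) (zeroʳ _))) ⟨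
        (n · 1#) * (κ 0 * δ n + Σ< (suc n) (λ m → κ (suc m) * (b ↑ suc m) n))
          ≈⟨ *-congˡ (trans (+-congʳ (trans (*-congʳ κ₀) (zeroˡ _))) (+-identityˡ _)) ⟩
        (n · 1#) * Σ< (suc n) (λ m → κ (suc m) * (b ↑ suc m) n)
          ≈⟨ Σ<-*ˡ (suc n) (n · 1#) (λ m → κ (suc m) * (b ↑ suc m) n) ⟨
        Σ< (suc n) (λ m → (n · 1#) * (κ (suc m) * (b ↑ suc m) n))
          ≈⟨ Σ<-cong (suc n) (λ m _ → term m n) ⟩
        Σ< (suc n) (λ m → (b ↑ m ⋆ θ b) n)
          ≈⟨ Σ<-↑-⋆ (θ b) n ⟩
        (geometric ⋆ θ b) n ∎

-- Majorants and partial sums of Cauchy products.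

module Expansions {c ℓ₁ ℓ₂ : Level} (ℝ : RealNumbers c ℓ₁ ℓ₂) where
  open OrderedField ℝ
  open PowerSeries commutativeRing
  open SetoidReasoning setoid

  fromℕ-mono : ∀ {m n} → m ℕ.≤ n → fromℕ m ≤ fromℕ n
  fromℕ-mono {n = n} z≤n = fromℕ-nonneg n
  fromℕ-mono (s≤s p) = +-monoʳ-≤ 1# (fromℕ-mono p)

  -- The majorants are required up to index n only, because in the cyclic case one of them depends
  -- on n and is valid just on an initial segment.
  ∣⋆∣-≤ : ∀ {f f′ g g′} n → (∀ i → i ℕ.≤ n → ∣ f i ∣ ≤ f′ i) → (∀ i → i ℕ.≤ n → ∣ g i ∣ ≤ g′ i) →
          ∣ (f ⋆ g) n ∣ ≤ (f′ ⋆ g′) n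
  ∣⋆∣-≤ zero p q = ≤-trans (∣∣-* _ _) (*-mono-≤ (0≤∣∣ _) (≤-trans (0≤∣∣ _) (q 0 z≤n)) (p 0 z≤n) (q 0 z≤n))
  ∣⋆∣-≤ (suc n) p q = ≤-trans (∣∣-+ _ _) (+-mono-≤
    (≤-trans (∣∣-* _ _) (*-mono-≤ (0≤∣∣ _) (≤-trans (0≤∣∣ _) (q (suc n) ℕ.≤-refl)) (p 0 z≤n)
      (q (suc n) ℕ.≤-refl)))
    (∣⋆∣-≤ n (λ i i≤n → p (suc i) (s≤s i≤n)) (λ i i≤n → q i (ℕ.m≤n⇒m≤1+n i≤n))))

  drop : ℕ → Series → Series
  drop r f n = f (r ℕ.+ n)

  -- The sum of f k * g (n - k) over k < r, which is at once the first r terms of a Cauchy product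
  -- and a partial sum of an expansion. For k > n the subtraction stops at 0, but asymptotic
  -- statements concern large n.
  truncated : ℕ → Series → Series → Series
  truncated zero    f g n = 0#
  truncated (suc r) f g n = f 0 * g n + truncated r (tail f) g (n ∸ 1)

  truncated-congˡ : ∀ r {f f′} g → f ≋ f′ → truncated r f g ≋ truncated r f′ g
  truncated-congˡ zero    g e n = ≈-refl
  truncated-congˡ (suc r) g e n = +-cong (*-congʳ (e 0)) (truncated-congˡ r g (e ∘ suc) (n ∸ 1))

  truncated-congʳ : ∀ r f {g g′} → g ≋ g′ → truncated r f g ≋ truncated r f g′
  truncated-congʳ zero    f e n = ≈-refl
  truncated-congʳ (suc r) f e n = +-cong (*-congˡ (e n)) (truncated-congʳ r (tail f) e (n ∸ 1))

  truncated-⊞ : ∀ r f g h → truncated r (f ⊞ g) h ≋ truncated r f h ⊞ truncated r g h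
  truncated-⊞ zero    f g h n = sym (+-identityˡ 0#)
  truncated-⊞ (suc r) f g h n = trans (+-congˡ (truncated-⊞ r (tail f) (tail g) h (n ∸ 1)))
    (solve 5 (λ x y z u v → (x :+ y) :* z :+ (u :+ v) := (x :* z :+ u) :+ (y :* z :+ v)) ≈-refl _ _ _ _ _)

  truncated-⊡ : ∀ r x f h → truncated r (x ⊡ f) h ≋ x ⊡ truncated r f h
  truncated-⊡ zero    x f h n = sym (zeroʳ x)
  truncated-⊡ (suc r) x f h n = trans (+-congˡ (truncated-⊡ r x (tail f) h (n ∸ 1)))
    (solve 4 (λ x y z u → (x :* y) :* z :+ x :* u := x :* (y :* z :+ u)) ≈-refl _ _ _ _)

  truncated-⊟ : ∀ r f h → truncated r (⊟ f) h ≋ ⊟ truncated r f h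
  truncated-⊟ zero    f h n = solve 0 (con (+ 0) := :- con (+ 0)) ≈-refl
  truncated-⊟ (suc r) f h n = trans (+-congˡ (truncated-⊟ r (tail f) h (n ∸ 1)))
    (solve 3 (λ x y z → (:- x) :* y :+ :- z := :- (x :* y :+ z)) ≈-refl _ _ _)

  truncated-𝟎 : ∀ r h → truncated r 𝟎 h ≋ 𝟎
  truncated-𝟎 zero    h n = ≈-refl
  truncated-𝟎 (suc r) h n = trans (+-cong (zeroˡ _) (truncated-𝟎 r h (n ∸ 1))) (+-identityˡ 0#)

  truncated-δ : ∀ r h → truncated (suc r) δ h ≋ h
  truncated-δ r h n = trans (+-cong (*-identityˡ _) (truncated-𝟎 r h (n ∸ 1))) (+-identityʳ _)

  -- The constant term of f keeps length and index, while its tail loses one of each; this is the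
  -- recursion of `truncated-expansion`.
  truncated-⋆ : ∀ r f e h → truncated (suc r) (f ⋆ e) h ≋
                (λ n → f 0 * truncated (suc r) e h n + truncated r (tail f ⋆ e) h (n ∸ 1))
  truncated-⋆ r f e h n = trans
    (+-congˡ (trans (truncated-⊞ r (f 0 ⊡ tail e) (tail f ⋆ e) h (n ∸ 1))
      (+-congʳ (truncated-⊡ r (f 0) (tail e) h (n ∸ 1)))))
    (solve 5 (λ x y z u v → (x :* y) :* z :+ (x :* u :+ v) := x :* (y :* z :+ u) :+ v) ≈-refl _ _ _ _ _)

  -- The Leibniz rule for partial sums: the term f i * g (n - i) receives the factors n - i and i,
  -- which add up to n. Writing n as r + k ensures i ≤ n, so that n - i is a true difference.
  truncated-θ : ∀ r f g k → truncated r f (θ g) (r ℕ.+ k) + truncated r (θ f) g (r ℕ.+ k) ≈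
                            fromℕ (r ℕ.+ k) * truncated r f g (r ℕ.+ k)
  truncated-θ zero    f g k = trans (+-identityˡ 0#) (sym (zeroʳ _))
  truncated-θ (suc r) f g k = begin
    (f 0 * (N * g n) + truncated r (tail f) (θ g) n′) + ((0# * f 0) * g n + truncated r (tail (θ f)) g n′)
      ≈⟨ +-congˡ (+-congˡ (trans (truncated-congˡ r g (tail-θ f) n′)
        (truncated-⊞ r (θ (tail f)) (tail f) g n′))) ⟩
    (f 0 * (N * g n) + truncated r (tail f) (θ g) n′) + ((0# * f 0) * g n +
      (truncated r (θ (tail f)) g n′ + X))
      ≈⟨ solve 6 (λ x y z u v t → (x :* (y :* z) :+ u) :+ ((con (+ 0) :* x) :* z :+ (v :+ t)) := y :* (x :* z)
        :+ ((u :+ v) :+ t)) ≈-refl _ _ _ _ _ _ ⟩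
    N * (f 0 * g n) + ((truncated r (tail f) (θ g) n′ + truncated r (θ (tail f)) g n′) + X)
      ≈⟨ +-congˡ (+-congʳ (truncated-θ r (tail f) g k)) ⟩
    N * (f 0 * g n) + (fromℕ n′ * X + X)
      ≈⟨ +-congˡ (trans (+-comm _ _) (+-congʳ (sym (*-identityˡ X)))) ⟩
    N * (f 0 * g n) + (1# * X + fromℕ n′ * X)
      ≈⟨ +-congˡ (distribʳ _ _ _) ⟨
    N * (f 0 * g n) + N * X
      ≈⟨ distribˡ _ _ _ ⟨
    N * (f 0 * g n + X) ∎
    where
    n n′ : ℕ
    n  = suc (r ℕ.+ k)
    n′ = r ℕ.+ k
    N X : Carrier
    N = fromℕ n
    X = truncated r (tail f) g n′

  ⋆-peel : ∀ r f g k → (f ⋆ g) (r ℕ.+ k) ≈ truncated r f g (r ℕ.+ k) + (drop r f ⋆ g) k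
  ⋆-peel zero    f g k = sym (+-identityˡ _)
  ⋆-peel (suc r) f g k = trans (+-congˡ (⋆-peel r (tail f) g k)) (sym (+-assoc _ _ _))

  truncated-drop : ∀ r s f g k → truncated r g (drop s f) (r ℕ.+ k) ≈ truncated r g f (s ℕ.+ (r ℕ.+ k))
  truncated-drop zero    s f g k = ≈-refl
  truncated-drop (suc r) s f g k = +-congˡ (trans (truncated-drop r s f (tail g) k)
    (reflexive (cong (λ i → truncated r (tail g) f (i ∸ 1)) (≡.sym (ℕ.+-suc s (r ℕ.+ k))))))

  -- For n ≥ 2 r the first r and the last r terms do not overlap, and what lies between is again a
  -- coefficient of a Cauchy product, that of the shifted series.
  ⋆-split : ∀ r f g k → let n = r ℕ.+ (r ℕ.+ k) in
            (f ⋆ g) n ≈ (truncated r f g n + truncated r g f n) + (drop r g ⋆ drop r f) k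
  ⋆-split r f g k = trans (⋆-peel r f g (r ℕ.+ k)) (trans (+-congˡ (trans (⋆-comm (drop r f) g (r ℕ.+ k))
    (trans (⋆-peel r g (drop r f) k) (+-congʳ (truncated-drop r r f g k))))) (sym (+-assoc _ _ _)))

  -- Negligible errors and asymptotic expansions relative to `a`.

  module RelativeTo (a : Series) (0≤a : ∀ n → 0# ≤ a n)
           (a-convolution : ∀ r → ∃[ K ] ∃[ N ] ∀ j → N ℕ.≤ j → (drop r a ⋆ drop r a) j ≤ K * a (r ℕ.+ j))
             where

    -- The relation h n = O(a (n - r)), with `a` itself on the right since its coefficients are
    -- nonnegative.
    record Negligible (r : ℕ) (h : Series) : Set (c ⊔ˡ ℓ₂) where
      constructor negligible
      field
        constant  : Carrier
        threshold : ℕ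
        bound     : ∀ n → threshold ℕ.≤ n → ∣ h n ∣ ≤ constant * a (n ∸ r)

    open Negligible

    neg-eventually : ∀ {r h h′} N → (∀ n → N ℕ.≤ n → h n ≈ h′ n) → Negligible r h → Negligible r h′
    neg-eventually N e (negligible K M p) = negligible K (N ℕ.⊔ M) λ n le →
      ≤-respˡ (∣∣-cong (e n (ℕ.m⊔n≤o⇒m≤o N M le))) (p n (ℕ.m⊔n≤o⇒n≤o N M le))

    neg-cong : ∀ {r h h′} → h ≋ h′ → Negligible r h → Negligible r h′
    neg-cong e = neg-eventually 0 (λ n _ → e n)

    neg-⊞ : ∀ {r h h′} → Negligible r h → Negligible r h′ → Negligible r (h ⊞ h′)
    neg-⊞ (negligible K N p) (negligible L M q) = negligible (K + L) (N ℕ.⊔ M) λ n le → ≤-trans (∣∣-+ _ _)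
      (≤-respʳ (sym (distribʳ _ _ _)) (+-mono-≤ (p n (ℕ.m⊔n≤o⇒m≤o N M le)) (q n (ℕ.m⊔n≤o⇒n≤o N M le))))

    neg-⊡ : ∀ {r h} x → Negligible r h → Negligible r (x ⊡ h)
    neg-⊡ x (negligible K N p) = negligible (∣ x ∣ * K) N λ n le → ≤-trans (∣∣-* _ _)
      (≤-respʳ (sym (*-assoc _ _ _)) (*-monoˡ-≤ (0≤∣∣ x) (p n le)))

    neg-⊟ : ∀ {r h} → Negligible r h → Negligible r (⊟ h)
    neg-⊟ (negligible K N p) = negligible K N λ n le → ≤-trans (∣∣-neg _) (p n le)

    neg-shift : ∀ {r h} → Negligible r h → Negligible (suc r) (λ n → h (n ∸ 1))
    neg-shift {r} {h} (negligible K N p) = negligible K (suc N) λ n le →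
      ≤-respʳ (reflexive (cong (λ i → K * a i) (ℕ.∸-+-assoc n 1 r))) (p (n ∸ 1) (ℕ.∸-monoˡ-≤ 1 le))

    neg-𝟎 : ∀ {r} → Negligible r 𝟎
    neg-𝟎 = negligible 0# 0 λ n _ → ≤-reflexive (trans (∣∣-nonneg ≤-refl) (sym (zeroˡ _)))

    neg-δ : ∀ {r} → Negligible r δ
    neg-δ = neg-eventually 1 (λ { (suc n) _ → ≈-refl }) neg-𝟎

    -- The bound holds at all indices and not just eventually, because every coefficient from the
    -- r-th on can occur in the middle part of a product.
    Dominated : Series → Set (c ⊔ˡ ℓ₂)
    Dominated f = ∃[ K ] 0# ≤ K × ∀ n → ∣ f n ∣ ≤ K * a n

    a-dominated : Dominated a
    a-dominated = 1# , 0≤1 , λ n → ≤-reflexive (trans (∣∣-nonneg (0≤a n)) (sym (*-identityˡ _)))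

    Expansion : Series → Series → Set (c ⊔ˡ ℓ₂)
    Expansion f d = ∀ r → Negligible r (f ⊞ ⊟ truncated r d a)

    Expansion≤ : ℕ → Series → Series → Set (c ⊔ˡ ℓ₂)
    Expansion≤ r f d = ∀ s → s ℕ.≤ r → Negligible s (f ⊞ ⊟ truncated s d a)

    -- Bootstrapping for a series given by an equation: order 0 is mere domination, and each further
    -- order is read off the equation. The step receives all lower orders, because
    -- `truncated-expansion` consults a different one for each coefficient.
    expansion-by-steps : ∀ {f d} → Negligible 0 f →
                         (∀ r → Expansion≤ r f d → Negligible (suc r) (f ⊞ ⊟ truncated (suc r) d a)) →
                           Expansion f d
    expansion-by-steps {f} {d} p₀ step r = go r r ℕ.≤-refl
      where
      go : ∀ r → Expansion≤ r f d
      go zero    zero    _ = neg-cong (λ n → solve 1 (λ x → x := x :- con (+ 0)) ≈-refl _) p₀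
      go (suc r) s s≤ with ℕ.m≤n⇒m<n∨m≡n s≤
      ... | inj₁ (s≤s s≤r) = go r s s≤r
      ... | inj₂ refl      = step r (go r)

    dominated⇒negligible : ∀ {f} → Dominated f → Negligible 0 f
    dominated⇒negligible (K , _ , p) = negligible K 0 λ n _ → p n

    -- The k-th coefficient of f multiplies g delayed by k, and the delay gains k orders; so order r
    -- - k of the expansion of g suffices there.
    truncated-expansion : ∀ r {g e} → Expansion≤ r g e → ∀ f → Negligible r
      (truncated r f g ⊞ ⊟ truncated r (f ⋆ e) a)
    truncated-expansion zero    x f = neg-cong (λ n → solve 0 (con (+ 0) := con (+ 0) :- con (+ 0)) ≈-refl)
      neg-𝟎
    truncated-expansion (suc r) {g} {e} x f = neg-cong
      (λ n → sym (trans (+-congˡ (-‿cong (truncated-⋆ r f e a n)))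
        (solve 5 (λ u v w y z → (u :* v :+ y) :- (u :* w :+ z) := u :* (v :- w) :+ (y :- z)) ≈-refl _ _ _ _
          _)))
      (neg-⊞ (neg-⊡ (f 0) (x (suc r) ℕ.≤-refl))
             (neg-shift (truncated-expansion r (λ s s≤r → x s (ℕ.m≤n⇒m≤1+n s≤r)) (tail f))))

    from-split : ∀ r N {P : ℕ → Set ℓ₂} → (∀ j → N ℕ.≤ j → P (r ℕ.+ (r ℕ.+ j))) → ∀ n → (r ℕ.+ r) ℕ.+ N ℕ.≤ n
      → P n
    from-split r N {P} p n le = subst P
      (≡.trans (≡.sym (ℕ.+-assoc r r _)) (ℕ.m+[n∸m]≡n (ℕ.m+n≤o⇒m≤o (r ℕ.+ r) le)))
      (p (n ∸ (r ℕ.+ r)) (ℕ.≤-trans (ℕ.≤-reflexive (≡.sym (ℕ.m+n∸m≡n (r ℕ.+ r) N)))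
        (ℕ.∸-monoˡ-≤ (r ℕ.+ r) le)))

    -- The factor x is kept apart from the constants since it may vary with j: the cyclic case takes
    -- x = n, and bounds f by x times a only at the indices that occur.
    drop-⋆-bound : ∀ r {f g x} j → 0# ≤ x → (∀ i → i ℕ.≤ j → ∣ f (r ℕ.+ i) ∣ ≤ x * a (r ℕ.+ i)) →
      (g-dominated : Dominated g) →
                   proj₁ (proj₂ (a-convolution r)) ℕ.≤ j →
                   ∣ (drop r g ⋆ drop r f) j ∣ ≤ x * ((proj₁ g-dominated * proj₁ (a-convolution r)) * a
                     (r ℕ.+ j))
    drop-⋆-bound r {f} {g} {x} j 0≤x p (L , 0≤L , q) N≤j = ≤-trans
      (∣⋆∣-≤ {drop r g} {L ⊡ drop r a} {drop r f} {x ⊡ drop r a} j (λ i _ → q (r ℕ.+ i)) p)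
      (≤-resp (sym (trans (⋆-⊡ˡ L (drop r a) (x ⊡ drop r a) j) (*-congˡ (⋆-⊡ʳ x (drop r a) (drop r a) j))))
              (solve 4 (λ l x m y → l :* (x :* (m :* y)) := x :* ((l :* m) :* y)) ≈-refl L x _ _)
        (*-monoˡ-≤ 0≤L (*-monoˡ-≤ 0≤x (proj₂ (proj₂ (a-convolution r)) j N≤j))))

    index-∸ : ∀ r j → (r ℕ.+ (r ℕ.+ j)) ∸ r ≡ r ℕ.+ j
    index-∸ r j = ℕ.m+n∸m≡n r (r ℕ.+ j)

    dominated-split : ∀ {f g} → Dominated f → Dominated g → ∀ r →
                      Negligible r (f ⋆ g ⊞ ⊟ (truncated r f g ⊞ truncated r g f))
    dominated-split {f} {g} (K , 0≤K , p) g-dom r = negligible (K * (proj₁ g-dom * proj₁ (a-convolution r)))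
      ((r ℕ.+ r) ℕ.+ proj₁ (proj₂ (a-convolution r))) (
      from-split r (proj₁ (proj₂ (a-convolution r))) λ j N≤j →
        ≤-resp (∣∣-cong (sym (trans (+-congʳ (⋆-split r f g j))
          (solve 2 (λ x y → x :+ y :- x := y) ≈-refl _ _))))
               (trans (*-congˡ (*-congˡ (reflexive (cong a (≡.sym (index-∸ r j)))))) (sym (*-assoc K _ _)))
               (drop-⋆-bound r {f} j 0≤K (λ i _ → p (r ℕ.+ i)) g-dom N≤j))

    expansion-cong : ∀ {f f′ d d′} → f ≋ f′ → d ≋ d′ → Expansion f d → Expansion f′ d′
    expansion-cong e e′ x r = neg-cong (λ n → +-cong (e n) (-‿cong (truncated-congˡ r a e′ n))) (x r)

    expansion-⊡ : ∀ x {f d} → Expansion f d → Expansion (x ⊡ f) (x ⊡ d)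
    expansion-⊡ x {f} {d} p r = neg-cong
      (λ n → trans (solve 3 (λ x y z → x :* (y :- z) := x :* y :- x :* z) ≈-refl x (f n) (truncated r d a n))
                   (+-congˡ (-‿cong (sym (truncated-⊡ r x d a n))))) (neg-⊡ x (p r))

    -- Passing from f to its expansion d is a derivation.
    expansion-⋆ : ∀ {f g d e} → Dominated f → Dominated g → Expansion f d → Expansion g e → Expansion (f ⋆ g)
      (f ⋆ e ⊞ g ⋆ d)
    expansion-⋆ {f} {g} {d} {e} f-dom g-dom x y r = neg-cong
      (λ n → trans (solve 5 (λ h u v w z → (h :- (u :+ v)) :+ ((u :- w) :+ (v :- z)) := h :- (w :+ z)) ≈-refl
        _ _ _ _ _)
                   (+-congˡ (-‿cong (sym (truncated-⊞ r (f ⋆ e) (g ⋆ d) a n)))))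
      (neg-⊞ (dominated-split f-dom g-dom r)
        (neg-⊞ (truncated-expansion r (λ s _ → y s) f) (truncated-expansion r (λ s _ → x s) g)))

    expansion-↑ : ∀ {b e} → (∀ m → Dominated (b ↑ suc m)) → Dominated b → Expansion b e →
                  ∀ m → Expansion (b ↑ suc m) (fromℕ (suc m) ⊡ (b ↑ m ⋆ e))
    expansion-↑ {b} {e} dom b-dom x zero = expansion-cong (Ser.sym (Ser.*-identityʳ b))
      (λ n → trans (sym (⋆-identityˡ e n)) (trans (sym (*-identityˡ _)) (*-congʳ (sym (+-identityʳ 1#))))) x
    expansion-↑ {b} {e} dom b-dom x (suc m) = expansion-cong Ser.refl
      (λ n → trans (+-cong (trans (⋆-⊡ʳ _ b (b ↑ m ⋆ e) n) (*-congˡ (sym (⋆-assoc b (b ↑ m) e n))))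
        (sym (*-identityˡ _)))
        (trans (+-comm _ _) (sym (distribʳ _ _ _))))
      (expansion-⋆ b-dom (dom m) x (expansion-↑ dom b-dom x m))

    -- From a = 1 + b a: compare the two truncations of b a and use a (1 - b)² = 1 - b.
    linear-expansion : ∀ {b} → b 0 ≈ 0# → a ≋ δ ⊞ b ⋆ a → Dominated b → Expansion b ((δ ⊞ ⊟ b) ⋆ (δ ⊞ ⊟ b))
    linear-expansion {b} b₀ a≋ b-dom = expansion-by-steps (dominated⇒negligible b-dom) λ r x → neg-cong
      (combine r)
      -- Three errors: the middle part of b a; the term 1 of the equation, which vanishes for n ≥ 1;
      -- and the earlier b in the truncation, replaced by their expansion, where the delay supplies
      -- the missing order.
      (neg-⊞ (neg-⊟ (dominated-split b-dom a-dominated (suc r)))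
        (neg-⊞ (neg-⊟ neg-δ) (neg-⊟ (neg-shift (truncated-expansion r x (tail a))))))
      where
      e : Series
      e = (δ ⊞ ⊟ b) ⋆ (δ ⊞ ⊟ b)
      a₀ : a 0 ≈ 1#
      a₀ = trans (a≋ 0) (trans (+-congˡ (trans (*-congʳ b₀) (zeroˡ _))) (+-identityʳ 1#))
      e₀ : e 0 ≈ 1# - b 0
      e₀ = trans (*-congˡ (trans (+-congˡ (trans (-‿cong b₀) (solve 0 (:- con (+ 0) := con (+ 0)) ≈-refl)))
        (+-identityʳ 1#))) (*-identityʳ _)
      a⋆e : a ⋆ e ≋ δ ⊞ ⊟ b
      a⋆e = Ser.trans (Ser.solve 3 (λ u a b → a Ser.:* ((u Ser.:- b) Ser.:* (u Ser.:- b)) Ser.:=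
                (u Ser.:* a Ser.:- b Ser.:* a) Ser.:* (u Ser.:- b)) Ser.refl δ a b)
              (Ser.trans (⋆-cong (λ n → trans (+-congʳ (trans (⋆-identityˡ a n) (a≋ n)))
                                              (solve 2 (λ x y → (x :+ y) :- y := x) ≈-refl _ _)) Ser.refl)
                         (⋆-identityˡ _))
      -- Coefficient n + 1 of a (1 - b)² = 1 - b, solved for that of (1 - b)² by means of a 0 = 1.
      tail-e : tail e ≋ ⊟ tail b ⊞ ⊟ (tail a ⋆ e)
      tail-e n = trans (solve 2 (λ x y → x := (x :+ y) :- y) ≈-refl (tail e n) ((tail a ⋆ e) n))
        (+-congʳ (trans (+-congʳ (trans (sym (*-identityˡ _)) (*-congʳ (sym a₀))))
          (trans (a⋆e (suc n)) (+-identityˡ _))))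
      combine : ∀ r n →
        - ((b ⋆ a) n - (truncated (suc r) b a n + truncated (suc r) a b n)) +
        (- δ n + - (truncated r (tail a) b (n ∸ 1) - truncated r (tail a ⋆ e) a (n ∸ 1))) ≈
        b n - truncated (suc r) e a n
      combine r n = begin
        - (ba - ((b 0 * a n + Tb) + (a 0 * b n + Tab))) + (- δ n + - (Tab - Tae))
          ≈⟨ +-congʳ (-‿cong (+-congˡ (-‿cong (+-congˡ (+-congʳ (trans (*-congʳ a₀) (*-identityˡ _))))))) ⟩
        - (ba - ((b 0 * a n + Tb) + (b n + Tab))) + (- δ n + - (Tab - Tae))
          ≈⟨ solve 8 (λ ba b₀ an tb bn tab d tae → :- (ba :- ((b₀ :* an :+ tb) :+ (bn :+ tab))) :+
            (:- d :+ :- (tab :- tae))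
                := bn :- ((d :+ ba) :- (b₀ :* an :+ (tb :+ tae)))) ≈-refl ba (b 0) (a n) Tb (b n) Tab (δ n)
                  Tae ⟩
        b n - ((δ n + ba) - (b 0 * a n + (Tb + Tae)))
          ≈⟨ +-congˡ (-‿cong (+-congʳ (sym (a≋ n)))) ⟩
        b n - (a n - (b 0 * a n + (Tb + Tae)))
          ≈⟨ +-congˡ (-‿cong (+-congʳ (sym (*-identityˡ _)))) ⟩
        b n - (1# * a n - (b 0 * a n + (Tb + Tae)))
          ≈⟨ solve 6 (λ i x y z u v → x :- (i :* y :- (z :* y :+ (u :+ v))) := x :-
            ((i :- z) :* y :+ (:- u :- v))) ≈-refl 1# (b n) (a n) (b 0) Tb Tae ⟩
        b n - ((1# - b 0) * a n + (- Tb - Tae))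
          ≈⟨ +-congˡ (-‿cong (+-cong (*-congʳ (sym e₀)) (sym Te))) ⟩
        b n - truncated (suc r) e a n ∎
        where
        ba Tb Tab Tae : Carrier
        ba  = (b ⋆ a) n
        Tb  = truncated r (tail b) a (n ∸ 1)
        Tab = truncated r (tail a) b (n ∸ 1)
        Tae = truncated r (tail a ⋆ e) a (n ∸ 1)
        Te : truncated r (tail e) a (n ∸ 1) ≈ - Tb - Tae
        Te = trans (truncated-congˡ r a tail-e (n ∸ 1)) (trans
          (truncated-⊞ r (⊟ tail b) (⊟ (tail a ⋆ e)) a (n ∸ 1))
          (+-cong (truncated-⊟ r (tail b) a (n ∸ 1)) (truncated-⊟ r (tail a ⋆ e) a (n ∸ 1))))

    -- From θ a (1 - b) = θ b, where θ = z d/dz.  Every term is divided by n at the end.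
    cyclic-expansion : ∀ {b} → a 0 ≈ 0# → θ a ⋆ (δ ⊞ ⊟ b) ≋ θ b → Dominated b → Expansion b (δ ⊞ ⊟ b)
    cyclic-expansion {b} a₀ θa≋ b-dom = expansion-by-steps (dominated⇒negligible b-dom) step
      where
      e : Series
      e = δ ⊞ ⊟ b
      tail-θb : tail (θ b) ≋ tail (θ a) ⋆ e
      tail-θb n = trans (sym (θa≋ (suc n))) (trans (+-congʳ (trans (*-congʳ (zeroˡ _)) (zeroˡ _)))
        (+-identityˡ _))
      step : ∀ r → Expansion≤ r b e → Negligible (suc r) (b ⊞ ⊟ truncated (suc r) e a)
      step r x = negligible (∣ K ∣ + LM) ((s ℕ.+ s) ℕ.+ (M′ ℕ.⊔ N)) (from-split s (M′ ℕ.⊔ N) estimate)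
        where
        s : ℕ
        s = suc r
        -- The error of replacing b by its expected expansion in the first terms of θ a · b. As θ a
        -- has no constant term, only earlier b occur, and order r of the expansion gives order r +
        -- 1 of the error.
        ε : Series
        ε n = truncated r (tail (θ a)) b (n ∸ 1) - truncated r (tail (θ a) ⋆ e) a (n ∸ 1)
        ε-negligible : Negligible s ε
        ε-negligible = neg-shift (truncated-expansion r x (tail (θ a)))
        K LM : Carrier
        K  = constant ε-negligible
        LM = proj₁ b-dom * proj₁ (a-convolution s)
        N M′ : ℕ
        N  = threshold ε-negligible
        M′ = proj₁ (proj₂ (a-convolution s))
        estimate : ∀ j → M′ ℕ.⊔ N ℕ.≤ j → let n = s ℕ.+ (s ℕ.+ j) in
                ∣ b n - truncated s e a n ∣ ≤ (∣ K ∣ + LM) * a (n ∸ s)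
        estimate j le = *-cancelˡ-≤ 0<n (≤-trans (*∣∣-≤ 0<n _)
          (≤-respˡ (∣∣-cong (sym identity)) (≤-trans (∣∣-neg _) (≤-trans (∣∣-+ _ _)
            (≤-respʳ (sym (trans (*-congˡ (distribʳ _ _ _)) (distribˡ _ _ _)))
              (+-mono-≤ ε-bound rest-bound))))))
          where
          n : ℕ
          n = s ℕ.+ (s ℕ.+ j)
          0<n : 0# < fromℕ n
          0<n = fromℕ-pos n
          rest : Carrier
          rest = (drop s b ⋆ drop s (θ a)) j
          y : Carrier
          y = a (n ∸ s)
          -- This error has no factor n; it is inserted by 1 ≤ n. The sign of K is unknown, hence ∣
          -- K ∣.
          ε-bound : ∣ ε n ∣ ≤ fromℕ n * (∣ K ∣ * y)
          ε-bound = ≤-trans (bound ε-negligible n (ℕ.≤-trans (ℕ.m⊔n≤o⇒n≤o M′ N le)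
            (ℕ.≤-trans (ℕ.m≤n+m j s) (ℕ.m≤n+m (s ℕ.+ j) s))))
            (≤-trans (*-monoʳ-≤ (0≤a _) (≤∣∣ K)) (≤-respˡ (*-identityˡ _)
              (*-monoʳ-≤ (*-nonneg (0≤∣∣ K) (0≤a _)) (≤-respˡ (+-identityʳ 1#)
                (fromℕ-mono {1} {n} (s≤s z≤n))))))
          -- The middle part involves θ a only up to index s + j, which is at most n, so its
          -- coefficients are at most n times those of a.
          rest-bound : ∣ rest ∣ ≤ fromℕ n * (LM * y)
          rest-bound = ≤-respʳ (*-congˡ (*-congˡ (reflexive (cong a (≡.sym (index-∸ s j))))))
            (drop-⋆-bound s {θ a} j (<⇒≤ 0<n) (λ i i≤j → ≤-respˡ
              (sym (∣∣-nonneg (*-nonneg (fromℕ-nonneg (s ℕ.+ i)) (0≤a _))))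
              (*-monoʳ-≤ (0≤a _) (fromℕ-mono {s ℕ.+ i} {n} (ℕ.≤-trans (ℕ.+-monoʳ-≤ s i≤j)
                (ℕ.m≤n+m (s ℕ.+ j) s))))) b-dom (ℕ.m⊔n≤o⇒m≤o M′ N le))
          Tθab Tb Tθb Taθ Te : Carrier
          Tθab = truncated r (tail (θ a)) b (n ∸ 1)
          Te   = truncated r (tail (θ a) ⋆ e) a (n ∸ 1)
          Tb   = truncated s b a n
          Taθ  = truncated s b (θ a) n
          Tθb  = truncated s (θ b) a n
          Tθb≈ : Tθb ≈ Te
          Tθb≈ = trans (+-congʳ (trans (*-congʳ (zeroˡ _)) (zeroˡ _)))
            (trans (+-identityˡ _) (truncated-congˡ r a tail-θb (n ∸ 1)))
          Tθab≈ : truncated s (θ a) b n ≈ Tθab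
          Tθab≈ = trans (+-congʳ (trans (*-congʳ (zeroˡ _)) (zeroˡ _))) (+-identityˡ _)
          Ts : truncated s e a n ≈ a n - Tb
          Ts = trans (truncated-⊞ s δ (⊟ b) a n) (+-cong (truncated-δ r a n) (truncated-⊟ s b a n))
          θb≈ : θ b n ≈ θ a n - (θ a ⋆ b) n
          θb≈ = trans (sym (θa≋ n)) (Ser.trans (Ser.solve 3 (λ u x y → x Ser.:* (u Ser.:- y) Ser.:= u Ser.:* x
            Ser.:- x Ser.:* y) Ser.refl δ (θ a) b)
            (λ k → +-congʳ (⋆-identityˡ (θ a) k)) n)
          -- `truncated-θ` turns n times the partial sum for b into `Taθ` + `Tθb`. The former
          -- cancels against the last terms of θ a · b, and the latter is the expected value of its
          -- first terms.
          identity : fromℕ n * (b n - truncated s e a n) ≈ - (ε n + rest)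
          identity = begin
            fromℕ n * (b n - truncated s e a n)
              ≈⟨ *-congˡ (+-congˡ (-‿cong Ts)) ⟩
            fromℕ n * (b n - (a n - Tb))
              ≈⟨ solve 4 (λ n x y z → n :* (x :- (y :- z)) := n :* x :- n :* y :+ n :* z) ≈-refl (fromℕ n)
                (b n) (a n) Tb ⟩
            θ b n - θ a n + fromℕ n * Tb
              ≈⟨ +-cong (+-congʳ θb≈) (sym (truncated-θ s b a (s ℕ.+ j))) ⟩
            (θ a n - (θ a ⋆ b) n) - θ a n + (Taθ + Tθb)
              ≈⟨ +-congʳ (+-congʳ (+-congˡ (-‿cong (⋆-split s (θ a) b j)))) ⟩
            (θ a n - ((truncated s (θ a) b n + Taθ) + rest)) - θ a n + (Taθ + Tθb)
              ≈⟨ +-cong (+-congʳ (+-congˡ (-‿cong (+-congʳ (+-congʳ Tθab≈))))) (+-congˡ Tθb≈) ⟩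
            (θ a n - ((Tθab + Taθ) + rest)) - θ a n + (Taθ + Te)
              ≈⟨ solve 5 (λ x p q w v → (x :- ((p :+ q) :+ w)) :- x :+ (q :+ v) := :- ((p :- v) :+ w)) ≈-refl
                (θ a n) Tθab Taθ rest Te ⟩
            - (ε n + rest) ∎

-- Sums of nonnegative weights as suprema over finite lists.

module WeightedSums {c ℓ₁ ℓ₂ : Level} (ℝ : RealNumbers c ℓ₁ ℓ₂) where
  open OverReals ℝ using (IsSum)
  open OrderedField ℝ
  open SetoidReasoning setoid

  ∑-cong : ∀ {X : Set} {w v : X → Carrier} → (∀ x → w x ≈ v x) → ∀ xs → ∑ (map w xs) ≈ ∑ (map v xs)
  ∑-cong e []       = ≈-refl
  ∑-cong e (x ∷ xs) = +-cong (e x) (∑-cong e xs)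

  ∑-++ : ∀ xs ys → ∑ (xs ++ ys) ≈ ∑ xs + ∑ ys
  ∑-++ []       ys = sym (+-identityˡ _)
  ∑-++ (x ∷ xs) ys = trans (+-congˡ (∑-++ xs ys)) (sym (+-assoc _ _ _))

  ∑-*ˡ : ∀ {X : Set} (w : X → Carrier) z xs → ∑ (map (λ x → z * w x) xs) ≈ z * ∑ (map w xs)
  ∑-*ˡ w z []       = sym (zeroʳ z)
  ∑-*ˡ w z (x ∷ xs) = trans (+-congˡ (∑-*ˡ w z xs)) (sym (distribˡ _ _ _))

  ∑-map : ∀ {X Y : Set} (w : Y → Carrier) (f : X → Y) xs → ∑ (map w (map f xs)) ≈ ∑ (map (w ∘ f) xs)
  ∑-map w f xs = reflexive (cong ∑ (≡.sym (List.map-∘ xs)))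

  -- Elements of any kind with nonnegative weights. They are neither enumerated nor decidable, since
  -- a summable species may have infinitely many structures on a finite set.
  record Weighted : Set (lsuc 0ℓ ⊔ˡ c ⊔ˡ ℓ₁ ⊔ˡ ℓ₂) where
    no-eta-equality
    field
      support       : Setoid 0ℓ 0ℓ
      weight        : Setoid.Carrier support → Carrier
      weight-cong   : ∀ {x y} → Setoid._≈_ support x y → weight x ≈ weight y
      weight-nonneg : ∀ x → 0# ≤ weight x

    Element : Set
    Element = Setoid.Carrier support

    open UniqueSetoid support public using (Unique)
    open Membership support public using (_∈_)

    total : List Element → Carrier
    total xs = ∑ (map weight xs)

    total-nonneg : ∀ xs → 0# ≤ total xs
    total-nonneg []       = ≤-refl
    total-nonneg (x ∷ xs) = +-nonneg (weight-nonneg x) (total-nonneg xs)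

  open Weighted public using (Element)

  record HasSum (W : Weighted) (t : Carrier) : Set (c ⊔ˡ ℓ₂) where
    open Weighted W
    field
      upper  : ∀ xs → Unique xs → total xs ≤ t
      approx : ∀ ε → 0# < ε → ∃[ xs ] Unique xs × t - ε < total xs

    isSum : IsSum support weight t
    isSum = record { upper = upper ; approx = approx }

  open HasSum public

  record _⇿_ (W V : Weighted) : Set (c ⊔ˡ ℓ₁) where
    private
      module W = Weighted W
      module V = Weighted V
    field
      inv     : Inverse W.support V.support
      weights : ∀ x → W.weight x ≈ V.weight (Inverse.to inv x)

  HasSum-⇿ : ∀ {W V t} → W ⇿ V → HasSum W t → HasSum V t
  HasSum-⇿ {W} {V} {t} I s = record
    { upper  = λ ys ys! → ≤-respˡ (back ys)
        (upper s (map from ys) (Unique.map⁺ V.support W.support from-injective ys!))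
    ; approx = λ ε 0<ε → let xs , xs! , t-ε< = approx s ε 0<ε in
        map to xs , Unique.map⁺ W.support V.support to-injective xs! ,
        <-respʳ-≈ (trans (∑-cong (_⇿_.weights I) xs) (sym (∑-map V.weight to xs))) t-ε<
    }
    where
    module W = Weighted W
    module V = Weighted V
    module S = Setoid W.support
    module T = Setoid V.support
    open Inverse (_⇿_.inv I)
    from-injective : ∀ {x y} → from x S.≈ from y → x T.≈ y
    from-injective e = T.trans (T.sym (strictlyInverseˡ _)) (T.trans (to-cong e) (strictlyInverseˡ _))
    to-injective : ∀ {x y} → to x T.≈ to y → x S.≈ y
    to-injective e = S.trans (S.sym (strictlyInverseʳ _)) (S.trans (from-cong e) (strictlyInverseʳ _))
    back : ∀ ys → W.total (map from ys) ≈ V.total ys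
    back ys = trans (∑-map W.weight from ys)
      (∑-cong (λ y → trans (_⇿_.weights I (from y)) (V.weight-cong (strictlyInverseˡ y))) ys)

  -- If t < s, a list that approximates s within the gap s - t has a total above t.
  HasSum-unique-≤ : ∀ {W s t} → HasSum W s → HasSum W t → s ≤ t
  HasSum-unique-≤ {s = s} {t} p q t<s = let xs , xs! , lt = approx p (s - t) (<⇒0<- t<s) in
    upper q xs xs! (<-respˡ-≈ (solve 2 (λ s t → s :- (s :- t) := t) ≈-refl s t) lt)

  HasSum-unique : ∀ {W s t} → HasSum W s → HasSum W t → s ≈ t
  HasSum-unique p q = ≤-antisym (HasSum-unique-≤ p q) (HasSum-unique-≤ q p)

  HasSum-cong : ∀ {W s t} → s ≈ t → HasSum W s → HasSum W t
  HasSum-cong e p = record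
    { upper  = λ xs xs! → ≤-respʳ e (upper p xs xs!)
    ; approx = λ ε 0<ε → let xs , xs! , lt = approx p ε 0<ε in xs , xs! , <-respˡ-≈ (+-congʳ e) lt
    }

  HasSum-nonneg : ∀ {W t} → HasSum W t → 0# ≤ t
  HasSum-nonneg p = upper p [] []

  HasSum-empty : ∀ {W} → ¬ Element W → HasSum W 0#
  HasSum-empty {W} ∅ = record
    { upper  = λ { [] _ → ≤-refl ; (x ∷ _) _ → contradiction x ∅ }
    ; approx = λ ε 0<ε → [] , [] , 0-ε<0 0<ε
    }
    where
    0-ε<0 : ∀ {ε} → 0# < ε → 0# - ε < 0#
    0-ε<0 {ε} 0<ε = 0<-⇒< (<-respʳ-≈ (solve 1 (λ e → e := con (+ 0) :- (con (+ 0) :- e)) ≈-refl ε) 0<ε)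

  x-ε<x : ∀ x {ε} → 0# < ε → x - ε < x
  x-ε<x x {ε} 0<ε = 0<-⇒< (<-respʳ-≈ (solve 2 (λ x e → e := x :- (x :- e)) ≈-refl x ε) 0<ε)

  HasSum-single : ∀ {W} (x : Element W) → (∀ y → Setoid._≈_ (Weighted.support W) y x) →
                  HasSum W (Weighted.weight W x)
  HasSum-single {W} x x! = record
    { upper  = λ
        { []          _                → W.weight-nonneg x
        ; (y ∷ [])    _                → ≤-reflexive (trans (+-identityʳ _) (W.weight-cong (x! y)))
        ; (y ∷ z ∷ _) ((y≉z ∷ _) ∷ _) → contradiction (S.trans (x! y) (S.sym (x! z))) y≉z
        }
    ; approx = λ ε 0<ε → x ∷ [] , [] ∷ [] , <-respʳ-≈ (sym (+-identityʳ _)) (x-ε<x (W.weight x) 0<ε)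
    }
    where
    module W = Weighted W
    module S = Setoid W.support

  scale : ∀ z → 0# ≤ z → Weighted → Weighted
  scale z 0≤z W .Weighted.support         = Weighted.support W
  scale z 0≤z W .Weighted.weight x        = z * Weighted.weight W x
  scale z 0≤z W .Weighted.weight-cong e   = *-congˡ (Weighted.weight-cong W e)
  scale z 0≤z W .Weighted.weight-nonneg x = *-nonneg 0≤z (Weighted.weight-nonneg W x)

  HasSum-scale : ∀ {W t} z (0<z : 0# < z) → HasSum W t → HasSum (scale z (<⇒≤ 0<z) W) (z * t)
  HasSum-scale {W} {t} z 0<z p = record
    { upper  = λ xs xs! → ≤-respˡ (sym (∑-*ˡ W.weight z xs)) (*-monoˡ-≤ (<⇒≤ 0<z) (upper p xs xs!))
    ; approx = λ ε 0<ε →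
        let xs , xs! , lt = approx p (inverse z#0 * ε) (*-pos (inverse-pos z#0 0<z) 0<ε) in
        xs , xs! , <-resp (ε-cancel ε) (sym (∑-*ˡ W.weight z xs)) (*-monoˡ-< 0<z lt)
    }
    where
    module W = Weighted W
    z#0 : z # 0#
    z#0 = 0<⇒#0 0<z
    ε-cancel : ∀ ε → z * (t - inverse z#0 * ε) ≈ z * t - ε
    ε-cancel ε = begin
      z * (t - inverse z#0 * ε)
        ≈⟨ solve 4 (λ z t i e → z :* (t :- i :* e) := z :* t :- (z :* i) :* e) ≈-refl z t (inverse z#0) ε ⟩
      z * t - (z * inverse z#0) * ε
        ≈⟨ +-congˡ (-‿cong (*-inverse-cancel z#0 ε)) ⟩
      z * t - ε ∎

  halve : ∀ ε → 0# < ε → ∃[ η ] 0# < η × η + η ≈ ε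
  halve ε 0<ε = ½ * ε , *-pos (inverse-pos 2#0 (fromℕ-pos 2)) 0<ε ,
    trans (solve 2 (λ h e → h :* e :+ h :* e := ((con (+ 1) :+ (con (+ 1) :+ con (+ 0))) :* h) :* e) ≈-refl ½
      ε)
          (trans (*-congʳ (trans (*-congʳ (+-cong one (+-congʳ one))) (*-inverse 2#0))) (*-identityˡ ε))
    where
    2#0 : fromℕ 2 # 0#
    2#0 = 0<⇒#0 (fromℕ-pos 2)
    ½ : Carrier
    ½ = inverse 2#0
    one : 1# + 0# ≈ 1#
    one = +-identityʳ 1#

  restrictTo : (W : Weighted) → (Element W → Set) → Weighted
  restrictTo W Q .Weighted.support       = On.setoid (Weighted.support W) (proj₁ {B = Q})
  restrictTo W Q .Weighted.weight        = Weighted.weight W ∘ proj₁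
  restrictTo W Q .Weighted.weight-cong   = Weighted.weight-cong W
  restrictTo W Q .Weighted.weight-nonneg = Weighted.weight-nonneg W ∘ proj₁

  fibre : {I : Set} (W : Weighted) → (Element W → I) → I → Weighted
  fibre W κ i = restrictTo W (λ x → κ x ≡ i)

  module _ (W : Weighted) (P : Element W → Bool)
           (P-cong : ∀ {x y} → Setoid._≈_ (Weighted.support W) x y → P x ≡ P y) where
    private
      module W = Weighted W
      select : ∀ b → List W.Element → List (Element (fibre W P b))
      select b []       = []
      select b (x ∷ xs) with P x Bool.≟ b
      ... | yes p = (x , p) ∷ select b xs
      ... | no  _ = select b xs

      All-select : ∀ {ℓ b} {Q : W.Element → Set ℓ} xs → All Q xs → All (Q ∘ proj₁) (select b xs)
      All-select []       []       = []
      All-select {b = b} (x ∷ xs) (q ∷ qs) with P x Bool.≟ b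
      ... | yes _ = q ∷ All-select xs qs
      ... | no  _ = All-select xs qs

      Unique-select : ∀ {b} xs → W.Unique xs → Weighted.Unique (fibre W P b) (select b xs)
      Unique-select []       []         = []
      Unique-select {b} (x ∷ xs) (x# ∷ xs!) with P x Bool.≟ b
      ... | yes _ = All-select xs x# ∷ Unique-select xs xs!
      ... | no  _ = Unique-select xs xs!

      total-select : ∀ xs → W.total xs ≈ Weighted.total (fibre W P true) (select true xs) +
                                         Weighted.total (fibre W P false) (select false xs)
      total-select []       = sym (+-identityˡ 0#)
      total-select (x ∷ xs) with P x Bool.≟ true | P x Bool.≟ false
      ... | yes p | yes q with () ← ≡.trans (≡.sym p) q
      ... | yes _ | no _  = trans (+-congˡ (total-select xs)) (sym (+-assoc _ _ _))
      ... | no _  | yes _ = trans (+-congˡ (total-select xs))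
        (solve 3 (λ a b c → a :+ (b :+ c) := b :+ (a :+ c)) ≈-refl _ _ _)
      ... | no ¬p | no ¬q = contradiction (Bool.¬-not ¬p) ¬q

    -- The property is Boolean because lists have to be sorted into its two classes. An
    -- approximation of the whole joins two approximations within ε / 2, which P keeps disjoint.
    HasSum-split : ∀ {s t} → HasSum (fibre W P true) s → HasSum (fibre W P false) t → HasSum W (s + t)
    HasSum-split {s} {t} p q = record
      { upper  = λ xs xs! → ≤-respˡ (sym (total-select xs))
          (+-mono-≤ (upper p _ (Unique-select xs xs!)) (upper q _ (Unique-select xs xs!)))
      ; approx = λ ε 0<ε →
          let η , 0<η , 2η≈ε = halve ε 0<ε
              xs , xs! , ltx = approx p η 0<η
              ys , ys! , lty = approx q η 0<η
          in map proj₁ xs ++ map proj₁ ys ,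
             Unique.++⁺ W.support
               (Unique.map⁺ (Weighted.support (fibre W P true)) W.support id xs!)
               (Unique.map⁺ (Weighted.support (fibre W P false)) W.support id ys!)
               (λ (v∈xs , v∈ys) → disjoint (all-proj xs) (all-proj ys) v∈xs v∈ys) ,
             <-resp (trans (solve 3 (λ s t e → (s :- e) :+ (t :- e) := (s :+ t) :- (e :+ e)) ≈-refl s t η)
                           (+-congˡ (-‿cong 2η≈ε)))
                    (total-++ xs ys) (+-mono-< ltx lty)
      }
      where
      all-proj : ∀ {b} (xs : List (Element (fibre W P b))) → All (λ x → P x ≡ b) (map proj₁ xs)
      all-proj []       = []
      all-proj (x ∷ xs) = proj₂ x ∷ all-proj xs
      value : ∀ {b v xs} → All (λ x → P x ≡ b) xs → v W.∈ xs → P v ≡ b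
      value (p ∷ _)  (here e)  = ≡.trans (P-cong e) p
      value (_ ∷ ps) (there i) = value ps i
      disjoint : ∀ {xs ys v} → All (λ x → P x ≡ true) xs → All (λ x → P x ≡ false) ys →
                 v W.∈ xs → v W.∈ ys → ⊥
      disjoint ps qs i j with () ← ≡.trans (≡.sym (value ps i)) (value qs j)
      total-++ : ∀ xs ys → Weighted.total (fibre W P true) xs + Weighted.total (fibre W P false) ys ≈
                           W.total (map proj₁ xs ++ map proj₁ ys)
      total-++ xs ys = sym (begin
        ∑ (map W.weight (map proj₁ xs ++ map proj₁ ys))
          ≡⟨ cong ∑ (List.map-++ W.weight (map proj₁ xs) (map proj₁ ys)) ⟩
        ∑ (map W.weight (map proj₁ xs) ++ map W.weight (map proj₁ ys))
          ≈⟨ ∑-++ (map W.weight (map proj₁ xs)) _ ⟩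
        ∑ (map W.weight (map proj₁ xs)) + ∑ (map W.weight (map proj₁ ys))
          ≈⟨ +-cong (∑-map W.weight proj₁ xs) (∑-map W.weight proj₁ ys) ⟩
        ∑ (map (W.weight ∘ proj₁) xs) + ∑ (map (W.weight ∘ proj₁) ys) ∎)

  infixr 7 _⊗_
  _⊗_ : Weighted → Weighted → Weighted
  (W ⊗ V) .Weighted.support               = Weighted.support W ×ₛ Weighted.support V
  (W ⊗ V) .Weighted.weight (x , y)        = Weighted.weight W x * Weighted.weight V y
  (W ⊗ V) .Weighted.weight-cong (p , q)   = *-cong (Weighted.weight-cong W p) (Weighted.weight-cong V q)
  (W ⊗ V) .Weighted.weight-nonneg (x , y) = *-nonneg (Weighted.weight-nonneg W x) (Weighted.weight-nonneg V y)

  module _ (W : Weighted) where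
    private
      module W = Weighted W
      module S = Setoid W.support

    remove : ∀ {z xs} → z W.∈ xs → List W.Element
    remove {xs = _ ∷ xs} (here _)  = xs
    remove {xs = x ∷ _}  (there i) = x ∷ remove i

    total-remove : ∀ {z xs} (i : z W.∈ xs) → W.total xs ≈ W.weight z + W.total (remove i)
    total-remove (here e)  = +-congʳ (W.weight-cong (S.sym e))
    total-remove (there i) = trans (+-congˡ (total-remove i))
      (solve 3 (λ a b c → a :+ (b :+ c) := b :+ (a :+ c)) ≈-refl _ _ _)

    ∈-remove : ∀ {y z xs} (i : z W.∈ xs) → ¬ (z S.≈ y) → y W.∈ xs → y W.∈ remove i
    ∈-remove (here e)  z≉y (here e′)  = contradiction (S.trans e (S.sym e′)) z≉y
    ∈-remove (here e)  z≉y (there j)  = j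
    ∈-remove (there i) z≉y (here e′)  = here e′
    ∈-remove (there i) z≉y (there j)  = there (∈-remove i z≉y j)

    -- The entries of zs are distinct, so each can be charged to an entry of xs that is then
    -- removed; what is left of xs has a nonnegative total.
    total-⊆ : ∀ {zs} xs → W.Unique zs → All (W._∈ xs) zs → W.total zs ≤ W.total xs
    total-⊆ xs []         []       = W.total-nonneg xs
    total-⊆ xs (z# ∷ zs!) (i ∷ is) = ≤-respʳ (sym (total-remove i))
      (+-monoʳ-≤ _ (total-⊆ (remove i) zs! (All.zipWith (λ (p , q) → ∈-remove i p q) (z# , is))))

    -- Equality on the elements need not be decidable, but the order on ℝ is a negation.
    ¬¬-deduplicate : ∀ xs → ¬ ¬ (Σ[ us ∈ List W.Element ] W.Unique us × All (W._∈ us) xs)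
    ¬¬-deduplicate []       k = k ([] , [] , [])
    ¬¬-deduplicate (x ∷ xs) k = ¬¬-deduplicate xs λ (us , us! , cover) →
      ¬¬-excluded-middle λ
        { (yes i) → k (us , us! , i ∷ cover)
        ; (no ¬i) → k (x ∷ us , All.¬Any⇒All¬ us ¬i ∷ us! , here S.refl ∷ All.map there cover)
        }

  total-cartesian : ∀ W V xs ys → Weighted.total (W ⊗ V) (cartesianProduct xs ys) ≈
                                  Weighted.total W xs * Weighted.total V ys
  total-cartesian W V []       ys = sym (zeroˡ _)
  total-cartesian W V (x ∷ xs) ys = begin
    ∑ (map WV.weight (map (x ,_) ys ++ cartesianProduct xs ys))
      ≡⟨ cong ∑ (List.map-++ WV.weight (map (x ,_) ys) _) ⟩
    ∑ (map WV.weight (map (x ,_) ys) ++ map WV.weight (cartesianProduct xs ys))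
      ≈⟨ ∑-++ (map WV.weight (map (x ,_) ys)) _ ⟩
    ∑ (map WV.weight (map (x ,_) ys)) + WV.total (cartesianProduct xs ys)
      ≈⟨ +-cong (trans (∑-map WV.weight (x ,_) ys) (∑-*ˡ V.weight (W.weight x) ys))
        (total-cartesian W V xs ys) ⟩
    W.weight x * V.total ys + W.total xs * V.total ys
      ≈⟨ distribʳ _ _ _ ⟨
    (W.weight x + W.total xs) * V.total ys ∎
    where
    module W = Weighted W
    module V = Weighted V
    module WV = Weighted (W ⊗ V)

  -- A list of distinct pairs lies in the rectangle spanned by its two projections, freed of
  -- repetitions, and the total of a rectangle is a product. From below, rectangles over good
  -- approximations suffice.
  HasSum-⊗ : ∀ {W V s t} → HasSum W s → HasSum V t → HasSum (W ⊗ V) (s * t)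
  HasSum-⊗ {W} {V} {s} {t} p q = record { upper = bound ; approx = approximation }
    where
    module W = Weighted W
    module V = Weighted V
    module WV = Weighted (W ⊗ V)
    0≤s : 0# ≤ s
    0≤s = HasSum-nonneg {W} p
    0≤t : 0# ≤ t
    0≤t = HasSum-nonneg {V} q
    bound : ∀ zs → WV.Unique zs → WV.total zs ≤ s * t
    bound zs zs! st< = ¬¬-deduplicate W (map proj₁ zs) λ (us , us! , us-cover) →
      ¬¬-deduplicate V (map proj₂ zs) λ (vs , vs! , vs-cover) →
        ≤-trans (total-⊆ (W ⊗ V) (cartesianProduct us vs) zs!
                  (All.zipWith (λ (i , j) → Any.cartesianProduct⁺ i j)
                    (All.map⁻ us-cover , All.map⁻ vs-cover)))
          (≤-respˡ (sym (total-cartesian W V us vs))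
            (*-mono-≤ (W.total-nonneg us) 0≤t (upper p us us!) (upper q vs vs!))) st<
    approximation : ∀ ε → 0# < ε → ∃[ zs ] WV.Unique zs × s * t - ε < WV.total zs
    approximation ε 0<ε =
      let xs , xs! , ltx = approx p η 0<η
          ys , ys! , lty = approx q η 0<η
          X = W.total xs
          Y = V.total ys
          step : s * t - X * Y < ε
          -- The defect s t - X Y equals s (t - Y) + (s - X) Y, which is at most s η + η t.
          step = ≤-<-trans (≤-respˡ (solve 4 (λ s t x y → s :* (t :- y) :+ (s :- x) :* y := s :* t :- x :* y)
            ≈-refl s t X Y)
              (+-mono-≤ (*-monoˡ-≤ 0≤s (<⇒≤ (flip lty)))
                (*-mono-≤ (≤⇒0≤- (upper p xs xs!)) 0≤t (<⇒≤ (flip ltx)) (upper q ys ys!))))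
              total<ε
      in cartesianProduct xs ys , Unique.cartesianProduct⁺ W.support V.support xs! ys! ,
         <-respʳ-≈ (sym (total-cartesian W V xs ys)) (flip step)
      where
      flip : ∀ {x y z} → x - y < z → x - z < y
      flip {x} {y} {z} lt = 0<-⇒< (<-respʳ-≈
        (solve 3 (λ x y z → z :- (x :- y) := y :- (x :- z)) ≈-refl x y z) (<⇒0<- lt))
      N : Carrier
      -- The tolerance is η = ε / (1 + s + t); the summand 1 makes the divisor positive and keeps s
      -- η + η t strictly below ε.
      N = 1# + (s + t)
      0<N : 0# < N
      0<N = <-≤-trans 0<1 (x≤x+y (+-nonneg 0≤s 0≤t))
      N#0 : N # 0#
      N#0 = 0<⇒#0 0<N
      η : Carrier
      η = inverse N#0 * ε
      0<η : 0# < η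
      0<η = *-pos (inverse-pos N#0 0<N) 0<ε
      total<ε : s * η + η * t < ε
      total<ε = <-resp (+-identityˡ _) eq (+-monoˡ-< (s * η + η * t) 0<η)
        where
        eq : η + (s * η + η * t) ≈ ε
        eq = begin
          η + (s * η + η * t)
            ≈⟨ solve 3 (λ e s t → e :+ (s :* e :+ e :* t) := e :+ (s :+ t) :* e) ≈-refl η s t ⟩
          η + (s + t) * η      ≈⟨ +-congʳ (*-identityˡ η) ⟨
          1# * η + (s + t) * η ≈⟨ distribʳ _ _ _ ⟨
          N * (inverse N#0 * ε) ≈⟨ *-assoc _ _ _ ⟨
          N * inverse N#0 * ε  ≈⟨ *-congʳ (*-inverse N#0) ⟩
          1# * ε               ≈⟨ *-identityˡ ε ⟩
          ε ∎

  counting : ℕ → Weighted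
  counting m .Weighted.support         = ≡.setoid (Fin m)
  counting m .Weighted.weight _        = 1#
  counting m .Weighted.weight-cong _   = ≈-refl
  counting m .Weighted.weight-nonneg _ = 0≤1

  total-allFin : ∀ m → Weighted.total (counting m) (allFin m) ≈ fromℕ m
  total-allFin m = trans (go (allFin m)) (reflexive (cong fromℕ (List.length-tabulate {n = m} id)))
    where
    go : ∀ (xs : List (Fin m)) → ∑ (map (λ _ → 1#) xs) ≈ fromℕ (length xs)
    go []       = ≈-refl
    go (_ ∷ xs) = +-congˡ (go xs)

  module _ (W : Weighted) where
    private
      module W = Weighted W
      Copies : ℕ → Weighted
      Copies m = counting m ⊗ W

      zeros : ∀ {m} → List (Fin (suc m) × W.Element) → List W.Element
      zeros []                 = []
      zeros ((zero , x) ∷ zs)  = x ∷ zeros zs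
      zeros ((suc _ , _) ∷ zs) = zeros zs

      sucs : ∀ {m} → List (Fin (suc m) × W.Element) → List (Fin m × W.Element)
      sucs []                 = []
      sucs ((zero , _) ∷ zs)  = sucs zs
      sucs ((suc i , x) ∷ zs) = (i , x) ∷ sucs zs

      All-zeros : ∀ {ℓ m} {Q : Fin (suc m) × W.Element → Set ℓ} zs → All Q zs → All (λ x → Q (zero , x))
        (zeros zs)
      All-zeros []                 []       = []
      All-zeros ((zero , x) ∷ zs)  (q ∷ qs) = q ∷ All-zeros zs qs
      All-zeros ((suc _ , _) ∷ zs) (q ∷ qs) = All-zeros zs qs

      All-sucs : ∀ {ℓ m} {Q : Fin (suc m) × W.Element → Set ℓ} zs → All Q zs → All (λ (i , x) → Q (suc i , x))
        (sucs zs)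
      All-sucs []                 []       = []
      All-sucs ((zero , x) ∷ zs)  (q ∷ qs) = All-sucs zs qs
      All-sucs ((suc _ , _) ∷ zs) (q ∷ qs) = q ∷ All-sucs zs qs

      Unique-zeros : ∀ {m} zs → Weighted.Unique (Copies (suc m)) zs → W.Unique (zeros zs)
      Unique-zeros []                 []        = []
      Unique-zeros ((zero , x) ∷ zs)  (z# ∷ zs!) = All.map (λ p e → p (refl , e)) (All-zeros zs z#) ∷
        Unique-zeros zs zs!
      Unique-zeros ((suc _ , _) ∷ zs) (z# ∷ zs!) = Unique-zeros zs zs!

      Unique-sucs : ∀ {m} zs → Weighted.Unique (Copies (suc m)) zs → Weighted.Unique (Copies m) (sucs zs)
      Unique-sucs []                 []         = []
      Unique-sucs ((zero , x) ∷ zs)  (z# ∷ zs!) = Unique-sucs zs zs!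
      Unique-sucs ((suc _ , _) ∷ zs) (z# ∷ zs!) =
        All.map (λ p (e , e′) → p (cong suc e , e′)) (All-sucs zs z#) ∷ Unique-sucs zs zs!

      total-zeros-sucs : ∀ {m} zs → Weighted.total (Copies (suc m)) zs ≈
                                    W.total (zeros zs) + Weighted.total (Copies m) (sucs zs)
      total-zeros-sucs []                 = sym (+-identityˡ 0#)
      total-zeros-sucs ((zero , x) ∷ zs)  = trans (+-cong (*-identityˡ _) (total-zeros-sucs zs))
        (sym (+-assoc _ _ _))
      total-zeros-sucs ((suc _ , _) ∷ zs) = trans (+-congˡ (total-zeros-sucs zs))
        (solve 3 (λ a b c → a :+ (b :+ c) := b :+ (a :+ c)) ≈-refl _ _ _)

      bound : ∀ {u} → (∀ xs → W.Unique xs → W.total xs ≤ u) →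
              ∀ m zs → Weighted.Unique (Copies m) zs → Weighted.total (Copies m) zs ≤ fromℕ m * u
      bound b zero    []             _   = ≤-reflexive (sym (zeroˡ _))
      bound b zero    ((() , _) ∷ _) _
      bound {u} b (suc m) zs zs! = ≤-resp (sym (total-zeros-sucs zs))
        (trans (+-congʳ (sym (*-identityˡ u))) (sym (distribʳ _ _ _)))
        (+-mono-≤ (b _ (Unique-zeros zs zs!)) (bound b m _ (Unique-sucs zs zs!)))

    -- Division by suc m without choosing representatives. For the upper bound a list is repeated in
    -- all copies. For the approximation, a list that nearly exhausts all copies has at most m u
    -- outside copy zero, so its part in copy zero comes within ε of u.
    HasSum-copies⁻ : ∀ m {u} → HasSum (counting (suc m) ⊗ W) (fromℕ (suc m) * u) → HasSum W u
    HasSum-copies⁻ m {u} p = record { upper = upper′ ; approx = approx′ }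
      where
      upper′ : ∀ xs → W.Unique xs → W.total xs ≤ u
      upper′ xs xs! = *-cancelˡ-≤ (fromℕ-pos (suc m)) (≤-respˡ
        (trans (total-cartesian (counting (suc m)) W (allFin (suc m)) xs) (*-congʳ (total-allFin (suc m))))
        (upper p _ (Unique.cartesianProduct⁺ (≡.setoid _) W.support
          (Unique.tabulate⁺ (≡.setoid _) id) xs!)))
      approx′ : ∀ ε → 0# < ε → ∃[ xs ] W.Unique xs × u - ε < W.total xs
      approx′ ε 0<ε = let zs , zs! , lt = approx p ε 0<ε in
        zeros zs , Unique-zeros zs zs! ,
        <-resp (trans (solve 4 (λ i m u e → ((i :+ m) :* u :- e) :- m :* u := i :* u :- e) ≈-refl 1# (fromℕ m)
          u ε)
                      (+-congʳ (*-identityˡ u)))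
               (solve 2 (λ x y → x :+ y :- y := x) ≈-refl _ _)
          (+-monoˡ-< (- (fromℕ m * u)) (<-≤-trans lt
            (≤-respˡ (sym (total-zeros-sucs zs))
              (+-monoʳ-≤ _ (bound upper′ m (sucs zs) (Unique-sucs zs zs!))))))

-- Setoid bijections, and subsets coded by Boolean vectors.

strictInverse : ∀ {S T : Setoid 0ℓ 0ℓ} →
  let module S = Setoid S
      module T = Setoid T
  in (to : S.Carrier → T.Carrier) (from : T.Carrier → S.Carrier) →
     (∀ {x y} → x S.≈ y → to x T.≈ to y) → (∀ {x y} → x T.≈ y → from x S.≈ from y) →
     (∀ y → to (from y) T.≈ y) → (∀ x → from (to x) S.≈ x) → Inverse S T
strictInverse {S} {T} to from to-cong from-cong invˡ invʳ = record
  { to = to ; from = from ; to-cong = to-cong ; from-cong = from-cong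
  ; inverse = (λ e → T.trans (to-cong e) (invˡ _)) , (λ e → S.trans (from-cong e) (invʳ _))
  }
  where
  module S = Setoid S
  module T = Setoid T

trues falses : ∀ {n} → Vec Bool n → ℕ
trues []          = 0
trues (true ∷ v)  = suc (trues v)
trues (false ∷ v) = trues v
falses v = trues (Vec.map not v)

position : ∀ {n} (v : Vec Bool n) → Fin (trues v) → Fin n
position (true ∷ v)  zero    = zero
position (true ∷ v)  (suc j) = suc (position v j)
position (false ∷ v) j       = suc (position v j)

T-position : ∀ {n} (v : Vec Bool n) j → T (Vec.lookup v (position v j))
T-position (true ∷ v)  zero    = tt
T-position (true ∷ v)  (suc j) = T-position v j
T-position (false ∷ v) j       = T-position v j

rankTrue : ∀ {n} (v : Vec Bool n) i → T (Vec.lookup v i) → Fin (trues v)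
rankTrue (true ∷ v)  zero    _ = zero
rankTrue (true ∷ v)  (suc i) p = suc (rankTrue v i p)
rankTrue (false ∷ v) (suc i) p = rankTrue v i p

position-rank : ∀ {n} (v : Vec Bool n) i p → position v (rankTrue v i p) ≡ i
position-rank (true ∷ v)  zero    _ = refl
position-rank (true ∷ v)  (suc i) p = cong suc (position-rank v i p)
position-rank (false ∷ v) (suc i) p = cong suc (position-rank v i p)

position-injective : ∀ {n} (v : Vec Bool n) {i j} → position v i ≡ position v j → i ≡ j
position-injective (true ∷ v)  {zero}  {zero}  e = refl
position-injective (true ∷ v)  {suc i} {suc j} e = cong suc (position-injective v (Fin.suc-injective e))
position-injective (false ∷ v)                 e = position-injective v (Fin.suc-injective e)

module _ {U : FinSet} where
  private
    module U = FinSet U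

  code : Subset U → Vec Bool U.size
  code P = Vec.tabulate (Subset.mem P ∘ U.enumerate)

  decode : Vec Bool U.size → Subset U
  decode v = record
    { mem      = Vec.lookup v ∘ Inverse.from U.enum
    ; mem-cong = cong (Vec.lookup v) ∘ Inverse.from-cong U.enum
    }

  infix 4 _≗ˢ_
  _≗ˢ_ : Subset U → Subset U → Set
  P ≗ˢ Q = ∀ u → Subset.mem P u ≡ Subset.mem Q u

  code-cong : ∀ {P Q} → P ≗ˢ Q → code P ≡ code Q
  code-cong e = Vec.tabulate-cong (e ∘ U.enumerate)

  code≡⇒≗decode : ∀ P {v} → code P ≡ v → P ≗ˢ decode v
  code≡⇒≗decode P refl u = ≡.trans (Subset.mem-cong P (U.sym (Inverse.strictlyInverseˡ U.enum u)))
    (≡.sym (Vec.lookup∘tabulate (Subset.mem P ∘ U.enumerate) (Inverse.from U.enum u)))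

  ≗decode⇒code≡ : ∀ P {v} → P ≗ˢ decode v → code P ≡ v
  ≗decode⇒code≡ P {v} e = ≡.trans
    (Vec.tabulate-cong (λ i → ≡.trans (e (U.enumerate i))
      (cong (Vec.lookup v) (Inverse.strictlyInverseʳ U.enum i))))
    (Vec.tabulate∘lookup v)

  -- The enumeration of a restriction is abstract, so its size is accessible only through a
  -- bijection. The vector v is a separate argument in order to serve a subset and its complement
  -- alike.
  sizeOf : (P : Subset U) (v : Vec Bool U.size) → P ≗ˢ decode v → FinSet.size (U ↾ P) ≡ trues v
  sizeOf P v e = size-cong bijection
    where
    bijection : Bij (U ↾ P) [ trues v ]
    bijection .Bij.inv = strictInverse
      (λ (u , p) → rankTrue v (Inverse.from U.enum u) (subst T (e u) p))
      (λ j → U.enumerate (position v j) ,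
             subst T (≡.sym (≡.trans (e _) (cong (Vec.lookup v) (Inverse.strictlyInverseʳ U.enum _))))
               (T-position v j))
      (λ {x} {y} x≈y → position-injective v (≡.trans (position-rank v _ _)
        (≡.trans (Inverse.from-cong U.enum x≈y) (≡.sym (position-rank v _ _)))))
      (λ { refl → U.refl })
      (λ j → position-injective v (≡.trans (position-rank v _ _) (Inverse.strictlyInverseʳ U.enum _)))
      (λ (u , p) → U.trans (U.reflexive (cong U.enumerate (position-rank v _ _)))
        (Inverse.strictlyInverseˡ U.enum u))

  size-decode : ∀ v → FinSet.size (U ↾ decode v) ≡ trues v
  size-decode v = sizeOf (decode v) v (λ _ → refl)

  size-∁-decode : ∀ v → FinSet.size (U ↾ ∁ (decode v)) ≡ falses v
  size-∁-decode v = sizeOf (∁ (decode v)) (Vec.map not v)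
    (λ u → ≡.sym (Vec.lookup-map (Inverse.from U.enum u) not v))

-- Exponential generating series and the product formula.

module SpeciesSums {c ℓ₁ ℓ₂ : Level} (ℝ : RealNumbers c ℓ₁ ℓ₂) where
  open OverReals ℝ using (Species; _⊙_; ProductStructure; module Product)
  open OrderedField ℝ
  open PowerSeries commutativeRing
  open WeightedSums ℝ
  open SetoidReasoning setoid

  codeSum : ∀ n → (Vec Bool n → Carrier) → Carrier
  codeSum zero    t = t []
  codeSum (suc n) t = codeSum n (t ∘ (true ∷_)) + codeSum n (t ∘ (false ∷_))

  codeSum-cong : ∀ n {s t} → (∀ v → s v ≈ t v) → codeSum n s ≈ codeSum n t
  codeSum-cong zero    e = e []
  codeSum-cong (suc n) e = +-cong (codeSum-cong n (e ∘ (true ∷_))) (codeSum-cong n (e ∘ (false ∷_)))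

  -- Each bit is a Boolean property to which `HasSum-split` applies. Codes replace subsets because
  -- fibres are taken over propositional equality, whereas subsets are compared pointwise.
  HasSum-codes : ∀ n W (κ : Element W → Vec Bool n) →
                 (∀ {x y} → Setoid._≈_ (Weighted.support W) x y → κ x ≡ κ y) →
                 ∀ {t} → (∀ v → HasSum (fibre W κ v) (t v)) → HasSum W (codeSum n t)
  HasSum-codes zero W κ κ-cong p = HasSum-⇿ {W = fibre W κ []} record
    { inv     = strictInverse {S = Weighted.support (fibre W κ [])} {T = W.support}
                  proj₁ (λ x → x , trivial (κ x)) id id (λ _ → S.refl) (λ _ → S.refl)
    ; weights = λ _ → ≈-refl
    } (p [])
    where
    module W = Weighted W
    module S = Setoid W.support
    trivial : (v : Vec Bool 0) → v ≡ []
    trivial [] = refl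
  HasSum-codes (suc n) W κ κ-cong {t} p = HasSum-split W (Vec.head ∘ κ) (cong Vec.head ∘ κ-cong) (half true)
    (half false)
    where
    module W = Weighted W
    module S = Setoid W.support
    cons : ∀ {b v} (w : Vec Bool (suc n)) → Vec.head w ≡ b → Vec.tail w ≡ v → w ≡ b ∷ v
    cons (_ ∷ _) refl refl = refl
    half : ∀ b → HasSum (fibre W (Vec.head ∘ κ) b) (codeSum n (t ∘ (b ∷_)))
    half b = HasSum-codes n (fibre W (Vec.head ∘ κ) b) (Vec.tail ∘ κ ∘ proj₁) (cong Vec.tail ∘ κ-cong) λ v →
      HasSum-⇿ record
        { inv     = strictInverse {S = Weighted.support (fibre W κ (b ∷ v))}
            {T = Weighted.support (fibre (fibre W (Vec.head ∘ κ) b) (Vec.tail ∘ κ ∘ proj₁) v)}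
            (λ (x , e) → (x , cong Vec.head e) , cong Vec.tail e)
            (λ ((x , e) , e′) → x , cons (κ x) e e′)
            id id (λ _ → S.refl) (λ _ → S.refl)
        ; weights = λ _ → ≈-refl
        } (p (b ∷ v))

  -- n! f n, the term of index n of the sequence with exponential generating series f.
  expand : Series → ℕ → Carrier
  expand f n = fromℕ (n !) * f n

  expand-suc : ∀ f n → expand f (suc n) ≈ expand (tail (θ f)) n
  expand-suc f n = trans (*-congʳ (fromℕ-* (suc n) (n !)))
    (solve 3 (λ x y z → (x :* y) :* z := y :* (x :* z)) ≈-refl (fromℕ (suc n)) (fromℕ (n !)) (f (suc n)))

  -- Whether the first point belongs to the subset splits the sum into the two terms of the Leibniz
  -- rule for f g, since setting a point aside differentiates an exponential generating series.
  -- Binomial coefficients are thereby avoided.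
  codeSum-⋆ : ∀ n f g → codeSum n (λ v → expand f (trues v) * expand g (falses v)) ≈ expand (f ⋆ g) n
  codeSum-⋆ zero f g = trans (solve 3 (λ o x y → (o :* x) :* (o :* y) := o :* o :* (x :* y)) ≈-refl _ _ _)
    (*-congʳ (trans (*-congʳ (+-identityʳ 1#)) (*-identityˡ _)))
  codeSum-⋆ (suc n) f g = begin
    codeSum n (λ v → expand f (suc (trues v)) * expand g (falses v)) + codeSum n
      (λ v → expand f (trues v) * expand g (suc (falses v)))
      ≈⟨ +-cong (codeSum-cong n (λ v → *-congʳ (expand-suc f (trues v))))
        (codeSum-cong n (λ v → *-congˡ (expand-suc g (falses v)))) ⟩
    codeSum n (λ v → expand (tail (θ f)) (trues v) * expand g (falses v)) + codeSum n
      (λ v → expand f (trues v) * expand (tail (θ g)) (falses v))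
      ≈⟨ +-cong (codeSum-⋆ n (tail (θ f)) g) (codeSum-⋆ n f (tail (θ g))) ⟩
    expand (tail (θ f) ⋆ g) n + expand (f ⋆ tail (θ g)) n
      ≈⟨ distribˡ _ _ _ ⟨
    fromℕ (n !) * ((tail (θ f) ⋆ g) n + (f ⋆ tail (θ g)) n)
      ≈⟨ *-congˡ (tail-θ-⋆ f g n) ⟨
    fromℕ (n !) * (fromℕ (suc n) * (f ⋆ g) (suc n))
      ≈⟨ expand-suc (f ⋆ g) n ⟨
    expand (f ⋆ g) (suc n) ∎

  -- The product formula for exponential generating series, for elements of W that amount to a subset
  -- P of U with an element of X P, placed on P, and one of Y P, placed on its complement.
  HasSum-parts : ∀ {U} W (part : Element W → Subset U) →
                 (∀ {x y} → Setoid._≈_ (Weighted.support W) x y → part x ≗ˢ part y) →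
                 ∀ {X Y : Subset U → Weighted} {f g} →
                 (∀ P → (X P ⊗ Y P) ⇿ restrictTo W (λ x → part x ≗ˢ P)) →
                 (∀ P → HasSum (X P) (expand f (FinSet.size (U ↾ P)))) →
                 (∀ P → HasSum (Y P) (expand g (FinSet.size (U ↾ ∁ P)))) →
                 HasSum W (expand (f ⋆ g) (FinSet.size U))
  HasSum-parts {U} W part part-cong {X} {Y} {f} {g} decompose p q =
    HasSum-cong (codeSum-⋆ (FinSet.size U) f g)
      (HasSum-codes (FinSet.size U) W (code ∘ part) (λ {x} {y} e → code-cong {P = part x} {part y}
        (part-cong e)) λ v →
        HasSum-⇿ (recode v) (HasSum-⇿ (decompose (decode v))
          (HasSum-cong (reflexive (cong₂ (λ i j → expand f i * expand g j) (size-decode {U} v)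
            (size-∁-decode {U} v)))
            (HasSum-⊗ {X (decode v)} {Y (decode v)} (p (decode v)) (q (decode v))))))
    where
    module S = Setoid (Weighted.support W)
    recode : ∀ v → restrictTo W (λ x → part x ≗ˢ decode v) ⇿ fibre W (code ∘ part) v
    recode v = record
      { inv     = strictInverse {S = Weighted.support (restrictTo W (λ x → part x ≗ˢ decode v))}
          {T = Weighted.support (fibre W (code ∘ part) v)}
          (λ (x , e) → x , ≗decode⇒code≡ (part x) e) (λ (x , e) → x , code≡⇒≗decode (part x) e)
          id id (λ _ → S.refl) (λ _ → S.refl)
      ; weights = λ _ → ≈-refl
      }

  structures : Species → FinSet → Weighted
  structures F U .Weighted.support         = Species.Str F U
  structures F U .Weighted.weight          = Species.weight F
  structures F U .Weighted.weight-cong     = Species.weight-cong F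
  structures F U .Weighted.weight-nonneg s = <⇒≤ (Species.weight-pos F s)

  -- Stated for all finite sets, since the factors of a product live on restrictions of U and not on
  -- initial segments.
  HasSeries : Species → Series → Set _
  HasSeries F f = ∀ U → HasSum (structures F U) (expand f (FinSet.size U))

  transport-⇿ : ∀ F {U V} → Bij U V → structures F U ⇿ structures F V
  transport-⇿ F {U} {V} σ = record
    { inv     = strictInverse (F.transport σ) (F.transport (σ ⁻¹ᵇ)) F.transport-congʳ F.transport-congʳ
        (λ s → F.≈-trans (F.transport-≗∘ {ρ = idᵇ} (Bij.strictlyInverseˡ σ)) (F.transport-id s))
        (λ s → F.≈-trans (F.transport-≗∘ {ρ = idᵇ} (Bij.strictlyInverseʳ σ)) (F.transport-id s))
    ; weights = λ s → sym (F.weight-transport σ s)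
    }
    where module F = Species F

  HasSeries-fromTotals : ∀ F f → (∀ n → HasSum (structures F [ n ]) (expand f n)) → HasSeries F f
  HasSeries-fromTotals F f p U = HasSum-⇿ (transport-⇿ F σ) (p (FinSet.size U))
    where
    σ : Bij [ FinSet.size U ] U
    σ .Bij.inv = FinSet.enum U

  module _ (F G : Species) (U : FinSet) (P : Subset U) where
    private
      module F = Species F
      module G = Species G
      module U = FinSet U
    open ProductStructure
    open Product F G using (module _≈_)
    open _≈_

    private
      Pairs Products-over-P : Setoid 0ℓ 0ℓ
      Pairs           = Weighted.support (structures F (U ↾ P) ⊗ structures G (U ↾ ∁ P))
      Products-over-P = Weighted.support (restrictTo (structures (F ⊙ G) U) (λ s → part s ≗ˢ P))
      module Pairs = Setoid Pairs
      module Products-over-P = Setoid Products-over-P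

      pair : Pairs.Carrier → Products-over-P.Carrier
      pair (l , r) = record { part = P ; left = l ; right = r } , λ _ → refl

      unpair : Products-over-P.Carrier → Pairs.Carrier
      unpair (s , e) = F.transport (restrict idᵇ (part s) P e) (left s) ,
                       G.transport (restrict idᵇ (∁ (part s)) (∁ P) (cong not ∘ e)) (right s)

      pair-cong : ∀ {x y} → x Pairs.≈ y → pair x Products-over-P.≈ pair y
      pair-cong _         .part≈ _ = refl
      pair-cong (l≈ , _)  .left≈   = F.≈-trans (F.transport-≗id (λ _ → U.refl)) l≈
      pair-cong (_  , r≈) .right≈  = G.≈-trans (G.transport-≗id (λ _ → U.refl)) r≈

      unpair-cong : ∀ {x y} → x Products-over-P.≈ y → unpair x Pairs.≈ unpair y
      unpair-cong {s , e} {t , e′} s≈t .proj₁ =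
        F.≈-trans (F.≈-sym (F.transport-≗∘ {τ = restrict idᵇ (part t) P e′} {s = left s} (λ _ → U.refl)))
                  (F.transport-congʳ (left≈ s≈t))
      unpair-cong {s , e} {t , e′} s≈t .proj₂ =
        G.≈-trans (G.≈-sym (G.transport-≗∘ {τ = restrict idᵇ (∁ (part t)) (∁ P) (cong not ∘ e′)} {s = right s}
          (λ _ → U.refl)))
                  (G.transport-congʳ (right≈ s≈t))

      pair-unpair : ∀ x → pair (unpair x) Products-over-P.≈ x
      pair-unpair (s , e) .part≈ u = ≡.sym (e u)
      pair-unpair (s , e) .left≈   = F.transport-sym {σ = restrict idᵇ (part s) P e} {s = left s}
        (λ _ → U.refl) F.≈-refl
      pair-unpair (s , e) .right≈  =
        G.transport-sym {σ = restrict idᵇ (∁ (part s)) (∁ P) (cong not ∘ e)} {s = right s} (λ _ → U.refl)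
          G.≈-refl

      unpair-pair : ∀ x → unpair (pair x) Pairs.≈ x
      unpair-pair (l , r) = F.transport-≗id (λ _ → U.refl) , G.transport-≗id (λ _ → U.refl)

    pair-⇿ : (structures F (U ↾ P) ⊗ structures G (U ↾ ∁ P)) ⇿ restrictTo (structures (F ⊙ G) U)
      (λ s → part s ≗ˢ P)
    pair-⇿ = record
      { inv     = strictInverse {S = Pairs} {T = Products-over-P} pair unpair
          (λ {x} {y} → pair-cong {x} {y}) (λ {x} {y} → unpair-cong {x} {y}) pair-unpair unpair-pair
      ; weights = λ _ → ≈-refl
      }

  HasSeries-⊙ : ∀ {F G f g} → HasSeries F f → HasSeries G g → HasSeries (F ⊙ G) (f ⋆ g)
  HasSeries-⊙ {F} {G} p q U = HasSum-parts (structures (F ⊙ G) U) ProductStructure.part Product._≈_.part≈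
    (pair-⇿ F G U) (λ P → p (U ↾ P)) (λ P → q (U ↾ ∁ P))

-- Decidable equality of colours, and cutting off the first colour.

T-does⁻ : ∀ {A : Set} (d : Dec A) → T (does d) → A
T-does⁻ (yes a) _ = a

T-does⁺ : ∀ {A : Set} (d : Dec A) → A → T (does d)
T-does⁺ (yes _) _ = tt
T-does⁺ (no ¬a) a = ¬a a

infix 4 _==_
_==_ : ∀ {m} → Fin m → Fin m → Bool
i == j = does (i Fin.≟ j)

==⇒≡ : ∀ {m} {i j : Fin m} → T (i == j) → i ≡ j
==⇒≡ {i = i} {j} = T-does⁻ (i Fin.≟ j)

≡⇒== : ∀ {m} {i j : Fin m} → i ≡ j → T (i == j)
≡⇒== {i = i} {j} = T-does⁺ (i Fin.≟ j)

-- A map to Fin (1 + m) as a subset, the fibre of zero, and a map from its complement to Fin m.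

join : ∀ {m} (b : Bool) → (T (not b) → Fin m) → Fin (suc m)
join true  k = zero
join false k = suc (k tt)

join-cong : ∀ {m} b {k k′ : T (not b) → Fin m} → (∀ p → k p ≡ k′ p) → join b k ≡ join b k′
join-cong true  e = refl
join-cong false e = cong suc (e tt)

join-cong₂ : ∀ {m b b′} {k : T (not b) → Fin m} {k′ : T (not b′) → Fin m} →
             b ≡ b′ → (∀ p q → k p ≡ k′ q) → join b k ≡ join b′ k′
join-cong₂ {b = b} refl e = join-cong b (λ p → e p p)

join≡zero : ∀ {m} b {k : T (not b) → Fin m} → b ≡ (join b k == zero)
join≡zero true  = refl
join≡zero false = refl

join≡suc : ∀ {m} b {k : T (not b) → Fin m} i p → (k p == i) ≡ (join b k == suc i)
join≡suc false i p = refl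

join≡suc⇒ : ∀ {m} b {k : T (not b) → Fin m} i → T (join b k == suc i) → T (not b)
join≡suc⇒ false i _ = tt

unjoin : ∀ {m} (x : Fin (suc m)) → T (not (x == zero)) → Fin m
unjoin (suc i) _ = i

unjoin-cong : ∀ {m} {x y : Fin (suc m)} {p q} → x ≡ y → unjoin x p ≡ unjoin y q
unjoin-cong {x = suc _} refl = refl

unjoin≡ : ∀ {m} (x : Fin (suc m)) p i → (x == suc i) ≡ (unjoin x p == i)
unjoin≡ (suc _) p i = refl

==suc⇒≢zero : ∀ {m} (x : Fin (suc m)) {i} → T (x == suc i) → T (not (x == zero))
==suc⇒≢zero (suc _) _ = tt

unjoin-join : ∀ {m} b {k : T (not b) → Fin m} p {q} → unjoin (join b k) q ≡ k p
unjoin-join false p = refl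

join-unjoin : ∀ {m} (x : Fin (suc m)) {b} (e : (x == zero) ≡ b) {k : T (not b) → Fin m} →
              (∀ p → k p ≡ unjoin x (subst (T ∘ not) (≡.sym e) p)) → join b k ≡ x
join-unjoin zero    refl h = refl
join-unjoin (suc i) refl h = cong suc (h tt)

flatten : ∀ {U} (P : Subset U) (Q : Subset (U ↾ P)) (R : Subset U) →
          (∀ u → T (Subset.mem R u) → T (Subset.mem P u)) →
          (∀ u p → Subset.mem Q (u , p) ≡ Subset.mem R u) → Bij ((U ↾ P) ↾ Q) (U ↾ R)
flatten {U} P Q R R⇒P Q≡R .Bij.inv = strictInverse
  {S = FinSet.setoid ((U ↾ P) ↾ Q)} {T = FinSet.setoid (U ↾ R)}
  (λ ((u , p) , q) → u , subst T (Q≡R u p) q)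
  (λ (u , r) → (u , R⇒P u r) , subst T (≡.sym (Q≡R u _)) r)
  id id (λ _ → FinSet.refl U) (λ _ → FinSet.refl U)

-- Ordered tuples of disjoint B-structures.

module Words {c ℓ₁ ℓ₂ : Level} (ℝ : RealNumbers c ℓ₁ ℓ₂) where
  open OverReals ℝ using (Species; ∏; ∏-cong; ∏-pos)
  open OrderedField ℝ hiding (Carrier)
  open PowerSeries commutativeRing
  open WeightedSums ℝ
  open SpeciesSums ℝ

  module _ (B : Species) where
    private
      module B = Species B

    transport-cancel₂ : ∀ {U V} {σ : Bij U V} {τ : Bij V U} {s} → τ ∘ᵇ σ ≗ᵇ idᵇ → B.transport τ
      (B.transport σ s) B.≈ s
    transport-cancel₂ eq = B.≈-trans (B.transport-≗∘ eq) (B.transport-id _)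

    transport-cancel₃ : ∀ {U V W} {ρ : Bij U V} {σ : Bij V W} {τ : Bij W U} {s} → τ ∘ᵇ (σ ∘ᵇ ρ) ≗ᵇ idᵇ →
                        B.transport τ (B.transport σ (B.transport ρ s)) B.≈ s
    transport-cancel₃ {ρ = ρ} {σ} eq =
      B.≈-trans (B.transport-congʳ (B.≈-sym (B.transport-∘ σ ρ _))) (transport-cancel₂ {σ = σ ∘ᵇ ρ} eq)

    -- An ordered m-tuple of disjoint B-structures with union U, as a map from U to Fin m together
    -- with a structure on each fibre.
    record Word (m : ℕ) (U : FinSet) : Set where
      private
        module U = FinSet U
      field
        color      : U.Carrier → Fin m
        color-cong : ∀ {u v} → u U.≈ v → color u ≡ color v

      colored : Fin m → Subset U
      colored i = record { mem = λ u → color u == i ; mem-cong = cong (_== i) ∘ color-cong }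

      field
        inner : ∀ i → B.Structure (U ↾ colored i)

    open Word

    infix 4 _≈ʷ_
    record _≈ʷ_ {m U} (s t : Word m U) : Set where
      field
        color≈ : ∀ u → color s u ≡ color t u
        inner≈ : ∀ i → B.transport (restrict idᵇ (colored s i) (colored t i) (cong (_== i) ∘ color≈))
          (inner s i)
                         B.≈ inner t i

    open _≈ʷ_

    words : ℕ → FinSet → Weighted
    words m U .Weighted.support = record
      { Carrier       = Word m U
      ; _≈_           = _≈ʷ_
      ; isEquivalence = record
        { refl  = record { color≈ = λ _ → refl ; inner≈ = λ _ → B.transport-≗id (λ _ → U.refl) }
        ; sym   = λ e → record
          { color≈ = ≡.sym ∘ color≈ e ; inner≈ = λ i → B.transport-sym (λ _ → U.refl) (inner≈ e i) }
        ; trans = λ e e′ → record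
          { color≈ = λ u → ≡.trans (color≈ e u) (color≈ e′ u)
          ; inner≈ = λ i → B.transport-trans (λ _ → U.refl) (inner≈ e i) (inner≈ e′ i)
          }
        }
      }
      where module U = FinSet U
    words m U .Weighted.weight s = ∏ [ m ] (B.weight ∘ inner s)
    words m U .Weighted.weight-cong {s} {t} e =
      ∏-cong {U = [ m ]} idᵇ {g = B.weight ∘ inner t} (λ { refl → ≈-refl }) (λ i → B.weight-≈ (inner≈ e i))
    words m U .Weighted.weight-nonneg s = <⇒≤ (∏-pos [ m ] (λ i → B.weight-pos (inner s i)))

    private
      ¬Fin0 : ¬ Fin 0
      ¬Fin0 ()

    -- A map to Fin 0 exists on the empty set only, where the empty word is the single one, of
    -- weight 1.
    HasSum-words-zero : ∀ U {n} → FinSet.size U ≡ n → HasSum (words 0 U) (expand δ n)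
    HasSum-words-zero U {zero} e = HasSum-cong (sym (trans (*-identityʳ _) (+-identityʳ 1#)))
      (HasSum-single {words 0 U} empty λ _ → record { color≈ = λ u → contradiction u ∅ ; inner≈ = λ () })
      where
      ∅ : ¬ FinSet.Carrier U
      ∅ u = ¬Fin0 (subst Fin e (Inverse.from (FinSet.enum U) u))
      empty : Word 0 U
      empty = record
        { color = λ u → contradiction u ∅ ; color-cong = λ {u} _ → contradiction u ∅ ; inner = λ () }
    HasSum-words-zero U {suc n} e = HasSum-cong (sym (zeroʳ _)) (HasSum-empty {words 0 U}
      (λ s → ¬Fin0 (color s (FinSet.enumerate U (subst Fin (≡.sym e) zero)))))

    module _ {m : ℕ} {U : FinSet} where
      private
        module U = FinSet U

      firstPart : Word (suc m) U → Subset U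
      firstPart s = colored s zero

      module _ (P : Subset U) where

        attach : B.Structure (U ↾ P) × Word m (U ↾ ∁ P) → Word (suc m) U
        attach (β , s) = record
          { color      = paint
          ; color-cong = λ e → join-cong₂ (Subset.mem-cong P e) (λ _ _ → color-cong s e)
          ; inner      = λ
            { zero    → B.transport (restrict idᵇ P _ (λ u → join≡zero (Subset.mem P u))) β
            ; (suc i) → B.transport (flatten (∁ P) (colored s i) _
                          (λ u → join≡suc⇒ (Subset.mem P u) i) (λ u p → join≡suc (Subset.mem P u) i p))
                            (inner s i)
            }
          }
          where
          paint : U.Carrier → Fin (suc m)
          paint u = join (Subset.mem P u) (λ p → color s (u , p))

        detach : Σ[ s ∈ Word (suc m) U ] firstPart s ≗ˢ P → B.Structure (U ↾ P) × Word m (U ↾ ∁ P)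
        detach (s , e) = B.transport (restrict idᵇ (firstPart s) P e) (inner s zero) , record
          { color      = unpaint
          ; color-cong = unjoin-cong ∘ color-cong s
          ; inner      = λ i → B.transport (flatten (∁ P) _ (colored s (suc i))
              (λ u r → subst (T ∘ not) (e u) (==suc⇒≢zero (color s u) r))
              (λ u p → ≡.sym (unjoin≡ (color s u) _ i)) ⁻¹ᵇ) (inner s (suc i))
          }
          where
          unpaint : FinSet.Carrier (U ↾ ∁ P) → Fin m
          unpaint (u , p) = unjoin (color s u) (subst (T ∘ not) (≡.sym (e u)) p)

        private
          Parts Words-over-P : Setoid 0ℓ 0ℓ
          Parts        = Weighted.support (structures B (U ↾ P) ⊗ words m (U ↾ ∁ P))
          Words-over-P = Weighted.support (restrictTo (words (suc m) U) (λ s → firstPart s ≗ˢ P))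
          module Parts = Setoid Parts
          module Words-over-P = Setoid Words-over-P

          attach′ : Parts.Carrier → Words-over-P.Carrier
          attach′ x = attach x , λ u → ≡.sym (join≡zero (Subset.mem P u))

          attach-cong : ∀ {x y} → x Parts.≈ y → attach′ x Words-over-P.≈ attach′ y
          attach-cong {β , s} {γ , t} (β≈ , s≈) .color≈ u = join-cong (Subset.mem P u)
            (λ p → color≈ s≈ (u , p))
          attach-cong {β , s} {γ , t} (β≈ , s≈) .inner≈ zero    =
            B.transport-square {σ = idᵇ} {s = β} {t = γ} (λ _ → U.refl) (B.≈-trans (B.transport-id β) β≈)
          attach-cong {β , s} {γ , t} (β≈ , s≈) .inner≈ (suc i) =
            B.transport-square {s = inner s i} {t = inner t i} (λ _ → U.refl) (inner≈ s≈ i)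

          detach-cong : ∀ {x y} → x Words-over-P.≈ y → detach x Parts.≈ detach y
          detach-cong {s , e} {t , e′} s≈t .proj₁ =
            B.≈-trans (B.≈-sym (B.transport-≗∘ {τ = restrict idᵇ (firstPart t) P e′} {s = inner s zero}
              (λ _ → U.refl)))
                      (B.transport-congʳ (inner≈ s≈t zero))
          detach-cong {s , e} {t , e′} s≈t .proj₂ .color≈ (u , _) = unjoin-cong (color≈ s≈t u)
          detach-cong {s , e} {t , e′} s≈t .proj₂ .inner≈ i =
            B.transport-square {s = inner s (suc i)} {t = inner t (suc i)} (λ _ → U.refl) (inner≈ s≈t (suc i))

          attach-detach : ∀ x → attach′ (detach x) Words-over-P.≈ x
          attach-detach (s , e) .color≈ u       = join-unjoin (color s u) (e u) (λ _ → refl)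
          attach-detach (s , e) .inner≈ zero    = transport-cancel₃ {s = inner s zero} (λ _ → U.refl)
          attach-detach (s , e) .inner≈ (suc i) = transport-cancel₃ {s = inner s (suc i)} (λ _ → U.refl)

          detach-attach : ∀ x → detach (attach′ x) Parts.≈ x
          detach-attach (β , s) .proj₁                 = transport-cancel₂ {s = β} (λ _ → U.refl)
          detach-attach (β , s) .proj₂ .color≈ (u , p) = unjoin-join (Subset.mem P u) p
          detach-attach (β , s) .proj₂ .inner≈ i       = transport-cancel₃ {s = inner s i} (λ _ → U.refl)

        attach-⇿ : (structures B (U ↾ P) ⊗ words m (U ↾ ∁ P)) ⇿
                   restrictTo (words (suc m) U) (λ s → firstPart s ≗ˢ P)
        attach-⇿ = record
          { inv     = strictInverse {S = Parts} {T = Words-over-P} attach′ detach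
              (λ {x} {y} → attach-cong {x} {y}) (λ {x} {y} → detach-cong {x} {y}) attach-detach detach-attach
          ; weights = λ (β , s) → *-cong (sym (B.weight-transport _ β))
              (∏-cong {U = [ m ]} idᵇ {g = λ i → B.weight (inner (attach (β , s)) (suc i))}
                (λ { refl → ≈-refl }) (λ i → sym (B.weight-transport _ (inner s i))))
          }

    -- The fibre of zero and the word on its complement realise the recursion of `b ↑ suc m` as a
    -- product.
    HasSum-words : ∀ {b} → HasSeries B b → ∀ m U → HasSum (words m U) (expand (b ↑ m) (FinSet.size U))
    HasSum-words p zero    U = HasSum-words-zero U refl
    HasSum-words p (suc m) U = HasSum-parts (words (suc m) U) firstPart (λ e u → cong (_== zero) (color≈ e u))
      attach-⇿ (λ P → p (U ↾ P)) (λ P → HasSum-words p m (U ↾ ∁ P))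

-- Pigeonhole, counting, and increasing self-maps of finite sets.

-- If j were missed, punching it out would embed Fin (suc m) into Fin m.
injective⇒surjective : ∀ {m} (f : Fin m → Fin m) → (∀ {i j} → f i ≡ f j → i ≡ j) → ∀ j → ∃[ i ] f i ≡ j
injective⇒surjective {suc m} f f-injective j with Fin.any? (λ i → f i Fin.≟ j)
... | yes hit = hit
... | no miss = contradiction
  (Fin.injective⇒≤ {f = λ i → punchOut (avoid i)} (f-injective ∘ Fin.punchOut-injective (avoid _) (avoid _)))
  ℕ.1+n≰n
  where
  avoid : ∀ i → ¬ (j ≡ f i)
  avoid i e = miss (i , ≡.sym e)

module _ {X : FinSet} where
  private
    module X = FinSet X

  injection⇒bijection : ∀ {m} → X.size ≡ m → (f : X.Carrier → Fin m) → (∀ {x y} → x X.≈ y → f x ≡ f y) →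
                        (∀ {x y} → f x ≡ f y → x X.≈ y) → Σ[ e ∈ Bij X [ m ] ] (∀ x → Bij.to e x ≡ f x)
  injection⇒bijection {m} refl f f-cong f-injective = e , λ _ → refl
    where
    surjective : ∀ j → ∃[ i ] f (X.enumerate i) ≡ j
    surjective = injective⇒surjective (f ∘ X.enumerate) λ {i} {j} p →
      ≡.trans (≡.sym (Inverse.strictlyInverseʳ X.enum i))
        (≡.trans (Inverse.from-cong X.enum (f-injective p)) (Inverse.strictlyInverseʳ X.enum j))
    e : Bij X [ m ]
    e .Bij.inv = strictInverse f (X.enumerate ∘ proj₁ ∘ surjective) f-cong (λ { refl → X.refl })
      (proj₂ ∘ surjective) (λ x → f-injective (proj₂ (surjective (f x))))

count : ∀ {n} → (Fin n → Bool) → ℕ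
count {zero}  p = 0
count {suc n} p with p zero
... | true  = suc (count (p ∘ suc))
... | false = count (p ∘ suc)

count-≤ : ∀ {n} {p q : Fin n → Bool} → (∀ i → T (p i) → T (q i)) → count p ℕ.≤ count q
count-≤ {zero}          p⇒q = z≤n
count-≤ {suc n} {p} {q} p⇒q with p zero | q zero | p⇒q zero
... | true  | true  | _ = s≤s (count-≤ (p⇒q ∘ suc))
... | true  | false | h with () ← h tt
... | false | true  | _ = ℕ.m≤n⇒m≤1+n (count-≤ (p⇒q ∘ suc))
... | false | false | _ = count-≤ (p⇒q ∘ suc)

count-< : ∀ {n} {p q : Fin n → Bool} → (∀ i → T (p i) → T (q i)) →
          ∀ i → ¬ T (p i) → T (q i) → count p ℕ.< count q
count-< {suc n} {p} {q} p⇒q zero ¬pi qi with p zero | q zero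
... | true  | _    = contradiction tt ¬pi
... | false | true = s≤s (count-≤ (p⇒q ∘ suc))
count-< {suc n} {p} {q} p⇒q (suc i) ¬pi qi with p zero | q zero | p⇒q zero
... | true  | true  | _ = s≤s (count-< (p⇒q ∘ suc) i ¬pi qi)
... | true  | false | h with () ← h tt
... | false | true  | _ = ℕ.m≤n⇒m≤1+n (count-< (p⇒q ∘ suc) i ¬pi qi)
... | false | false | _ = count-< (p⇒q ∘ suc) i ¬pi qi

count-true : ∀ n → count {n} (λ _ → true) ≡ n
count-true zero    = refl
count-true (suc n) = cong suc (count-true n)

count<size : ∀ {n} {p : Fin n → Bool} i → ¬ T (p i) → count p ℕ.< n
count<size {n} {p} i ¬pi = subst (count p ℕ.<_) (count-true n) (count-< {p = p} (λ _ _ → tt) i ¬pi tt)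

-- Each step up in i forces a step up in f i. Applied to the comparison of two numberings of an
-- order and to its inverse, this shows that the numberings coincide.
strictlyMonotone⇒≤ : ∀ {m} (f : Fin m → Fin m) → (∀ {i j} → toℕ i ℕ.< toℕ j → toℕ (f i) ℕ.< toℕ (f j)) →
                     ∀ i → toℕ i ℕ.≤ toℕ (f i)
strictlyMonotone⇒≤ {m} f f-mono i = go (toℕ i) i refl
  where
  go : ∀ n i → toℕ i ≡ n → n ℕ.≤ toℕ (f i)
  go zero    i e = z≤n
  go (suc n) i e = ℕ.≤-trans (s≤s (go n j (Fin.toℕ-fromℕ< _))) (f-mono j<i)
    where
    n<m : n ℕ.< m
    n<m = ℕ.<-trans (ℕ.n<1+n n) (subst (ℕ._< m) e (Fin.toℕ<n i))
    j : Fin m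
    j = fromℕ< n<m
    j<i : toℕ j ℕ.< toℕ i
    j<i = ℕ.≤-reflexive (≡.trans (cong suc (Fin.toℕ-fromℕ< n<m)) (≡.sym e))

infix 4 _≤ᵇ_
_≤ᵇ_ : ∀ {m} → Fin m → Fin m → Bool
i ≤ᵇ j = does (i Fin.≤? j)

≤ᵇ⇒≤ : ∀ {m} (i j : Fin m) → T (i ≤ᵇ j) → toℕ i ℕ.≤ toℕ j
≤ᵇ⇒≤ i j = T-does⁻ (i Fin.≤? j)

≤⇒≤ᵇ : ∀ {m} (i j : Fin m) → toℕ i ℕ.≤ toℕ j → T (i ≤ᵇ j)
≤⇒≤ᵇ i j = T-does⁺ (i Fin.≤? j)

-- Numberings of linear orders and of cycles.

module Numberings {c ℓ₁ ℓ₂ : Level} (ℝ : RealNumbers c ℓ₁ ℓ₂) where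
  open OverReals ℝ using (LinearOrder; module LinearOrder; Cycle; module Cycle)

  module _ {X : FinSet} where
    private
      module X = FinSet X
    open LinearOrder

    OrderNumbering : ∀ {m} → LinearOrder X → Bij X [ m ] → Set
    OrderNumbering s e = ∀ x y → leq s x y ≡ (Bij.to e x ≤ᵇ Bij.to e y)

    numbering-unique : ∀ {m} {s} (e e′ : Bij X [ m ]) → OrderNumbering s e → OrderNumbering s e′ →
                       ∀ x → Bij.to e x ≡ Bij.to e′ x
    numbering-unique {m} {s} e e′ p q x = Fin.toℕ-injective (ℕ.≤-antisym
        (ℕ.≤-trans (strictlyMonotone⇒≤ (shift e e′) (mono e e′ p q) (Bij.to e x))
          (ℕ.≤-reflexive (cong toℕ (Bij.to-cong e′ (Bij.strictlyInverseʳ e x)))))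
        (ℕ.≤-trans (strictlyMonotone⇒≤ (shift e′ e) (mono e′ e q p) (Bij.to e′ x))
          (ℕ.≤-reflexive (cong toℕ (Bij.to-cong e (Bij.strictlyInverseʳ e′ x))))))
      where
      shift : (e e′ : Bij X [ m ]) → Fin m → Fin m
      shift e e′ = Bij.to e′ ∘ Bij.from e
      mono : ∀ (e e′ : Bij X [ m ]) → OrderNumbering s e → OrderNumbering s e′ →
             ∀ {i j} → toℕ i ℕ.< toℕ j → toℕ (shift e e′ i) ℕ.< toℕ (shift e e′ j)
      mono e e′ p q {i} {j} i<j = ℕ.≰⇒> λ fj≤fi → ℕ.<⇒≱ i<j
        (subst₂ (Bij.strictlyInverseˡ e j) (Bij.strictlyInverseˡ e i)
          (≤ᵇ⇒≤ (Bij.to e (Bij.from e j)) (Bij.to e (Bij.from e i))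
          (subst T (p _ _) (subst T (≡.sym (q _ _)) (≤⇒≤ᵇ (shift e e′ j) (shift e e′ i) fj≤fi)))))
        where
        subst₂ : ∀ {a b c d : Fin m} → a ≡ c → b ≡ d → toℕ a ℕ.≤ toℕ b → toℕ c ℕ.≤ toℕ d
        subst₂ refl refl r = r

    numbering-determines : ∀ {m} {s t} {e : Bij X [ m ]} → OrderNumbering s e → OrderNumbering t e →
                           ∀ x y → leq s x y ≡ leq t x y
    numbering-determines p q x y = ≡.trans (p x y) (≡.sym (q x y))

    -- Each element is numbered by how many elements lie strictly below it. The count is less than
    -- the size because an element is not below itself; totality makes it reflect the order, and
    -- antisymmetry then makes it injective.
    numbering-exists : ∀ {m} (s : LinearOrder X) → X.size ≡ m → Σ[ e ∈ Bij X [ m ] ] OrderNumbering s e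
    numbering-exists {m} s refl = e , λ x y → T-ext
        (λ x≤y → ≤⇒≤ᵇ (Bij.to e x) (Bij.to e y) (subst₂≤ (e≡ x) (e≡ y) (≤⇒rank≤ x≤y)))
        (λ r → rank≤⇒≤ (subst₂≤ (≡.sym (e≡ x)) (≡.sym (e≡ y)) (≤ᵇ⇒≤ (Bij.to e x) (Bij.to e y) r)))
      where
      module S = IsTotalOrder (isTotalOrder s)
      subst₂≤ : ∀ {a b c d : Fin m} → c ≡ a → d ≡ b → toℕ a ℕ.≤ toℕ b → toℕ c ℕ.≤ toℕ d
      subst₂≤ refl refl r = r
      below : X.Carrier → Fin m → Bool
      below x i = not (leq s x (X.enumerate i))
      ¬below : ∀ x → ¬ T (below x (Inverse.from X.enum x))
      ¬below x = not-T (S.reflexive (X.sym (Inverse.strictlyInverseˡ X.enum x)))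
        where
        not-T : ∀ {b} → T b → ¬ T (not b)
        not-T {true} _ ()
      rank : X.Carrier → Fin m
      rank x = fromℕ< (count<size {p = below x} (Inverse.from X.enum x) (¬below x))
      toℕ-rank : ∀ x → toℕ (rank x) ≡ count (below x)
      toℕ-rank x = Fin.toℕ-fromℕ< _
      not-anti : ∀ {a b} → (T b → T a) → T (not a) → T (not b)
      not-anti {false} {false} _ _ = tt
      not-anti {false} {true}  h _ with () ← h tt
      ≤⇒rank≤ : ∀ {x y} → T (leq s x y) → toℕ (rank x) ℕ.≤ toℕ (rank y)
      ≤⇒rank≤ {x} {y} x≤y = ≡.subst₂ ℕ._≤_ (≡.sym (toℕ-rank x)) (≡.sym (toℕ-rank y))
        (count-≤ {p = below x} {below y} (λ i → not-anti (S.trans x≤y)))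
      T-not : ∀ {b} → ¬ T b → T (not b)
      T-not {false} _ = tt
      T-not {true} ¬t = ¬t tt
      <⇒rank< : ∀ {x y} → T (leq s x y) → ¬ T (leq s y x) → toℕ (rank x) ℕ.< toℕ (rank y)
      <⇒rank< {x} {y} x≤y y≰x = ≡.subst₂ ℕ._<_ (≡.sym (toℕ-rank x)) (≡.sym (toℕ-rank y))
        (count-< {p = below x} {below y} (λ i → not-anti (S.trans x≤y)) (Inverse.from X.enum x) (¬below x)
          (T-not (λ r → y≰x (S.trans r (S.reflexive (Inverse.strictlyInverseˡ X.enum x))))))
      rank≤⇒≤ : ∀ {x y} → toℕ (rank x) ℕ.≤ toℕ (rank y) → T (leq s x y)
      rank≤⇒≤ {x} {y} r with T?? (leq s x y)
        where
        T?? : ∀ b → T b ⊎ ¬ T b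
        T?? true  = inj₁ tt
        T?? false = inj₂ id
      ... | inj₁ x≤y = x≤y
      ... | inj₂ x≰y with S.total x y
      ...   | inj₁ x≤y = x≤y
      ...   | inj₂ y≤x = contradiction r (ℕ.<⇒≱ (<⇒rank< y≤x x≰y))
      numbered : Σ[ e ∈ Bij X [ m ] ] (∀ x → Bij.to e x ≡ rank x)
      numbered = injection⇒bijection refl rank
        (λ x≈y → Fin.toℕ-injective (ℕ.≤-antisym (≤⇒rank≤ (S.reflexive x≈y))
          (≤⇒rank≤ (S.reflexive (X.sym x≈y)))))
        (λ r → S.antisym (rank≤⇒≤ (ℕ.≤-reflexive (cong toℕ r)))
          (rank≤⇒≤ (ℕ.≤-reflexive (cong toℕ (≡.sym r)))))
      e : Bij X [ m ]
      e = proj₁ numbered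
      e≡ : ∀ x → Bij.to e x ≡ rank x
      e≡ = proj₂ numbered

    order : ∀ {m} → Bij X [ m ] → LinearOrder X
    order e = record
      { leq          = λ x y → to x ≤ᵇ to y
      ; isTotalOrder = record
        { isPartialOrder = record
          { isPreorder = record
            { isEquivalence = X.isEquivalence
            ; reflexive     = λ {x} {y} x≈y → ≤⇒≤ᵇ (to x) (to y) (ℕ.≤-reflexive (cong toℕ (to-cong x≈y)))
            ; trans         = λ {x} {y} {z} p q → ≤⇒≤ᵇ (to x) (to z)
                (ℕ.≤-trans (≤ᵇ⇒≤ (to x) (to y) p) (≤ᵇ⇒≤ (to y) (to z) q))
            }
          ; antisym = λ {x} {y} p q → X.trans (X.sym (strictlyInverseʳ _))
              (X.trans (from-cong (Fin.toℕ-injective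
              (ℕ.≤-antisym (≤ᵇ⇒≤ (to x) (to y) p) (≤ᵇ⇒≤ (to y) (to x) q)))) (strictlyInverseʳ _))
          }
        ; total = λ x y → Sum.map (≤⇒≤ᵇ (to x) (to y)) (≤⇒≤ᵇ (to y) (to x))
            (ℕ.≤-total (toℕ (to x)) (toℕ (to y)))
        }
      }
      where open Bij e

  module _ {m′ : ℕ} where
    private
      m : ℕ
      m = suc m′

    rot : Fin m → Fin m
    rot i = suc (toℕ i) mod m

    toℕ-mod : ∀ k → toℕ (k mod m) ≡ k % m
    toℕ-mod k = Fin.toℕ-fromℕ< _

    suc-% : ∀ k → suc (k % m) % m ≡ suc k % m
    suc-% k = ≡.trans (%-distribˡ-+ 1 (k % m) m)
      (≡.trans (cong (λ r → (1 % m ℕ.+ r) % m) (m%n%n≡m%n k m)) (≡.sym (%-distribˡ-+ 1 k m)))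

    rot-mod : ∀ k → rot (k mod m) ≡ suc k mod m
    rot-mod k = Fin.toℕ-injective (≡.trans (toℕ-mod (suc (toℕ (k mod m))))
      (≡.trans (cong (λ r → suc r % m) (toℕ-mod k)) (≡.trans (suc-% k) (≡.sym (toℕ-mod (suc k))))))

    toℕ-mod-id : ∀ (i : Fin m) → toℕ i mod m ≡ i
    toℕ-mod-id i = Fin.toℕ-injective (≡.trans (toℕ-mod (toℕ i)) (m<n⇒m%n≡m (Fin.toℕ<n i)))

    iterate-rot-mod : ∀ a k → iterate rot (a mod m) k ≡ (a ℕ.+ k) mod m
    iterate-rot-mod a zero    = cong (_mod m) (≡.sym (ℕ.+-identityʳ a))
    iterate-rot-mod a (suc k) = ≡.trans (cong (λ i → iterate rot i k) (rot-mod a))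
      (≡.trans (iterate-rot-mod (suc a) k) (cong (_mod m) (≡.sym (ℕ.+-suc a k))))

    iterate-rot : ∀ i k → iterate rot i k ≡ (toℕ i ℕ.+ k) mod m
    iterate-rot i k = ≡.trans (cong (λ j → iterate rot j k) (≡.sym (toℕ-mod-id i)))
      (iterate-rot-mod (toℕ i) k)

    mod-+m : ∀ k → (k ℕ.+ m) mod m ≡ k mod m
    mod-+m k = Fin.toℕ-injective (≡.trans (toℕ-mod (k ℕ.+ m)) (≡.trans ([m+n]%n≡m%n k m) (≡.sym (toℕ-mod k))))

    -- Since m = suc m′, stepping back once is stepping forward m′ times.
    rotᵇ : Bij [ m ] [ m ]
    rotᵇ .Bij.inv = strictInverse rot (λ i → (toℕ i ℕ.+ m′) mod m) (cong rot) (cong _)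
      (λ i → ≡.trans (rot-mod _) (≡.trans (cong (_mod m) (≡.sym (ℕ.+-suc (toℕ i) m′)))
        (≡.trans (mod-+m (toℕ i)) (toℕ-mod-id i))))
      (λ i → ≡.trans (≡.sym (iterate-rot (rot i) m′))
        (≡.trans (iterate-rot i m) (≡.trans (mod-+m (toℕ i)) (toℕ-mod-id i))))

  module _ {X : FinSet} where
    private
      module X = FinSet X

    iterate-cong : ∀ {f : X.Carrier → X.Carrier} → (∀ {x y} → x X.≈ y → f x X.≈ f y) →
                   ∀ k {x y} → x X.≈ y → iterate f x k X.≈ iterate f y k
    iterate-cong f-cong zero    e = e
    iterate-cong f-cong (suc k) e = iterate-cong f-cong k (f-cong e)

    iterate-suc : ∀ (f : X.Carrier → X.Carrier) x k → iterate f x (suc k) ≡ f (iterate f x k)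
    iterate-suc f x zero    = refl
    iterate-suc f x (suc k) = iterate-suc f (f x) k

    iterate-+ : ∀ (f : X.Carrier → X.Carrier) x j k → iterate f x (j ℕ.+ k) ≡ iterate f (iterate f x j) k
    iterate-+ f x zero    k = refl
    iterate-+ f x (suc j) k = iterate-+ f (f x) j k

    iterate-inverse : ∀ (σ : Bij X X) x k → iterate (Bij.to σ) (iterate (Bij.from σ) x k) k X.≈ x
    iterate-inverse σ x zero    = X.refl
    iterate-inverse σ x (suc k) = X.trans
      (X.reflexive (iterate-suc (Bij.to σ) (iterate (Bij.from σ) (Bij.from σ x) k) k))
      (X.trans (Bij.to-cong σ (iterate-inverse σ (Bij.from σ x) k)) (Bij.strictlyInverseˡ σ x))

    module Orbit (s : Cycle X) (x₀ : X.Carrier) where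
      open Cycle s
      private
        module σ = Bij perm
        step : X.Carrier → ℕ
        step x = proj₁ (cyclic x₀ x)
      orbit : ℕ → X.Carrier
      orbit = iterate σ.to x₀

      orbit-step : ∀ x → orbit (step x) X.≈ x
      orbit-step x = proj₂ (cyclic x₀ x)

      orbit-suc : ∀ k → orbit (suc k) ≡ σ.to (orbit k)
      orbit-suc = iterate-suc σ.to x₀

      to-injective : ∀ {x y} → σ.to x X.≈ σ.to y → x X.≈ y
      to-injective e = X.trans (X.sym (σ.strictlyInverseʳ _)) (X.trans (σ.from-cong e) (σ.strictlyInverseʳ _))

      -- The permutation is injective, so a common initial stretch can be stripped from a
      -- repetition, which leaves a return to the start.
      orbit-cancel : ∀ a d → orbit (a ℕ.+ d) X.≈ orbit a → orbit d X.≈ x₀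
      orbit-cancel zero    d e = e
      orbit-cancel (suc a) d e = orbit-cancel a d (to-injective
        (X.trans (X.reflexive (≡.sym (orbit-suc (a ℕ.+ d)))) (X.trans e (X.reflexive (orbit-suc a)))))

      orbit-+ : ∀ d → orbit d X.≈ x₀ → ∀ k → orbit (d ℕ.+ k) X.≈ orbit k
      orbit-+ d e k = X.trans (X.reflexive (iterate-+ σ.to x₀ d k)) (iterate-cong σ.to-cong k e)

      orbit-* : ∀ d → orbit d X.≈ x₀ → ∀ q r → orbit (r ℕ.+ q ℕ.* d) X.≈ orbit r
      orbit-* d e zero    r = X.reflexive (cong orbit (ℕ.+-identityʳ r))
      orbit-* d e (suc q) r = X.trans (X.reflexive (cong orbit
        (≡.trans (≡.sym (ℕ.+-assoc r d _)) (≡.trans (cong (ℕ._+ q ℕ.* d) (ℕ.+-comm r d)) (ℕ.+-assoc d r _)))))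
        (X.trans (orbit-+ d e (r ℕ.+ q ℕ.* d)) (orbit-* d e q r))

      orbit-% : ∀ d .{{_ : NonZero d}} → orbit d X.≈ x₀ → ∀ k → orbit (k % d) X.≈ orbit k
      orbit-% d e k = X.trans (X.sym (orbit-* d e (k / d) (k % d)))
        (X.reflexive (cong orbit (≡.sym (m≡m%n+[m/n]*n k d))))

      orbit-mod : ∀ d → orbit (suc d) X.≈ x₀ → ∀ k → orbit (toℕ (k mod suc d)) X.≈ orbit k
      orbit-mod d e k = X.trans (X.reflexive (cong orbit (toℕ-mod k))) (orbit-% (suc d) e k)

      private
        index : ∀ d → Fin X.size → Fin (suc d)
        index d i = step (X.enumerate i) mod suc d

        orbit-index : ∀ d → orbit (suc d) X.≈ x₀ → ∀ i → orbit (toℕ (index d i)) X.≈ X.enumerate i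
        orbit-index d e i = X.trans (orbit-mod d e (step (X.enumerate i))) (orbit-step (X.enumerate i))

        enumerate-injective : ∀ {i j} → X.enumerate i X.≈ X.enumerate j → i ≡ j
        enumerate-injective p = ≡.trans (≡.sym (Inverse.strictlyInverseʳ X.enum _))
          (≡.trans (Inverse.from-cong X.enum p) (Inverse.strictlyInverseʳ X.enum _))

        index-injective : ∀ d → orbit (suc d) X.≈ x₀ → ∀ {i j} → index d i ≡ index d j → i ≡ j
        index-injective d e {i} {j} p = enumerate-injective (X.trans (X.sym (orbit-index d e i))
          (X.trans (X.reflexive (cong (orbit ∘ toℕ) p)) (orbit-index d e j)))

      -- Every point is on the orbit of x₀, and a return after suc d steps lets its step count be
      -- reduced modulo suc d, so there are at most suc d points.
      size≤period : ∀ d → orbit (suc d) X.≈ x₀ → X.size ℕ.≤ suc d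
      size≤period d e = Fin.injective⇒≤ (index-injective d e)

      -- Among the first size + 1 entries of the orbit two coincide, which gives a return time of at
      -- most the size; `size≤period` shows that it is no smaller.
      orbit-size : orbit X.size X.≈ x₀
      orbit-size with Fin.pigeonhole (ℕ.n<1+n X.size) (Inverse.from X.enum ∘ orbit ∘ toℕ)
      ... | i , j , i<j , p = period
        where
        d : ℕ
        d = toℕ j ∸ toℕ i
        returns : orbit d X.≈ x₀
        returns = orbit-cancel (toℕ i) d (X.trans (X.reflexive (cong orbit (ℕ.m+[n∸m]≡n (ℕ.<⇒≤ i<j))))
          (X.trans (X.sym (Inverse.strictlyInverseˡ X.enum _))
            (X.trans (X.reflexive (cong X.enumerate (≡.sym p))) (Inverse.strictlyInverseˡ X.enum _))))
        d≤size : d ℕ.≤ X.size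
        d≤size = ℕ.≤-trans (ℕ.m∸n≤m (toℕ j) (toℕ i)) (Fin.toℕ≤pred[n] j)
        positive : ∀ k → 0 ℕ.< k → orbit k X.≈ x₀ → X.size ℕ.≤ k
        positive (suc k) _ = size≤period k
        period : orbit X.size X.≈ x₀
        period = subst (λ k → orbit k X.≈ x₀) (ℕ.≤-antisym d≤size (positive d (ℕ.m<n⇒0<n∸m i<j) returns))
          returns

      module _ {m′ : ℕ} (size≡m : X.size ≡ suc m′) where
        private
          m : ℕ
          m = suc m′

        orbit-m : orbit m X.≈ x₀
        orbit-m = subst (λ k → orbit k X.≈ x₀) size≡m orbit-size

        private
          hit : ∀ (a : Fin m) → ∃[ i ] index m′ i ≡ a
          hit = onto size≡m (index m′) (index-injective m′ orbit-m)
            where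
            onto : ∀ {k l} → k ≡ l → (f : Fin k → Fin l) → (∀ {i j} → f i ≡ f j → i ≡ j) → ∀ a → ∃[ i ] f i ≡
              a
            onto refl = injective⇒surjective

        -- `index` is an injection between sets of equal size, hence onto, and the orbit recovers
        -- each point from its index.
        orbit-injective : ∀ {a b : Fin m} → orbit (toℕ a) X.≈ orbit (toℕ b) → a ≡ b
        orbit-injective {a} {b} e with hit a | hit b
        ... | i , refl | j , refl = cong (index m′) (enumerate-injective
          (X.trans (X.sym (orbit-index m′ orbit-m i)) (X.trans e (orbit-index m′ orbit-m j))))

        -- A discrete logarithm: the exponent below m that takes x₀ to x. The step count supplied by
        -- `cyclic` is arbitrary, hence the reduction modulo m.
        coordinate : X.Carrier → Fin m
        coordinate x = step x mod m

        orbit-coordinate : ∀ x → orbit (toℕ (coordinate x)) X.≈ x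
        orbit-coordinate x = X.trans (orbit-mod m′ orbit-m (step x)) (orbit-step x)

        coordinate-orbit : ∀ {x} k → x X.≈ orbit k → coordinate x ≡ k mod m
        coordinate-orbit {x} k e = orbit-injective (X.trans (orbit-coordinate x)
          (X.trans e (X.sym (orbit-mod m′ orbit-m k))))

        coordinate-perm : ∀ x → coordinate (σ.to x) ≡ rot (coordinate x)
        coordinate-perm x = ≡.trans (coordinate-orbit (suc (toℕ (coordinate x)))
          (X.trans (σ.to-cong (X.sym (orbit-coordinate x))) (X.reflexive
            (≡.sym (orbit-suc (toℕ (coordinate x))))))) refl

        coordinates : Σ[ e ∈ Bij X [ m ] ] (∀ x → Bij.to e x ≡ coordinate x)
        coordinates = injection⇒bijection size≡m coordinate
          (λ x≈y → orbit-injective (X.trans (orbit-coordinate _) (X.trans x≈y (X.sym (orbit-coordinate _)))))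
          (λ p → X.trans (X.sym (orbit-coordinate _)) (X.trans (X.reflexive (cong (orbit ∘ toℕ) p))
            (orbit-coordinate _)))

    module _ {m′ : ℕ} where
      private
        m : ℕ
        m = suc m′
      open Cycle

      CycleNumbering : Cycle X → Bij X [ m ] → Set
      CycleNumbering s e = ∀ x → Bij.to e (Bij.to (perm s) x) ≡ rot (Bij.to e x)

      numbering-iterate : ∀ s e → CycleNumbering s e →
                          ∀ x k → Bij.to e (iterate (Bij.to (perm s)) x k) ≡ iterate rot (Bij.to e x) k
      numbering-iterate s e p x zero    = refl
      numbering-iterate s e p x (suc k) =
        ≡.trans (numbering-iterate s e p (Bij.to (perm s) x) k) (cong (λ i → iterate rot i k) (p x))

      -- A numbering turns the cycle into the rotation, so its value at x₀ propagates along the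
      -- orbit, which is everything.
      cycleNumbering-unique : ∀ s e e′ x₀ → CycleNumbering s e → CycleNumbering s e′ →
                              Bij.to e x₀ ≡ Bij.to e′ x₀ → ∀ x → Bij.to e x ≡ Bij.to e′ x
      cycleNumbering-unique s e e′ x₀ p q e₀ x = let k , r = cyclic s x₀ x in
        ≡.trans (Bij.to-cong e (X.sym r)) (≡.trans (numbering-iterate s e p x₀ k)
          (≡.trans (cong (λ i → iterate rot i k) e₀) (≡.trans (≡.sym (numbering-iterate s e′ q x₀ k))
            (Bij.to-cong e′ r))))

      cycleNumbering-determines : ∀ s t e → CycleNumbering s e → CycleNumbering t e → perm s ≗ᵇ perm t
      cycleNumbering-determines s t e p q x = X.trans (X.sym (Bij.strictlyInverseʳ e _))
        (X.trans (Bij.from-cong e (≡.trans (p x) (≡.sym (q x)))) (Bij.strictlyInverseʳ e _))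

      cycleNumbering-exists : ∀ s → X.size ≡ m → ∀ x₀ j →
                              Σ[ e ∈ Bij X [ m ] ] CycleNumbering s e × Bij.to e x₀ ≡ j
      cycleNumbering-exists s size≡m x₀ j = e ,
          (λ x → ≡.trans (e≡ _) (≡.trans (coordinate-perm size≡m x) (cong rot (≡.sym (e≡ x))))) ,
          ≡.trans (e≡ x₀) (≡.trans (coordinate-orbit size≡m (toℕ j)
            (X.sym (iterate-inverse (perm s) x₀ (toℕ j)))) (toℕ-mod-id j))
        where
        -- Starting the orbit j steps before x₀ gives x₀ itself the number j.
        open Orbit s (iterate (Bij.from (perm s)) x₀ (toℕ j))
        e : Bij X [ m ]
        e = proj₁ (coordinates size≡m)
        e≡ : ∀ x → Bij.to e x ≡ coordinate size≡m x
        e≡ = proj₂ (coordinates size≡m)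

      cycle : Bij X [ m ] → Cycle X
      cycle e = record
        { perm   = π
        ; point  = from zero
        -- On to the point numbered zero, then to y: starting from the number of x this arrives at m
        -- plus that of y, which is y modulo m.
        ; cyclic = λ x y → (m ∸ toℕ (to x)) ℕ.+ toℕ (to y) ,
            X.trans (X.sym (strictlyInverseʳ _)) (X.trans (from-cong (reach x y)) (strictlyInverseʳ y))
        }
        where
        open Bij e
        π : Bij X X
        π = e ⁻¹ᵇ ∘ᵇ rotᵇ ∘ᵇ e
        to-iterate : ∀ x k → to (iterate (Bij.to π) x k) ≡ iterate rot (to x) k
        to-iterate x zero    = refl
        to-iterate x (suc k) = ≡.trans (to-iterate (Bij.to π x) k)
          (cong (λ i → iterate rot i k) (strictlyInverseˡ _))
        reach : ∀ x y → to (iterate (Bij.to π) x ((m ∸ toℕ (to x)) ℕ.+ toℕ (to y))) ≡ to y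
        reach x y = ≡.trans (to-iterate x ((m ∸ toℕ (to x)) ℕ.+ toℕ (to y)))
          (≡.trans (iterate-rot (to x) ((m ∸ toℕ (to x)) ℕ.+ toℕ (to y)))
          (≡.trans (cong (_mod m) arithmetic) (≡.trans (mod-+m (toℕ (to y))) (toℕ-mod-id (to y)))))
          where
          arithmetic : toℕ (to x) ℕ.+ ((m ∸ toℕ (to x)) ℕ.+ toℕ (to y)) ≡ toℕ (to y) ℕ.+ m
          arithmetic = ≡.trans (≡.sym (ℕ.+-assoc (toℕ (to x)) _ _))
            (≡.trans (cong (ℕ._+ toℕ (to y)) (ℕ.m+[n∸m]≡n (ℕ.<⇒≤ (Fin.toℕ<n (to x))))) (ℕ.+-comm m _))

      cycle-numbering : ∀ e → CycleNumbering (cycle e) e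
      cycle-numbering e x = Bij.strictlyInverseˡ e _

open Partition using (rel)

-- Composite structures with numbered blocks as words.

module Compositions {c ℓ₁ ℓ₂ : Level} (ℝ : RealNumbers c ℓ₁ ℓ₂) where
  open OverReals ℝ using (Species; ∏; ∏-cong; _⊚_; _atSize_; 𝓛; 𝓒; CompositeStructure; module Composite)
  open OrderedField ℝ hiding (Carrier)
  open PowerSeries commutativeRing
  open WeightedSums ℝ
  open SpeciesSums ℝ
  open Words ℝ
  open Numberings ℝ

  Structure : Species → FinSet → Set
  Structure F U = Setoid.Carrier (Species.Str F U)

  composites : Species → Species → FinSet → Weighted
  composites F B U .Weighted.support         = Species.Str (F ⊚ B) U
  composites F B U .Weighted.weight          = Species.weight (F ⊚ B)
  composites F B U .Weighted.weight-cong     = Species.weight-cong (F ⊚ B)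
  composites F B U .Weighted.weight-nonneg s = <⇒≤ (Species.weight-pos (F ⊚ B) s)

  restricted : Species → ℕ → Species → FinSet → Weighted
  restricted F m B U .Weighted.support         = Species.Str ((F atSize m) ⊚ B) U
  restricted F m B U .Weighted.weight          = Species.weight ((F atSize m) ⊚ B)
  restricted F m B U .Weighted.weight-cong     = Species.weight-cong ((F atSize m) ⊚ B)
  restricted F m B U .Weighted.weight-nonneg s = <⇒≤ (Species.weight-pos ((F atSize m) ⊚ B) s)

  -- For every set X of m blocks, the F-structures on X with an index in Fin k correspond to the
  -- bijections from X to Fin m.
  record Numbering (F : Species) (m k : ℕ) (U : FinSet) : Set (lsuc 0ℓ ⊔ˡ c ⊔ˡ ℓ₁) where
    private
      module F = Species F
    field
      Compatible  : ∀ {π : Partition U} → Structure F (blocks π) → Bij (blocks π) [ m ] → Set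
      index       : ∀ {π : Partition U} → Bij (blocks π) [ m ] → Fin k
      index-cong  : ∀ {π ρ} (e : Bij (blocks π) [ m ]) (e′ : Bij (blocks ρ) [ m ]) →
                    (∀ u → Bij.to e u ≡ Bij.to e′ u) → index e ≡ index e′
      unique      : ∀ {π} (s : Structure F (blocks π)) e e′ → Compatible s e → Compatible s e′ →
                    index e ≡ index e′ → ∀ u → Bij.to e u ≡ Bij.to e′ u
      exists      : ∀ {π} (s : Structure F (blocks π)) → FinSet.size (blocks π) ≡ m → ∀ j →
                    Σ[ e ∈ Bij (blocks π) [ m ] ] Compatible s e × index e ≡ j
      build       : ∀ {π} → Bij (blocks π) [ m ] → Structure F (blocks π)
      build-compatible : ∀ {π} (e : Bij (blocks π) [ m ]) → Compatible (build e) e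
      determined  : ∀ {π} (s t : Structure F (blocks π)) e → Compatible s e → Compatible t e → s F.≈ t
      transported : ∀ {π ρ} (h : ∀ u v → rel π u v ≡ rel ρ u v) s t
                    (e : Bij (blocks π) [ m ]) (e′ : Bij (blocks ρ) [ m ]) →
                    F.transport (onBlocks idᵇ π ρ h) s F.≈ t → (∀ u → Bij.to e u ≡ Bij.to e′ u) →
                    Compatible s e → Compatible t e′
      weight≈1    : ∀ {X} (s : Structure F X) → F.weight s ≈ 1#

  orderNumbering : ∀ m U → Numbering 𝓛 m 1 U
  orderNumbering m U = record
    { Compatible       = OrderNumbering
    ; index            = λ _ → zero
    ; index-cong       = λ _ _ _ → refl
    ; unique           = λ s e e′ p q _ → numbering-unique {s = s} e e′ p q
    ; exists           = λ { s size≡m zero → let e , p = numbering-exists s size≡m in e , p , refl }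
    ; build            = order
    ; build-compatible = λ _ _ _ → refl
    ; determined       = λ s t e p q → numbering-determines {s = s} {t} {e} p q
    ; transported      = λ h s t e e′ s≈t e≈e′ p u v →
        ≡.trans (≡.sym (s≈t u v)) (≡.trans (p u v) (cong₂ _≤ᵇ_ (e≈e′ u) (e≈e′ v)))
    ; weight≈1         = λ _ → ≈-refl
    }

  cycleNumbering : ∀ m U → FinSet.Carrier U → Numbering 𝓒 (suc m) (suc m) U
  cycleNumbering m U u₀ = record
    { Compatible       = CycleNumbering
    ; index            = λ e → Bij.to e u₀
    ; index-cong       = λ _ _ e≈e′ → e≈e′ u₀
    ; unique           = λ s e e′ p q → cycleNumbering-unique s e e′ u₀ p q
    ; exists           = λ s size≡m j → cycleNumbering-exists s size≡m u₀ j
    ; build            = cycle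
    ; build-compatible = cycle-numbering
    ; determined       = cycleNumbering-determines
    ; transported      = λ h s t e e′ s≈t e≈e′ p u →
        ≡.trans (≡.sym (Bij.to-cong e′ (s≈t u))) (≡.trans (≡.sym (e≈e′ _))
          (≡.trans (p u) (cong rot (e≈e′ u))))
    ; weight≈1         = λ _ → ≈-refl
    }

  module _ {F B : Species} {m k : ℕ} {U : FinSet} (N : Numbering F m k U)
           (B[∅]=∅ : ∀ {V} → FinSet.size V ≡ 0 → ¬ Structure B V) where
    open Numbering N
    open CompositeStructure
    open Composite (F atSize m) B using (module _≈_)
    open _≈_
    open Word
    open _≈ʷ_
    private
      module F = Species F
      module B = Species B
      module U = FinSet U

      infix 4 _≈ᵂ_
      _≈ᵂ_ : Word B m U → Word B m U → Set
      _≈ᵂ_ = _≈ʷ_ B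

      -- A B-structure proves its underlying set nonempty. So every colour of a word is used, and
      -- its classes are numbered by all of Fin m.
      occupant : ∀ V → Structure B V → FinSet.Carrier V
      occupant V s = go (FinSet.size V) refl
        where
        go : ∀ n → FinSet.size V ≡ n → FinSet.Carrier V
        go zero    e = contradiction s (B[∅]=∅ e)
        go (suc n) e = FinSet.enumerate V (subst Fin (≡.sym e) zero)

    module _ (s : Element (restricted F m B U)) (j : Fin k) where
      private
        numbered : Σ[ e ∈ Bij (blocks (partition s)) [ m ] ] Compatible (proj₁ (outer s)) e × index e ≡ j
        numbered = exists (proj₁ (outer s)) (proj₂ (outer s)) j

      numbering : Bij (blocks (partition s)) [ m ]
      numbering = proj₁ numbered

      numbering-compatible : Compatible (proj₁ (outer s)) numbering
      numbering-compatible = proj₁ (proj₂ numbered)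

      numbering-index : index numbering ≡ j
      numbering-index = proj₂ (proj₂ numbered)

      private
        module e = Bij numbering

      rel≡color : ∀ i u → rel (partition s) (e.from i) u ≡ (e.to u == i)
      rel≡color i u = T-ext
        (λ r → ≡⇒== (≡.trans (≡.sym (e.to-cong r)) (e.strictlyInverseˡ i)))
        (λ c → subst (λ i → T (rel (partition s) (e.from i) u)) (==⇒≡ c) (e.strictlyInverseʳ u))

      toWord : Word B m U
      toWord = record
        { color      = e.to
        ; color-cong = e.to-cong ∘ Partition.≈⇒rel (partition s)
        ; inner      = λ i → B.transport (restrict idᵇ (block (partition s) (e.from i)) _ (rel≡color i))
            (inner s (e.from i))
        }

    module _ (w : Word B m U) where
      private
        chosen : ∀ i → FinSet.Carrier (U ↾ colored w i)
        chosen i = occupant (U ↾ colored w i) (inner w i)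
        same⇒≡ : ∀ u v → T (color w v == color w u) → color w u ≡ color w v
        same⇒≡ u v p = ≡.sym (==⇒≡ {i = color w v} p)
        ≡⇒same : ∀ u v → color w u ≡ color w v → T (color w v == color w u)
        ≡⇒same u v e = ≡⇒== {i = color w v} (≡.sym e)

      -- The colours are compared in swapped order so that the block of u has, by definition, the
      -- same members as `colored w (color w u)`, and the structures of the word fit on the blocks.
      colorPartition : Partition U
      colorPartition = record
        { rel           = λ u v → color w v == color w u
        ; isEquivalence = record
          { refl  = λ {u} → ≡⇒same u u refl
          ; sym   = λ {u} {v} p → ≡⇒same v u (≡.sym (same⇒≡ u v p))
          ; trans = λ {u} {v} {x} p q → ≡⇒same u x (≡.trans (same⇒≡ u v p) (same⇒≡ v x q))
          }
        ; ≈⇒rel         = λ {u} {v} u≈v → ≡⇒same u v (color-cong w u≈v)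
        }

      colorNumbering : Bij (blocks colorPartition) [ m ]
      colorNumbering .Bij.inv = strictInverse {S = FinSet.setoid (blocks colorPartition)}
        (color w) (proj₁ ∘ chosen) (λ {u} {v} → same⇒≡ u v)
          (λ { {i} refl → ≡⇒same (proj₁ (chosen i)) (proj₁ (chosen i)) refl })
        (λ i → ==⇒≡ (proj₂ (chosen i)))
        (λ u → ≡⇒same (proj₁ (chosen (color w u))) u (==⇒≡ (proj₂ (chosen (color w u)))))

      inner-≡ : ∀ {i j} (p : i ≡ j) (h : ∀ u → (color w u == i) ≡ (color w u == j)) →
                B.transport (restrict idᵇ (colored w i) (colored w j) h) (inner w i) B.≈ inner w j
      inner-≡ refl h = B.transport-≗id (λ _ → U.refl)

      fromWord : Element (restricted F m B U)
      fromWord = record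
        { partition = colorPartition
        ; outer     = build colorNumbering , size-cong colorNumbering
        ; inner     = λ u → B.transport (restrict idᵇ (colored w (color w u)) (block colorPartition u)
            (λ _ → refl))
                                        (inner w (color w u))
        ; coherent  = λ {u} {v} p → B.transport-square
            {σ = restrict idᵇ (colored w (color w u)) (colored w (color w v))
              (λ x → cong (color w x ==_) (same⇒≡ u v p))}
            (λ _ → U.refl) (inner-≡ (same⇒≡ u v p) _)
        }

    -- Each index j selects one compatible numbering of the blocks of s, which colours U. Conversely
    -- the colours of a word number its classes, and that numbering determines both the outer
    -- structure and the index.
    composite⇿word : (counting k ⊗ restricted F m B U) ⇿ words B m U
    composite⇿word = record
      { inv     = strictInverse {S = Weighted.support (counting k ⊗ restricted F m B U)}
        {T = Weighted.support (words B m U)}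
          (λ (j , s) → toWord s j) (λ w → index (colorNumbering w) , fromWord w)
          (λ {(j , s)} {(j′ , t)} (j≡j′ , s≈t) → toWord-cong s t j j′ j≡j′ s≈t)
          (λ {w} {w′} w≈w′ → index-cong (colorNumbering w) (colorNumbering w′) (color≈ w≈w′) , fromWord-cong w
            w′ w≈w′)
          toWord-fromWord
          (λ (j , s) → ≡.trans (index-cong (colorNumbering (toWord s j)) (numbering s j) (λ _ → refl))
            (numbering-index s j) ,
                       fromWord-toWord s j)
      ; weights = λ (j , s) → trans (*-identityˡ _) (trans (*-congʳ (weight≈1 (proj₁ (outer s))))
          (trans (*-identityˡ _)
          -- The word carries the structure of a representative of each block; coherence makes the
          -- choice of representative immaterial to the weight.
          (∏-cong (numbering s j) {g = λ i → B.weight (inner (toWord s j) i)} (λ { refl → ≈-refl }) (λ u →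
            trans (B.weight-≈ (coherent s (Partition.Rel.sym (partition s)
              (Bij.strictlyInverseʳ (numbering s j) u))))
                  (sym (B.weight-transport _ _))))))
      }
      where
      toWord-cong : ∀ s t j j′ → j ≡ j′ → Setoid._≈_ (Weighted.support (restricted F m B U)) s t → toWord s j
        ≈ᵂ toWord t j′
      toWord-cong s t j .j refl s≈t = record
        { color≈ = colors
        ; inner≈ = λ i → B.transport-square
            {σ = restrict idᵇ (block (partition s) (Bij.from e i)) (block (partition t) (Bij.from e′ i))
                   (λ u → ≡.trans (partition≈ s≈t (Bij.from e i) u) (rel-congˡ (partition t) (same i)))}
            (λ _ → U.refl)
            (B.transport-trans (λ _ → U.refl) (inner≈ s≈t (Bij.from e i)) (coherent t (same i)))
        }
        where
        e : Bij (blocks (partition s)) [ m ]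
        e = numbering s j
        e′ e″ : Bij (blocks (partition t)) [ m ]
        e′ = numbering t j
        -- The numberings of s and t are obtained independently. Here that of s is carried to the
        -- blocks of t, where uniqueness makes it agree with e′.
        e″ = e ∘ᵇ onBlocks idᵇ (partition s) (partition t) (partition≈ s≈t) ⁻¹ᵇ
        colors : ∀ u → Bij.to e u ≡ Bij.to e′ u
        colors = unique (proj₁ (outer t)) e″ e′
          (transported (partition≈ s≈t) (proj₁ (outer s)) (proj₁ (outer t)) e e″ (outer≈ s≈t) (λ _ → refl)
            (numbering-compatible s j))
          (numbering-compatible t j)
          (≡.trans (index-cong e″ e (λ _ → refl)) (≡.trans (numbering-index s j)
            (≡.sym (numbering-index t j))))
        same : ∀ i → T (rel (partition t) (Bij.from e i) (Bij.from e′ i))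
        same i = Partition.Rel.trans (partition t)
          (Partition.Rel.sym (partition t) (Bij.strictlyInverseʳ e′ (Bij.from e i)))
          (Bij.from-cong e′ (≡.trans (≡.sym (colors (Bij.from e i))) (Bij.strictlyInverseˡ e i)))

      fromWord-cong : ∀ w w′ → w ≈ᵂ w′ → Setoid._≈_ (Weighted.support (restricted F m B U)) (fromWord w)
        (fromWord w′)
      fromWord-cong w w′ w≈w′ = record
        { partition≈ = λ u v → parts u v
        ; outer≈     = determined _ _ (colorNumbering w′)
            (transported parts (build (colorNumbering w)) _ (colorNumbering w) (colorNumbering w′) F.≈-refl
              (color≈ w≈w′)
              (build-compatible (colorNumbering w)))
            (build-compatible (colorNumbering w′))
        ; inner≈     = λ u → B.transport-square
            {σ = restrict idᵇ (colored w (color w u)) (colored w′ (color w′ u)) (parts u)}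
            (λ _ → U.refl)
            (B.transport-trans {σ = restrict idᵇ _ (colored w′ (color w u))
              (λ v → cong (_== color w u) (color≈ w≈w′ v))}
              (λ _ → U.refl) (inner≈ w≈w′ (color w u)) (inner-≡ w′ (color≈ w≈w′ u)
                (λ v → cong (color w′ v ==_) (color≈ w≈w′ u))))
        }
        where
        parts : ∀ u v → (color w v == color w u) ≡ (color w′ v == color w′ u)
        parts u v = cong₂ _==_ (color≈ w≈w′ v) (color≈ w≈w′ u)

      toWord-fromWord : ∀ w → toWord (fromWord w) (index (colorNumbering w)) ≈ᵂ w
      toWord-fromWord w = record
        { color≈ = colors
        ; inner≈ = λ i → B.≈-trans (B.≈-sym (transport-∘₃ (λ _ → U.refl)))
            (inner-≡ w (≡.trans (≡.sym (colors (Bij.from e i))) (Bij.strictlyInverseˡ e i))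
                       (λ u → cong (color w u ==_) (≡.trans (≡.sym (colors (Bij.from e i)))
                         (Bij.strictlyInverseˡ e i))))
        }
        where
        e : Bij (blocks (colorPartition w)) [ m ]
        e = numbering (fromWord w) (index (colorNumbering w))
        colors : ∀ u → Bij.to e u ≡ color w u
        colors = unique _ e (colorNumbering w) (numbering-compatible (fromWord w) _)
          (build-compatible (colorNumbering w)) (numbering-index (fromWord w) _)
        transport-∘₃ : ∀ {V₁ V₂ V₃ V₄} {ρ : Bij V₁ V₂} {σ : Bij V₂ V₃} {τ : Bij V₃ V₄} {υ : Bij V₁ V₄} {s} →
                       υ ≗ᵇ τ ∘ᵇ (σ ∘ᵇ ρ) → B.transport υ s B.≈ B.transport τ
                         (B.transport σ (B.transport ρ s))
        transport-∘₃ {ρ = ρ} {σ} {τ} eq = B.≈-trans (B.transport-cong eq B.≈-refl)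
          (B.≈-trans (B.transport-∘ τ (σ ∘ᵇ ρ) _) (B.transport-congʳ (B.transport-∘ σ ρ _)))

      fromWord-toWord : ∀ s j → Setoid._≈_ (Weighted.support (restricted F m B U)) (fromWord (toWord s j)) s
      fromWord-toWord s j = record
        { partition≈ = parts
        ; outer≈     = determined _ _ e
            (transported parts (build (colorNumbering w)) _ (colorNumbering w) e F.≈-refl (λ _ → refl)
              (build-compatible (colorNumbering w)))
            (numbering-compatible s j)
        ; inner≈     = λ u → B.≈-trans
            (B.transport-congʳ (B.≈-sym (B.transport-∘ _ _ _)))
            (B.≈-trans (B.transport-≗∘ (λ _ → U.refl)) (coherent s (Bij.strictlyInverseʳ e u)))
        }
        where
        w : Word B m U
        w = toWord s j
        e : Bij (blocks (partition s)) [ m ]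
        e = numbering s j
        parts : ∀ u v → (Bij.to e v == Bij.to e u) ≡ rel (partition s) u v
        parts u v = ≡.trans (≡.sym (rel≡color s j (Bij.to e u) v))
          (rel-congˡ (partition s) (Bij.strictlyInverseʳ e u))

-- Series of restricted compositions and of virtual species, and the probability.

module Totals {c ℓ₁ ℓ₂ : Level} (ℝ : RealNumbers c ℓ₁ ℓ₂) where
  open OverReals ℝ using
    ( Species; _≅_; module _≅_; _⊕_; _⊙_; _⊚_; _^_; _atSize_; 𝟘; 𝟏; CompositeStructure; module
      CompositeStructure; module Composite; module Cycle
    ; Family; linearOrders; cyclicPermutations; species; Virtual; module Virtual; _⊝_; ⌜_⌝; _+ᵛ_; _-ᵛ_; _*ᵛ_;
        _×ᵛ_; 𝔡
    ; InRestriction; IsProbability; Summable; Summableᵛ; totalWeight; totalWeightᵛ; include; IsSum)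
  open OrderedField ℝ hiding (Carrier)
  open OrderedField ℝ using () renaming (Carrier to R)
  open PowerSeries commutativeRing
  open WeightedSums ℝ
  open SpeciesSums ℝ
  open Words ℝ
  open Compositions ℝ
  open SetoidReasoning setoid

  ⇿-sym : ∀ {W V} → W ⇿ V → V ⇿ W
  ⇿-sym {W} {V} I = record
    { inv     = Symmetry.inverse (_⇿_.inv I)
    ; weights = λ y → sym (trans (_⇿_.weights I (from y)) (Weighted.weight-cong V (strictlyInverseˡ y)))
    }
    where open Inverse (_⇿_.inv I)

  ∑-upTo : ∀ n (t : ℕ → R) → ∑ (map t (upTo n)) ≡ Σ< n t
  ∑-upTo n t = ≡.trans (cong ∑ (List.map-applyUpTo id t n)) (go n t)
    where
    go : ∀ n (t : ℕ → R) → ∑ (applyUpTo t n) ≡ Σ< n t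
    go zero    t = refl
    go (suc n) t = cong (λ x → t 0 + x) (go n (t ∘ suc))

  HasSum-levels : ∀ N W (level : Element W → ℕ) → (∀ {x y} → Setoid._≈_ (Weighted.support W) x y → level x ≡
    level y) →
                  (∀ x → level x ℕ.< N) → ∀ {t} → (∀ m → HasSum (fibre W level m) (t m)) → HasSum W (Σ< N t)
  HasSum-levels zero    W level level-cong <N p = HasSum-empty λ x → ℕ.n≮0 (<N x)
  HasSum-levels (suc N) W level level-cong <N {t} p = HasSum-split W (isZero ∘ level)
    (cong isZero ∘ level-cong)
    (HasSum-⇿ {W = fibre W level 0} record
      { inv     = strictInverse {S = Weighted.support (fibre W level 0)}
        {T = Weighted.support (fibre W (isZero ∘ level) true)}
          (λ (x , e) → x , cong isZero e) (λ (x , e) → x , isZero⇒ (level x) e) id id (λ _ → S.refl)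
            (λ _ → S.refl)
      ; weights = λ _ → ≈-refl
      } (p 0))
    (HasSum-levels N positive (pred ∘ level ∘ proj₁) (cong pred ∘ level-cong)
      (λ (x , e) → pred< (level x) e (<N x)) λ m →
      HasSum-⇿ {W = fibre W level (suc m)} record
        { inv     = strictInverse {S = Weighted.support (fibre W level (suc m))}
            {T = Weighted.support (fibre positive (pred ∘ level ∘ proj₁) m)}
            (λ (x , e) → (x , cong isZero e) , cong pred e) (λ ((x , e) , e′) → x , suc-pred (level x) e e′)
            id id (λ _ → S.refl) (λ _ → S.refl)
        ; weights = λ _ → ≈-refl
        } (p (suc m)))
    where
    module S = Setoid (Weighted.support W)
    isZero : ℕ → Bool
    isZero zero    = true
    isZero (suc _) = false
    positive : Weighted
    positive = fibre W (isZero ∘ level) false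
    isZero⇒ : ∀ k → isZero k ≡ true → k ≡ 0
    isZero⇒ zero _ = refl
    pred< : ∀ k → isZero k ≡ false → k ℕ.< suc N → pred k ℕ.< N
    pred< (suc k) _ (ℕ.s≤s p) = p
    suc-pred : ∀ k {m} → isZero k ≡ false → pred k ≡ m → k ≡ suc m
    suc-pred (suc k) _ refl = refl

  -- The number of F-structures on m points divided by m!: this is 1 for orders and 1 / m for
  -- cycles, with no cycle on the empty set.
  multiplicity : Family → ℕ → R
  multiplicity linearOrders       m       = 1#
  multiplicity cyclicPermutations zero    = 0#
  multiplicity cyclicPermutations (suc m) = inverse (0<⇒#0 (fromℕ-pos (suc m)))

  -- The enumeration of blocks picks an element of each; equal elements lie in one block, so
  -- distinct blocks have distinct representatives.
  blocks≤ : ∀ {U} (π : Partition U) → FinSet.size (blocks π) ℕ.≤ FinSet.size U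
  blocks≤ {U} π = Fin.injective⇒≤ {f = Inverse.from U.enum ∘ X.enumerate} λ {i} {j} e →
    ≡.trans (≡.sym (Inverse.strictlyInverseʳ X.enum i)) (≡.trans
      (Inverse.from-cong X.enum (Partition.≈⇒rel π
        (U.trans (U.sym (Inverse.strictlyInverseˡ U.enum _))
          (U.trans (U.reflexive (cong U.enumerate e)) (Inverse.strictlyInverseˡ U.enum _)))))
      (Inverse.strictlyInverseʳ X.enum j))
    where
    module U = FinSet U
    module X = FinSet (blocks π)

  module _ {F B : Species} where
    open CompositeStructure
    open Composite F B using (module _≈_)
    open _≈_

    blockCount : ∀ {U} → Structure (F ⊚ B) U → ℕ
    blockCount s = FinSet.size (blocks (partition s))

    atSize-⇿ : ∀ m U → restricted F m B U ⇿ fibre (composites F B U) blockCount m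
    atSize-⇿ m U = record
      { inv     = strictInverse {S = Weighted.support (restricted F m B U)}
          {T = Weighted.support (fibre (composites F B U) blockCount m)}
          (λ s → include s , proj₂ (outer s))
          (λ (s , e) → record { partition = partition s ; outer = outer s , e ; inner = inner s ; coherent =
            coherent s })
          (λ e → record { partition≈ = Atₘ._≈_.partition≈ e ; outer≈ = Atₘ._≈_.outer≈ e ; inner≈ =
            Atₘ._≈_.inner≈ e })
          (λ e → record { partition≈ = partition≈ e ; outer≈ = outer≈ e ; inner≈ = inner≈ e })
          (λ (s , _) → Species.≈-refl (F ⊚ B))
          (λ s → Species.≈-refl ((F atSize m) ⊚ B))
      ; weights = λ _ → ≈-refl
      }
      where module Atₘ = Composite (F atSize m) B

    HasSum-composite : ∀ {U} {f : ℕ → Series} → (∀ m → HasSum (restricted F m B U)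
      (expand (f m) (FinSet.size U))) →
                       HasSum (composites F B U) (expand (λ n → Σ< (suc n) (λ m → f m n)) (FinSet.size U))
    HasSum-composite {U} {f} p = HasSum-cong (Σ<-*ˡ (suc (FinSet.size U)) (fromℕ (FinSet.size U !))
      (λ m → f m (FinSet.size U)))
      (HasSum-levels (suc (FinSet.size U)) (composites F B U) blockCount
        (λ {s} {t} e → size-cong (onBlocks idᵇ (partition s) (partition t) (partition≈ e)))
        (λ s → ℕ.s≤s (blocks≤ (partition s)))
        (λ m → HasSum-⇿ (atSize-⇿ m U) (p m)))

  module _ {B : Species} (B[∅]=∅ : ∀ {U} → FinSet.size U ≡ 0 → ¬ Structure B U) {b : Series}
    (B-series : HasSeries B b) where

    constant-term : b 0 ≈ 0#
    constant-term = trans (sym (*-identityˡ _)) (trans (*-congʳ (sym (+-identityʳ 1#)))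
      (HasSum-unique (B-series [ 0 ]) (HasSum-empty (B[∅]=∅ refl))))

    -- Words count every restricted structure suc k times, once for each index; removing the copies
    -- divides by suc k.
    HasSum-numbered : ∀ F m k U → Numbering F m (suc k) U → ∀ u → fromℕ (suc k) * u ≈ expand (b ↑ m)
      (FinSet.size U) →
                      HasSum (restricted F m B U) u
    HasSum-numbered F m k U N u e = HasSum-copies⁻ W k
      (HasSum-cong {W = counting (suc k) ⊗ W} (sym e)
        (HasSum-⇿ {W = words B m U} {V = counting (suc k) ⊗ W}
          (⇿-sym (composite⇿word {F} {B} {m} {suc k} {U} N B[∅]=∅))
          (HasSum-words B B-series m U)))
      where
      W : Weighted
      W = restricted F m B U

    atSize-series : ∀ F m → ∀ U → HasSum (restricted (species F) m B U)
      (expand (multiplicity F m ⊡ b ↑ m) (FinSet.size U))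
    atSize-series linearOrders m U = HasSum-numbered (species linearOrders) m 0 U (orderNumbering m U) _
      (trans (*-congʳ (+-identityʳ 1#)) (trans (*-identityˡ _) (*-congˡ (*-identityˡ _))))
    atSize-series cyclicPermutations zero U = HasSum-cong (sym (trans (*-congˡ (zeroˡ _)) (zeroʳ _)))
      (HasSum-empty λ s →
      let open CompositeStructure s
          X = blocks partition
      in ¬Fin0 (subst Fin (proj₂ outer) (Inverse.from (FinSet.enum X) (Cycle.point (proj₁ outer)))))
      where
      ¬Fin0 : ¬ Fin 0
      ¬Fin0 ()
    atSize-series cyclicPermutations (suc m) U = go (FinSet.size U) refl
      where
      open CompositeStructure
      κ : R
      κ = multiplicity cyclicPermutations (suc m)
      go : ∀ n → FinSet.size U ≡ n → HasSum (restricted (species cyclicPermutations) (suc m) B U)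
        (expand (κ ⊡ b ↑ suc m) (FinSet.size U))
      -- The empty set has no atom to index numberings with. It carries no structure either, because
      -- a cycle has a point, and b 0 = 0 makes the coefficient vanish.
      go zero e = HasSum-cong (sym (trans (*-congˡ (trans (reflexive (cong (κ ⊡ b ↑ suc m) e))
          (trans (*-congˡ (trans (*-congʳ constant-term) (zeroˡ _))) (zeroʳ _)))) (zeroʳ _)))
        (HasSum-empty λ s → absurd e (Cycle.point (proj₁ (outer s))))
        where
        absurd : FinSet.size U ≡ 0 → ¬ FinSet.Carrier U
        absurd e u with () ← subst Fin e (Inverse.from (FinSet.enum U) u)
      go (suc n) e = HasSum-numbered (species cyclicPermutations) (suc m) m U
        (cycleNumbering m U (FinSet.enumerate U (subst Fin (≡.sym e) zero))) _
        (trans (solve 4 (λ s f k x → s :* (f :* (k :* x)) := (s :* k) :* (f :* x)) ≈-refl (fromℕ (suc m))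
          (fromℕ (FinSet.size U !)) κ _)
          (trans (*-congʳ (*-inverse (0<⇒#0 (fromℕ-pos (suc m))))) (*-identityˡ _)))

    composite-series : ∀ F → ∀ U → HasSum (composites (species F) B U)
      (expand (λ n → Σ< (suc n) (λ m → multiplicity F m * (b ↑ m) n)) (FinSet.size U))
    composite-series F U = HasSum-composite {f = λ m → multiplicity F m ⊡ b ↑ m} (λ m → atSize-series F m U)

  HasSeries-⊕ : ∀ {F G f g} → HasSeries F f → HasSeries G g → HasSeries (F ⊕ G) (f ⊞ g)
  HasSeries-⊕ {F} {G} p q U = HasSum-cong (sym (distribˡ _ _ _))
    (HasSum-split (structures (F ⊕ G) U) isLeft isLeft-cong
    (HasSum-⇿ {W = structures F U} record
      { inv     = strictInverse {S = Species.Str F U} {T = Weighted.support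
        (fibre (structures (F ⊕ G) U) isLeft true)}
          (λ s → inj₁ s , refl) (λ { (inj₁ s , _) → s }) inj₁ (λ { {inj₁ _ , _} {inj₁ _ , _} (inj₁ e) → e })
          (λ { (inj₁ s , _) → inj₁ (Species.≈-refl F) }) (λ _ → Species.≈-refl F)
      ; weights = λ _ → ≈-refl
      } (p U))
    (HasSum-⇿ {W = structures G U} record
      { inv     = strictInverse {S = Species.Str G U} {T = Weighted.support
        (fibre (structures (F ⊕ G) U) isLeft false)}
          (λ s → inj₂ s , refl) (λ { (inj₂ s , _) → s }) inj₂ (λ { {inj₂ _ , _} {inj₂ _ , _} (inj₂ e) → e })
          (λ { (inj₂ s , _) → inj₂ (Species.≈-refl G) }) (λ _ → Species.≈-refl G)
      ; weights = λ _ → ≈-refl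
      } (q U)))
    where
    isLeft : ∀ {X Y : Set} → X ⊎ Y → Bool
    isLeft (inj₁ _) = true
    isLeft (inj₂ _) = false
    isLeft-cong : ∀ {s t} → Setoid._≈_ (Species.Str (F ⊕ G) U) s t → isLeft s ≡ isLeft t
    isLeft-cong (inj₁ _) = refl
    isLeft-cong (inj₂ _) = refl

  HasSeries-𝟘  : HasSeries 𝟘 𝟎
  HasSeries-𝟘 U = HasSum-cong (sym (zeroʳ _)) (HasSum-empty λ ())

  HasSeries-𝟏 : HasSeries 𝟏 δ
  HasSeries-𝟏 U = go (FinSet.size U) refl
    where
    go : ∀ n → FinSet.size U ≡ n → HasSum (structures 𝟏 U) (expand δ (FinSet.size U))
    go zero    e = HasSum-cong (trans (trans (sym (*-identityˡ 1#)) (*-congʳ (sym (+-identityʳ 1#))))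
      (reflexive (cong (expand δ) (≡.sym e))))
      (HasSum-single e (λ _ → refl))
    go (suc n) e = HasSum-cong (trans (sym (zeroʳ _)) (reflexive (cong (expand δ) (≡.sym e))))
      (HasSum-empty λ e′ → ℕ.0≢1+n (≡.trans (≡.sym e′) e))

  HasSeries-^ : ∀ {B b} → HasSeries B b → ∀ k → HasSeries (B ^ k) (b ↑ k)
  HasSeries-^ p zero    = HasSeries-𝟏
  HasSeries-^ p (suc k) = HasSeries-⊙ p (HasSeries-^ p k)

  -- Only the difference is tied to d; the two parts are remembered because each has its own
  -- summability and totals.
  record VirtualSeries (V : Virtual) (d : Series) : Set (lsuc 0ℓ ⊔ˡ c ⊔ˡ ℓ₁ ⊔ˡ ℓ₂) where
    field
      {positive negative} : Series
      pos-series : HasSeries (Virtual.pos V) positive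
      neg-series : HasSeries (Virtual.neg V) negative
      difference : positive ⊞ ⊟ negative ≋ d

    summable : Summableᵛ V
    summable = (λ n → expand positive n , isSum (pos-series [ n ])) ,
      (λ n → expand negative n , isSum (neg-series [ n ]))

    total-expand : ∀ n → totalWeightᵛ V summable n ≈ expand d n
    total-expand n = trans (solve 3 (λ f x y → f :* x :- f :* y := f :* (x :- y)) ≈-refl (fromℕ (n !))
      (positive n) (negative n))
      (*-congˡ (difference n))

  open VirtualSeries

  virtual-cong : ∀ {V d e} → d ≋ e → VirtualSeries V d → VirtualSeries V e
  virtual-cong d≋e v = record
    { pos-series = pos-series v ; neg-series = neg-series v ; difference = λ n → trans (difference v n)
      (d≋e n) }

  virtual-embed : ∀ {F f} → HasSeries F f → VirtualSeries ⌜ F ⌝ f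
  virtual-embed p = record
    { pos-series = p ; neg-series = HasSeries-𝟘
    ; difference = λ n → solve 1 (λ x → x :- con (+ 0) := x) ≈-refl _ }

  virtual-plus : ∀ V W {d e} → VirtualSeries V d → VirtualSeries W e → VirtualSeries (V +ᵛ W) (d ⊞ e)
  virtual-plus (F ⊝ G) (H ⊝ K) v w = record
    { positive   = positive v ⊞ positive w
    ; negative   = negative v ⊞ negative w
    ; pos-series = HasSeries-⊕ {F} {H} {positive v} {positive w} (pos-series v) (pos-series w)
    ; neg-series = HasSeries-⊕ {G} {K} {negative v} {negative w} (neg-series v) (neg-series w)
    ; difference = λ n → trans (solve 4 (λ x y z u → (x :+ z) :- (y :+ u) := (x :- y) :+ (z :- u)) ≈-refl _ _
        _ _)
        (+-cong (difference v n) (difference w n))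
    }

  virtual-minus : ∀ V W {d e} → VirtualSeries V d → VirtualSeries W e → VirtualSeries (V -ᵛ W) (d ⊞ ⊟ e)
  virtual-minus (F ⊝ G) (H ⊝ K) v w = record
    { positive   = positive v ⊞ negative w
    ; negative   = negative v ⊞ positive w
    ; pos-series = HasSeries-⊕ {F} {K} {positive v} {negative w} (pos-series v) (neg-series w)
    ; neg-series = HasSeries-⊕ {G} {H} {negative v} {positive w} (neg-series v) (pos-series w)
    ; difference = λ n → trans (solve 4 (λ x y z u → (x :+ u) :- (y :+ z) := (x :- y) :- (z :- u)) ≈-refl _ _
        _ _)
        (+-cong (difference v n) (-‿cong (difference w n)))
    }

  virtual-times : ∀ V W {d e} → VirtualSeries V d → VirtualSeries W e → VirtualSeries (V *ᵛ W) (d ⋆ e)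
  virtual-times (F ⊝ G) (H ⊝ K) v w = record
    { positive   = p ⋆ r ⊞ q ⋆ s
    ; negative   = p ⋆ s ⊞ q ⋆ r
    ; pos-series = HasSeries-⊕ {F ⊙ H} {G ⊙ K} {p ⋆ r} {q ⋆ s}
        (HasSeries-⊙ {F} {H} {p} {r} (pos-series v) (pos-series w))
          (HasSeries-⊙ {G} {K} {q} {s} (neg-series v) (neg-series w))
    ; neg-series = HasSeries-⊕ {F ⊙ K} {G ⊙ H} {p ⋆ s} {q ⋆ r}
        (HasSeries-⊙ {F} {K} {p} {s} (pos-series v) (neg-series w))
          (HasSeries-⊙ {G} {H} {q} {r} (neg-series v) (pos-series w))
    ; difference = Ser.trans (Ser.solve 4 (λ x y z u → (x Ser.:* z Ser.:+ y Ser.:* u) Ser.:-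
        (x Ser.:* u Ser.:+ y Ser.:* z)
          Ser.:= (x Ser.:- y) Ser.:* (z Ser.:- u)) Ser.refl p q r s)
        (⋆-cong (difference v) (difference w))
    }
    where
    p q r s : Series
    p = positive v
    q = negative v
    r = positive w
    s = negative w

  virtual-multiple : ∀ k V {d} → VirtualSeries V d → VirtualSeries (k ×ᵛ V) (fromℕ k ⊡ d)
  virtual-multiple zero    V v = virtual-cong {⌜ 𝟘 ⌝} (λ n → sym (zeroˡ _)) (virtual-embed {𝟘} HasSeries-𝟘)
  virtual-multiple (suc k) V v = virtual-cong {V +ᵛ k ×ᵛ V}
    (λ n → trans (+-congʳ (sym (*-identityˡ _))) (sym (distribʳ _ _ _)))
    (virtual-plus V (k ×ᵛ V) v (virtual-multiple k V v))

  𝔡-series : Family → Series → ℕ → Series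
  𝔡-series _                  b zero    = 𝟎
  𝔡-series linearOrders       b (suc k) = fromℕ (suc k) ⊡ (b ↑ k ⋆ ((δ ⊞ ⊟ b) ⋆ (δ ⊞ ⊟ b)))
  𝔡-series cyclicPermutations b (suc k) = b ↑ k ⋆ (δ ⊞ ⊟ b)

  𝔡-virtualSeries : ∀ F {B b} → HasSeries B b → ∀ m → VirtualSeries (𝔡 F B m) (𝔡-series F b m)
  𝔡-virtualSeries linearOrders       p zero    = virtual-embed {𝟘} HasSeries-𝟘
  𝔡-virtualSeries cyclicPermutations p zero    = virtual-embed {𝟘} HasSeries-𝟘
  𝔡-virtualSeries linearOrders       {B} {b} p (suc k) = virtual-multiple (suc k)
    (⌜ B ^ k ⌝ *ᵛ ((⌜ 𝟏 ⌝ -ᵛ ⌜ B ⌝) *ᵛ (⌜ 𝟏 ⌝ -ᵛ ⌜ B ⌝)))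
    (virtual-times ⌜ B ^ k ⌝ ((⌜ 𝟏 ⌝ -ᵛ ⌜ B ⌝) *ᵛ (⌜ 𝟏 ⌝ -ᵛ ⌜ B ⌝)) (virtual-embed {B ^ k} (HasSeries-^ p k))
      (virtual-times (⌜ 𝟏 ⌝ -ᵛ ⌜ B ⌝) (⌜ 𝟏 ⌝ -ᵛ ⌜ B ⌝) 1-B 1-B))
    where
    1-B : VirtualSeries (⌜ 𝟏 ⌝ -ᵛ ⌜ B ⌝) (δ ⊞ ⊟ b)
    1-B = virtual-minus ⌜ 𝟏 ⌝ ⌜ B ⌝ (virtual-embed {𝟏} HasSeries-𝟏) (virtual-embed {B} p)
  𝔡-virtualSeries cyclicPermutations {B} p (suc k) = virtual-times ⌜ B ^ k ⌝ (⌜ 𝟏 ⌝ -ᵛ ⌜ B ⌝)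
    (virtual-embed {B ^ k} (HasSeries-^ p k)) (virtual-minus ⌜ 𝟏 ⌝ ⌜ B ⌝ (virtual-embed {𝟏} HasSeries-𝟏)
      (virtual-embed {B} p))

  module _ {A F B : Species} (A≅F⊚B : A ≅ F ⊚ B) where
    private
      module I U = Inverse (_≅_.iso A≅F⊚B U)
      module FB = Species (F ⊚ B)

    isomorphic-⇿ : ∀ U → structures A U ⇿ composites F B U
    isomorphic-⇿ U = record { inv = _≅_.iso A≅F⊚B U ; weights = λ s → sym (_≅_.weights A≅F⊚B s) }

    -- An element of the event is a structure s together with a restricted structure t to which it
    -- corresponds. Up to equivalence each determines the other, so passing to t loses nothing.
    restriction-⇿ : ∀ m U → restricted F m B U ⇿
                            restrictTo (structures A U) (InRestriction {A} {F} {B} A≅F⊚B m)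
    restriction-⇿ m U = record
      { inv     = strictInverse {S = Weighted.support (restricted F m B U)}
          {T = Weighted.support (restrictTo (structures A U) (InRestriction {A} {F} {B} A≅F⊚B m))}
          (λ t → I.from U (include t) , t , FB.≈-sym (I.strictlyInverseˡ U (include t)))
          (λ (_ , t , _) → t)
          (λ {t} {t′} e → I.from-cong U (forget t t′ e))
          (λ {(s , t , p)} {(s′ , t′ , p′)} e → remember t t′
            (FB.≈-trans p (FB.≈-trans (I.to-cong U e) (FB.≈-sym p′))))
          (λ (s , t , p) → Species.≈-trans A (I.from-cong U p) (I.strictlyInverseʳ U s))
          (λ t → Species.≈-refl ((F atSize m) ⊚ B))
      ; weights = λ t → sym (trans (sym (_≅_.weights A≅F⊚B _))
          (FB.weight-cong (I.strictlyInverseˡ U (include t))))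
      }
      where
      module Fₘ = Composite (F atSize m) B
      module F∞ = Composite F B
      forget : ∀ t t′ → Species._≈_ ((F atSize m) ⊚ B) t t′ → include t FB.≈ include t′
      forget t t′ e = record { partition≈ = Fₘ._≈_.partition≈ e ; outer≈ = Fₘ._≈_.outer≈ e ; inner≈ =
        Fₘ._≈_.inner≈ e }
      remember : ∀ t t′ → include t FB.≈ include t′ → Species._≈_ ((F atSize m) ⊚ B) t t′
      remember t t′ e = record { partition≈ = F∞._≈_.partition≈ e ; outer≈ = F∞._≈_.outer≈ e ; inner≈ =
        F∞._≈_.inner≈ e }

    probability : ∀ (A-summable : Summable A) n (a#0 : totalWeight A A-summable n # 0#) m {u} →
                  HasSum (restricted F m B [ n ]) u →
                  IsProbability A A-summable n a#0 (InRestriction {A} {F} {B} A≅F⊚B m) (inverse a#0 * u)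
    probability A-summable n a#0 m p = isSum (HasSum-⇿ {V = normalised} record
      { inv     = Identity.inverse _
      ; weights = λ _ → *-comm _ _
      } (HasSum-scale (inverse a#0) 0<z (HasSum-⇿ (restriction-⇿ m [ n ]) p)))
      where
      event : Weighted
      event = restrictTo (structures A [ n ]) (InRestriction {A} {F} {B} A≅F⊚B m)
      0<z : 0# < inverse a#0
      0<z = inverse-pos a#0 (#0∧0≤⇒0< a#0 (IsSum.upper (proj₂ (A-summable n)) _ AllPairs.[]))
      normalised : Weighted
      normalised .Weighted.support         = Weighted.support event
      normalised .Weighted.weight s        = Weighted.weight event s * inverse a#0
      normalised .Weighted.weight-cong {s} {t} e = *-congʳ (Weighted.weight-cong event {s} {t} e)
      normalised .Weighted.weight-nonneg s = *-nonneg (Weighted.weight-nonneg event s) (<⇒≤ 0<z)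

-- From the gargantuan condition to the expansion of the probability.

nCk*k![n∸k]!≡n! : ∀ {n k} → k ℕ.≤ n → (n C k) ℕ.* (k ! ℕ.* (n ∸ k) !) ≡ n !
nCk*k![n∸k]!≡n! {n} {k} k≤n = ≡.trans (cong (ℕ._* (k ! ℕ.* (n ∸ k) !)) (nCk≡n!/k![n-k]! k≤n))
  (m/n*n≡m {{k ℕ.!* (n ∸ k) !≢0}} (k![n∸k]!∣n! k≤n))

module Asymptotics {c ℓ₁ ℓ₂ : Level} (ℝ : RealNumbers c ℓ₁ ℓ₂) where
  open OverReals ℝ using
    ( Species; Virtual; Family; linearOrders; cyclicPermutations; Summable; totalWeight; totalWeightᵛ; IsSum
    ; _=O_; range; Gargantuan; module Gargantuan; GargantuanSpecies; AsymptoticExpansion )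
  open OrderedField ℝ hiding (Carrier)
  open OrderedField ℝ using () renaming (Carrier to R)
  open PowerSeries commutativeRing
  open WeightedSums ℝ
  open SpeciesSums ℝ
  open Totals ℝ
  open Expansions ℝ
  open SetoidReasoning setoid

  factorial-pos : ∀ n → 0# < fromℕ (n !)
  factorial-pos n = fromℕ-pos (n !) {{n ℕ.!≢0}}

  1/ : ℕ → R
  1/ n = inverse (fromℕ!#0 n)

  0<1/ : ∀ n → 0# < 1/ n
  0<1/ n = inverse-pos (fromℕ!#0 n) (factorial-pos n)

  normalised : ∀ F → Summable F → Series
  normalised F F-summable n = divide (totalWeight F F-summable n) (fromℕ!#0 n)

  expand-normalised : ∀ F F-summable n → expand (normalised F F-summable) n ≈ totalWeight F F-summable n
  expand-normalised F F-summable n = trans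
    (solve 3 (λ x y z → x :* (y :* z) := (x :* z) :* y) ≈-refl _ _ _) (*-inverse-cancel (fromℕ!#0 n) _)

  hasSeries : ∀ F F-summable → HasSeries F (normalised F F-summable)
  hasSeries F F-summable = HasSeries-fromTotals F _ λ n → HasSum-cong (sym (expand-normalised F F-summable n))
    (record { upper = IsSum.upper (proj₂ (F-summable n)) ; approx = IsSum.approx (proj₂ (F-summable n)) })

  series-nonneg : ∀ {F f} → HasSeries F f → ∀ n → 0# ≤ f n
  series-nonneg p n = *-cancelˡ-≤ (factorial-pos n) (≤-respˡ (sym (zeroʳ _)) (HasSum-nonneg (p [ n ])))

  HasSeries-unique : ∀ {F f g} → HasSeries F f → HasSeries F g → f ≋ g
  HasSeries-unique p q n = trans (sym (cancel _)) (trans (*-congˡ (HasSum-unique (p [ n ]) (q [ n ])))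
    (cancel _))
    where
    cancel : ∀ x → 1/ n * (fromℕ (n !) * x) ≈ x
    cancel x = trans (solve 3 (λ x y z → x :* (y :* z) := (y :* x) :* z) ≈-refl _ _ _)
      (*-inverse-cancel (fromℕ!#0 n) x)

  Σ<-nonneg : ∀ n {t} → (∀ k → 0# ≤ t k) → 0# ≤ Σ< n t
  Σ<-nonneg zero    p = ≤-refl
  Σ<-nonneg (suc n) p = +-nonneg (p 0) (Σ<-nonneg n (p ∘ suc))

  term≤Σ< : ∀ n {t} → (∀ k → 0# ≤ t k) → ∀ k → k ℕ.< n → t k ≤ Σ< n t
  term≤Σ< (suc n) p zero    _         = x≤x+y (Σ<-nonneg n (p ∘ suc))
  term≤Σ< (suc n) p (suc k) (s≤s k<n) = ≤-trans (term≤Σ< n (p ∘ suc) k k<n) (y≤x+y (p 0))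

  Σ<-mono : ∀ n {s t} → (∀ k → k ℕ.< n → s k ≤ t k) → Σ< n s ≤ Σ< n t
  Σ<-mono zero    p = ≤-refl
  Σ<-mono (suc n) p = +-mono-≤ (p 0 (s≤s z≤n)) (Σ<-mono n (λ k k<n → p (suc k) (s≤s k<n)))

  truncated-Σ< : ∀ r f g n → truncated r f g n ≈ Σ< r (λ k → f k * g (n ∸ k))
  truncated-Σ< zero    f g n = ≈-refl
  truncated-Σ< (suc r) f g n = +-congˡ (trans (truncated-Σ< r (tail f) g (n ∸ 1))
    (Σ<-cong r (λ k _ → *-congˡ (reflexive (cong g (ℕ.∸-+-assoc n 1 k))))))

  multiplicity-pos : ∀ F m → 0# < multiplicity F (suc m)
  multiplicity-pos linearOrders       m = 0<1
  multiplicity-pos cyclicPermutations m = inverse-pos (0<⇒#0 (fromℕ-pos (suc m))) (fromℕ-pos (suc m))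

  multiplicity-nonneg : ∀ F m → 0# ≤ multiplicity F m
  multiplicity-nonneg F                  (suc m) = <⇒≤ (multiplicity-pos F m)
  multiplicity-nonneg linearOrders       zero    = 0≤1
  multiplicity-nonneg cyclicPermutations zero    = ≤-refl

  -- For n = 2 r + j the indices from r to n - r are the r + k with k ≤ j, so the sum over them
  -- bounds coefficient j of the square of the shifted series.
  gargantuan-convolution : ∀ {a} → (∀ n → 0# ≤ a n) → Gargantuan a →
    ∀ r → ∃[ K ] ∃[ N ] ∀ j → N ℕ.≤ j → (drop r a ⋆ drop r a) j ≤ K * a (r ℕ.+ j)
  gargantuan-convolution {a} 0≤a garg r with Gargantuan.convolution garg r
  ... | K , N , p = K , N , λ j N≤j → ≤-trans (lower j) (≤-trans (≤∣∣ _) (≤-respʳ (right j)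
      (p (r ℕ.+ (r ℕ.+ j)) (ℕ.≤-trans N≤j (ℕ.≤-trans (ℕ.m≤n+m j r) (ℕ.m≤n+m _ r))) tt)))
    where
    n∸r : ∀ j → (r ℕ.+ (r ℕ.+ j)) ∸ r ≡ r ℕ.+ j
    n∸r j = ℕ.m+n∸m≡n r (r ℕ.+ j)
    right : ∀ j → K * ∣ a ((r ℕ.+ (r ℕ.+ j)) ∸ r) ∣ ≈ K * a (r ℕ.+ j)
    right j = *-congˡ (trans (∣∣-nonneg (0≤a _)) (reflexive (cong a (n∸r j))))
    lower : ∀ j → let n = r ℕ.+ (r ℕ.+ j) in
            (drop r a ⋆ drop r a) j ≤ ∑ (map (λ k → ∣ a k * a (n ∸ k) ∣) (range r (n ∸ r)))
    lower j = ≤-resp (sym (⋆-Σ< (drop r a) (drop r a) j)) (reflexive (≡.sym sum≡))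
        (Σ<-mono (suc j) λ k k<1+j → ≤-respˡ (*-congˡ {a (r ℕ.+ k)}
          (reflexive (cong a (index k (ℕ.≤-pred k<1+j))))) (≤∣∣ _))
      where
      n : ℕ
      n = r ℕ.+ (r ℕ.+ j)
      t : ℕ → R
      t k = ∣ a k * a (n ∸ k) ∣
      length≡ : suc (n ∸ r) ∸ r ≡ suc j
      length≡ = ≡.trans (cong (λ i → suc i ∸ r) (n∸r j)) (≡.trans (cong (_∸ r) (≡.sym (ℕ.+-suc r j)))
        (ℕ.m+n∸m≡n r (suc j)))
      sum≡ : ∑ (map t (range r (n ∸ r))) ≡ Σ< (suc j) (λ k → t (r ℕ.+ k))
      sum≡ = ≡.trans (cong ∑ (≡.sym (List.map-∘ (upTo (suc (n ∸ r) ∸ r)))))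
        (≡.trans (cong (λ l → ∑ (map (λ k → t (r ℕ.+ k)) (upTo l))) length≡)
          (∑-upTo (suc j) (λ k → t (r ℕ.+ k))))
      index : ∀ k → k ℕ.≤ j → n ∸ (r ℕ.+ k) ≡ r ℕ.+ (j ∸ k)
      index k k≤j = ≡.trans (ℕ.[m+n]∸[m+o]≡n∸o r (r ℕ.+ j) k) (ℕ.+-∸-assoc r k≤j)

  ⋆-nonneg : ∀ {f g} → (∀ n → 0# ≤ f n) → (∀ n → 0# ≤ g n) → ∀ n → 0# ≤ (f ⋆ g) n
  ⋆-nonneg p q zero    = *-nonneg (p 0) (q 0)
  ⋆-nonneg p q (suc n) = +-nonneg (*-nonneg (p 0) (q (suc n))) (⋆-nonneg (p ∘ suc) q n)

  ↑-nonneg : ∀ {b} → (∀ n → 0# ≤ b n) → ∀ m n → 0# ≤ (b ↑ m) n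
  ↑-nonneg p zero    zero    = 0≤1
  ↑-nonneg p zero    (suc n) = ≤-refl
  ↑-nonneg p (suc m) n       = ⋆-nonneg p (↑-nonneg p m) n

  module _ (A : Species) (A-summable : Summable A) (gargantuan : GargantuanSpecies A A-summable) where

    private
      a : Series
      a = normalised A A-summable

      0≤a : ∀ n → 0# ≤ a n
      0≤a = series-nonneg {A} (hasSeries A A-summable)

    open Gargantuan gargantuan

    a-convolution : ∀ r → ∃[ K ] ∃[ N ] ∀ j → N ℕ.≤ j → (drop r a ⋆ drop r a) j ≤ K * a (r ℕ.+ j)
    a-convolution = gargantuan-convolution 0≤a gargantuan

    open RelativeTo a 0≤a a-convolution

    module _ (F : Family) {b : Series} (0≤b : ∀ n → 0# ≤ b n) (b₀ : b 0 ≈ 0#)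
             (a-sum : a ≋ (λ n → Σ< (suc n) (λ m → multiplicity F m * (b ↑ m) n))) where

      ↑-dominated : ∀ m → Dominated (b ↑ suc m)
      ↑-dominated m = K , <⇒≤ 0<K , λ n → ≤-respˡ (sym (∣∣-nonneg (↑-nonneg 0≤b (suc m) n)))
        (bound n (suc m ℕ.≤? n))
        where
        κ K : R
        κ = multiplicity F (suc m)
        κ#0 : κ # 0#
        κ#0 = 0<⇒#0 (multiplicity-pos F m)
        K = inverse κ#0
        0<K : 0# < K
        0<K = inverse-pos κ#0 (multiplicity-pos F m)
        bound : ∀ n → Dec (suc m ℕ.≤ n) → (b ↑ suc m) n ≤ K * a n
        -- The sum for a n stops at the n-th power; a higher power has coefficient 0 there.
        bound n (no m≰n)  = ≤-respˡ (sym (↑-vanishes b b₀ (suc m) n (ℕ.≰⇒> m≰n))) (*-nonneg (<⇒≤ 0<K) (0≤a n))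
        bound n (yes m≤n) = ≤-respˡ
          (trans (solve 3 (λ k x y → k :* (x :* y) := (x :* k) :* y) ≈-refl K κ _) (*-inverse-cancel κ#0 _))
          (*-monoˡ-≤ (<⇒≤ 0<K) (≤-respʳ (sym (a-sum n))
            (term≤Σ< (suc n) (λ k → *-nonneg (multiplicity-nonneg F k) (↑-nonneg 0≤b k n)) (suc m)
              (s≤s m≤n))))

      b-dominated : Dominated b
      b-dominated = proj₁ (↑-dominated 0) , proj₁ (proj₂ (↑-dominated 0)) , λ n →
        ≤-respˡ (∣∣-cong (Ser.*-identityʳ b n)) (proj₂ (proj₂ (↑-dominated 0)) n)

      restricted-expansion : ∀ m → Expansion (multiplicity F m ⊡ b ↑ m) (𝔡-series F b m)
      restricted-expansion m = go F refl m
        where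
        go : ∀ G → F ≡ G → ∀ m → Expansion (multiplicity G m ⊡ b ↑ m) (𝔡-series G b m)
        -- The zeroth power is concentrated at index 0, hence negligible to every order, and its
        -- expansion is zero.
        go linearOrders       refl zero    r = neg-cong
          (λ n → sym (trans (+-cong (*-identityˡ _) (-‿cong (truncated-𝟎 r a n)))
            (solve 1 (λ x → x :- con (+ 0) := x) ≈-refl _)))
          neg-δ
        go cyclicPermutations refl zero    r = neg-cong
          (λ n → sym (trans (+-cong (zeroˡ _) (-‿cong (truncated-𝟎 r a n)))
            (solve 0 (con (+ 0) :- con (+ 0) := con (+ 0)) ≈-refl)))
          neg-𝟎
        go linearOrders       refl (suc m) = expansion-cong (λ n → sym (*-identityˡ _)) Ser.refl
          (expansion-↑ ↑-dominated b-dominated (linear-expansion b₀ a-equation b-dominated) m)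
          where
          a≋geometric : a ≋ geometric b b₀
          a≋geometric n = trans (a-sum n) (Σ<-cong (suc n) {t = λ k → (b ↑ k) n}
            (λ k _ → *-identityˡ ((b ↑ k) n)))
          a-equation : a ≋ δ ⊞ b ⋆ a
          a-equation n = trans (a≋geometric n) (trans (geometric-equation b b₀ n)
            (+-congˡ (⋆-cong (λ _ → ≈-refl) (λ k → sym (a≋geometric k)) n)))
        go cyclicPermutations refl (suc m) = expansion-cong Ser.refl
          -- The weight 1 / (m + 1) of the restricted cycles cancels the m + 1 of the power rule, so
          -- the cyclic coefficients carry no multiple.
          (λ n → trans (sym (*-assoc _ _ _)) (trans (*-congʳ
            (trans (*-comm _ _) (*-inverse (0<⇒#0 (fromℕ-pos (suc m)))))) (*-identityˡ _)))
          (expansion-⊡ κ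
            (expansion-↑ ↑-dominated b-dominated (cyclic-expansion a₀ a-equation b-dominated) m))
          where
          κ : R
          κ = multiplicity cyclicPermutations (suc m)
          a₀ : a 0 ≈ 0#
          a₀ = trans (a-sum 0) (trans (+-identityʳ _) (zeroˡ _))
          a-equation : θ a ⋆ (δ ⊞ ⊟ b) ≋ θ b
          a-equation = Ser.trans (⋆-cong (θ-cong a-sum) Ser.refl)
            (logarithm-equation b b₀ (multiplicity cyclicPermutations) ≈-refl
              (λ k → trans (*-comm _ _) (*-inverse (0<⇒#0 (fromℕ-pos (suc k))))))

    A-total : ℕ → R
    A-total = totalWeight A A-summable

    module _ (n : ℕ) (a#0 : A-total n # 0#) where

      ratio-scale : R
      ratio-scale = fromℕ (n !) * inverse a#0

      A-total-pos : 0# < A-total n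
      A-total-pos = #0∧0≤⇒0< a#0 (≤-respʳ (expand-normalised A A-summable n)
        (*-nonneg (<⇒≤ (factorial-pos n)) (0≤a n)))

      ratio-scale-pos : 0# < ratio-scale
      ratio-scale-pos = *-pos (factorial-pos n) (inverse-pos a#0 A-total-pos)

      gauge : ℕ → R
      gauge k = fromℕ (n C k) * divide (A-total (n ∸ k)) a#0

      -- The binomial coefficient and the factorials contained in a leave a factor that is common to
      -- all k, times a (n - k) / k!. So gauges are compared by comparing coefficients of a.
      gauge≈ : ∀ k → k ℕ.≤ n → gauge k ≈ ratio-scale * (1/ k * a (n ∸ k))
      gauge≈ k k≤n = begin
        t * (A-total (n ∸ k) * i)
          ≈⟨ *-congˡ (*-congʳ (expand-normalised A A-summable (n ∸ k))) ⟨
        t * ((q * a (n ∸ k)) * i)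
          ≈⟨ *-inverse-cancel (fromℕ!#0 k) _ ⟨
        (p * 1/ k) * (t * ((q * a (n ∸ k)) * i))
          ≈⟨ solve 6 (λ p k c q a i → (p :* k) :* (c :* ((q :* a) :* i)) := ((c :* (p :* q)) :* i) :*
            (k :* a)) ≈-refl p (1/ k) t q (a (n ∸ k)) i ⟩
        ((t * (p * q)) * i) * (1/ k * a (n ∸ k))
          ≈⟨ *-congʳ (*-congʳ binomial) ⟩
        ratio-scale * (1/ k * a (n ∸ k)) ∎
        where
        t p q i : R
        t = fromℕ (n C k)
        p = fromℕ (k !)
        q = fromℕ ((n ∸ k) !)
        i = inverse a#0
        binomial : t * (p * q) ≈ fromℕ (n !)
        binomial = trans (*-congˡ (sym (fromℕ-* (k !) ((n ∸ k) !))))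
          (trans (sym (fromℕ-* (n C k) (k ! ℕ.* (n ∸ k) !)))
          (reflexive (cong fromℕ (nCk*k![n∸k]!≡n! k≤n))))

      gauge-nonneg : ∀ k → k ℕ.≤ n → 0# ≤ ratio-scale * (1/ k * a (n ∸ k))
      gauge-nonneg k k≤n = *-nonneg (<⇒≤ ratio-scale-pos) (*-nonneg (<⇒≤ (0<1/ k)) (0≤a _))

      ∣gauge∣ : ∀ k → k ℕ.≤ n → ∣ gauge k ∣ ≈ ratio-scale * (1/ k * a (n ∸ k))
      ∣gauge∣ k k≤n = trans (∣∣-cong (gauge≈ k k≤n)) (∣∣-nonneg (gauge-nonneg k k≤n))

    A-total#0⇐ : ∀ n → a n # 0# → A-total n # 0#
    A-total#0⇐ n = *-#0ˡ

    predecessor-bound : ∀ ε → 0# < ε → ∃[ N ] ∀ n → N ℕ.≤ n → a (n ∸ 1) ≤ ε * a n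
    predecessor-bound ε 0<ε = proj₁ nonzero ℕ.⊔ proj₁ (ratio ε 0<ε) , λ n le →
      let an#0 = proj₂ nonzero n (ℕ.m⊔n≤o⇒m≤o (proj₁ nonzero) _ le)
      in step n an#0 (proj₂ (ratio ε 0<ε) n (ℕ.m⊔n≤o⇒n≤o (proj₁ nonzero) _ le) an#0)
      where
      step : ∀ n (an#0 : a n # 0#) → ∣ divide (a (n ∸ 1)) an#0 ∣ ≤ ε * ∣ 1# ∣ → a (n ∸ 1) ≤ ε * a n
      step n an#0 le = ≤-respˡ
        (trans (*-assoc _ _ _) (trans (*-congˡ (trans (*-comm _ _) (*-inverse an#0))) (*-identityʳ _)))
        (*-monoʳ-≤ (0≤a n) (≤-trans (≤∣∣ _) (≤-respʳ (trans (*-congˡ (∣∣-nonneg 0≤1)) (*-identityʳ ε)) le)))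

    gauge-scale : ∀ k ε → 0# < ε → ∃[ N ] ∀ n → N ℕ.≤ n → (a#0 : A-total n # 0#) →
                  ∣ gauge n a#0 (suc k) ∣ ≤ ε * ∣ gauge n a#0 k ∣
    gauge-scale k ε 0<ε = suc k ℕ.+ N , λ n le a#0 →
      let k<n = ℕ.m+n≤o⇒m≤o (suc k) le
          N≤n∸k = ℕ.≤-trans (ℕ.≤-trans (ℕ.n≤1+n N) (ℕ.≤-reflexive
            (≡.sym (≡.trans (cong (_∸ k) (≡.sym (ℕ.+-suc k N))) (ℕ.m+n∸m≡n k (suc N)))))) (ℕ.∸-monoˡ-≤ k le)
      in ≤-resp (sym (∣gauge∣ n a#0 (suc k) k<n))
           (trans (rearrange (ratio-scale n a#0) (a (n ∸ k))) (*-congˡ (sym (∣gauge∣ n a#0 k (ℕ.<⇒≤ k<n)))))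
           (*-monoˡ-≤ (<⇒≤ (ratio-scale-pos n a#0)) (*-monoˡ-≤ (<⇒≤ (0<1/ (suc k)))
             (≤-respˡ (reflexive (cong a (≡.trans (ℕ.∸-+-assoc n k 1) (cong (n ∸_) (ℕ.+-comm k 1)))))
               (p (n ∸ k) N≤n∸k))))
      where
      η : R
      -- Consecutive gauges carry 1 / k! and 1 / (k + 1)!, and η is ε times the quotient of the two.
      η = ε * (1/ k * fromℕ (suc k !))
      0<η : 0# < η
      0<η = *-pos 0<ε (*-pos (0<1/ k) (factorial-pos (suc k)))
      N : ℕ
      N = proj₁ (predecessor-bound η 0<η)
      p : ∀ n → N ℕ.≤ n → a (n ∸ 1) ≤ η * a n
      p = proj₂ (predecessor-bound η 0<η)
      rearrange : ∀ z x → z * (1/ (suc k) * (η * x)) ≈ ε * (z * (1/ k * x))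
      rearrange z x = trans (solve 6 (λ z s e k f x → z :* (s :* ((e :* (k :* f)) :* x)) := (f :* s) :*
        (e :* (z :* (k :* x))))
          ≈-refl z (1/ (suc k)) ε (1/ k) (fromℕ (suc k !)) x)
        (*-inverse-cancel (fromℕ!#0 (suc k)) _)

    module _ {V : Virtual} {f d : Series} (f-expansion : Expansion f d) (V-series : VirtualSeries V d) where

      private
        V-total : ℕ → R
        V-total = totalWeightᵛ V (VirtualSeries.summable V-series)

      -- The total weight of the virtual species brings k! and the gauge brings 1 / k!, so a partial
      -- sum in terms of coefficients remains. It includes k = r, hence the truncation at suc r.
      remainder : ∀ r n (a#0 : A-total n # 0#) → r ℕ.≤ n →
        inverse a#0 * expand f n - ∑ (map (λ k → V-total k * gauge n a#0 k) (upTo (suc r))) ≈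
        ratio-scale n a#0 * (f n - truncated (suc r) d a n)
      remainder r n a#0 r≤n = trans (+-cong
          (solve 3 (λ i f x → i :* (f :* x) := (f :* i) :* x) ≈-refl (inverse a#0) (fromℕ (n !)) (f n))
          (-‿cong sum≈))
        (solve 3 (λ z x y → z :* x :- z :* y := z :* (x :- y)) ≈-refl (ratio-scale n a#0) _ _)
        where
        term≈ : ∀ k → k ℕ.< suc r → V-total k * gauge n a#0 k ≈ ratio-scale n a#0 * (d k * a (n ∸ k))
        term≈ k (s≤s k≤r) = begin
          V-total k * gauge n a#0 k
            ≈⟨ *-cong (VirtualSeries.total-expand V-series k) (gauge≈ n a#0 k (ℕ.≤-trans k≤r r≤n)) ⟩
          (fromℕ (k !) * d k) * (ratio-scale n a#0 * (1/ k * a (n ∸ k)))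
            ≈⟨ solve 5 (λ f x z i y → (f :* x) :* (z :* (i :* y)) := (f :* i) :* (z :* (x :* y))) ≈-refl _ _ _
              _ _ ⟩
          (fromℕ (k !) * 1/ k) * (ratio-scale n a#0 * (d k * a (n ∸ k)))
            ≈⟨ *-inverse-cancel (fromℕ!#0 k) _ ⟩
          ratio-scale n a#0 * (d k * a (n ∸ k)) ∎
        sum≈ : ∑ (map (λ k → V-total k * gauge n a#0 k) (upTo (suc r))) ≈ ratio-scale n a#0 * truncated
          (suc r) d a n
        sum≈ = trans (reflexive (∑-upTo (suc r) (λ k → V-total k * gauge n a#0 k)))
          (trans (Σ<-cong (suc r) term≈)
          (trans (Σ<-*ˡ (suc r) (ratio-scale n a#0) (λ k → d k * a (n ∸ k)))
                 (*-congˡ (sym (truncated-Σ< (suc r) d a n)))))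

      asymptotics : AsymptoticExpansion {D = λ n → A-total n # 0#} (λ n a#0 → inverse a#0 * expand f n)
        V-total (λ k n a#0 → gauge n a#0 k)
      asymptotics = record
        { eventually = proj₁ nonzero , λ n le → A-total#0⇐ n (proj₂ nonzero n le)
        ; scale      = gauge-scale
        ; expansion  = expansion
        }
        where
        expansion : ∀ r → (λ n (a#0 : A-total n # 0#) →
                             inverse a#0 * expand f n - ∑ (map (λ k → V-total k * gauge n a#0 k)
                               (upTo (suc r))))
                          =O (λ n a#0 → gauge n a#0 (suc r))
        -- The gauge of index r + 1 contains 1 / (r + 1)!, which the factorial in the constant
        -- undoes; the threshold also ensures r + 1 ≤ n, as `∣gauge∣` requires.
        expansion r = K * fromℕ (suc r !) , suc r ℕ.⊔ N , λ n le a#0 →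
          let r<n = ℕ.m⊔n≤o⇒m≤o (suc r) N le
              z   = ratio-scale n a#0
          in ≤-resp (∣∣-cong (sym (remainder r n a#0 (ℕ.<⇒≤ r<n))))
               (trans (rearrange z (a (n ∸ suc r))) (*-congˡ (sym (∣gauge∣ n a#0 (suc r) r<n))))
               (≤-trans (∣∣-* z _) (*-mono-≤ (0≤∣∣ z) (≤-trans (0≤∣∣ _) (p n (ℕ.m⊔n≤o⇒n≤o (suc r) N le)))
                 (≤-reflexive (∣∣-nonneg (<⇒≤ (ratio-scale-pos n a#0)))) (p n (ℕ.m⊔n≤o⇒n≤o (suc r) N le))))
          where
          estimate : Negligible (suc r) (f ⊞ ⊟ truncated (suc r) d a)
          estimate = f-expansion (suc r)
          K : R
          K = Negligible.constant estimate
          N : ℕ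
          N = Negligible.threshold estimate
          p : ∀ n → N ℕ.≤ n → ∣ f n - truncated (suc r) d a n ∣ ≤ K * a (n ∸ suc r)
          p = Negligible.bound estimate
          rearrange : ∀ z x → z * (K * x) ≈ (K * fromℕ (suc r !)) * (z * (1/ (suc r) * x))
          rearrange z x = sym (trans (solve 5 (λ k f z i x → (k :* f) :* (z :* (i :* x)) := (f :* i) :*
            (z :* (k :* x))) ≈-refl K (fromℕ (suc r !)) z (1/ (suc r)) x)
            (*-inverse-cancel (fromℕ!#0 (suc r)) _))

theorem3p8 :
  ∀ {c ℓ₁ ℓ₂ : Level} (ℝ : RealNumbers c ℓ₁ ℓ₂) →
    let open OverReals ℝ in
    (F : Family)
    (A B : Species) (A-summable : Summable A) (B-summable : Summable B) →
    (∀ {U} → FinSet.size U ≡ 0 → ¬ Species.Structure B U) →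
    (A≅F⊚B : A ≅ species F ⊚ B) →
    GargantuanSpecies A A-summable →
    (m : ℕ) →
    let a : ℕ → R
        a = totalWeight A A-summable
    in
    Σ[ 𝔡-summable ∈ Summableᵛ (𝔡 F B m) ]
    Σ[ ℙ ∈ (∀ n (a#0 : a n # 0#) → ∃ (IsProbability A A-summable n a#0 (InRestriction A≅F⊚B m))) ]
      AsymptoticExpansion
        (λ n a#0 → proj₁ (ℙ n a#0))
        (totalWeightᵛ (𝔡 F B m) 𝔡-summable)
        (λ k n a#0 → fromℕ (n C k) * divide (a (n ∸ k)) a#0)
theorem3p8 ℝ F A B A-summable B-summable B[∅]=∅ A≅F⊚B gargantuan m =
  VirtualSeries.summable V ,
  (λ n a#0 → _ , probability A≅F⊚B A-summable n a#0 m (atSize-series {B} B[∅]=∅ {b} b-series F m [ n ])) ,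
  asymptotics A A-summable gargantuan {𝔡 F B m} {multiplicity F m ⊡ b ↑ m} {𝔡-series F b m}
    (restricted-expansion A A-summable gargantuan F (series-nonneg {B} b-series)
      (constant-term {B} B[∅]=∅ {b} b-series) a-sum m) V
  where
  open OverReals ℝ using (species; 𝔡)
  open OrderedField ℝ using (commutativeRing; _*_)
  open PowerSeries commutativeRing
  open WeightedSums ℝ
  open SpeciesSums ℝ
  open Totals ℝ
  open Asymptotics ℝ
  b : Series
  b = normalised B B-summable
  b-series : HasSeries B b
  b-series = hasSeries B B-summable
  V : VirtualSeries (𝔡 F B m) (𝔡-series F b m)
  V = 𝔡-virtualSeries F {B} {b} b-series m
  -- Both sides are series of A, the right one through the isomorphism with the composition, and a
  -- species has only one series because sums are unique.
  a-sum : normalised A A-summable ≋ (λ n → Σ< (suc n) (λ k → multiplicity F k * (b ↑ k) n))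
  a-sum = HasSeries-unique {A} (hasSeries A A-summable) λ U →
    HasSum-⇿ (⇿-sym (isomorphic-⇿ A≅F⊚B U)) (composite-series {B} B[∅]=∅ {b} b-series F U)
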